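{- Let $\mathbf w\in\mathbb{Z}^{m}$ be an integer vector indexed by $E(G)$, and for a positive integer $q$ let $w=[\mathbf w]_q:E(G)\to\mathbb{Z}_q$. The following hold. (1) For every positive integer $q$, $$\#C(G,w;\mathbb{Z}_q)=\sum_{S\subseteq E(G)}(-1)^{|S|}\tilde{d}_S(q)\,q^{c(G|S)}.$$ Moreover, there exists a polynomial $\chi(G,w;t)$ (depending on $G$, its orientation and $\mathbf w$) such that $\#C(G,w;\mathbb{Z}_q)=\chi(G,w;q)$ for all integers $q>q_{\mathbf w}$, and $\chi(G,w;t)$ can be written as $$\chi(G,w;t)=\sum_{S\subseteq E(G),\ r([M_G^T,\mathbf w]_S)=r(G|S)}(-1)^{|S|}t^{c(G|S)}.$$ (2) $\chi(G,w;t)=\chi(\mathcal{A}_{(G,\mathbf w)},t)$. (3) For any positive integers $p,q$, with $w=[\mathbf w]_q$ and $w'=[\mathbf w]_{pq}$, we have $\#C(G,w;\mathbb{Z}_q)\le \#C(G,w';\mathbb{Z}_{pq})$.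
   Context: $G$ is a finite graph, multiple edges and loops allowed, with vertex set $V(G)=\{1,\dots,n\}$ and $m=|E(G)|$ edges, equipped with a fixed orientation. For $S\subseteq E(G)$, $G|S$ is the spanning subgraph with edge set $S$, $c(G|S)$ is its number of connected components, and $r(G|S)=|V(G)|-c(G|S)$. $\mathbb{Z}_q=\mathbb{Z}/q\mathbb{Z}$ and $[\cdot]_q$ denotes entrywise reduction modulo $q$. For $w:E(G)\to\mathbb{Z}_q$, a $(\mathbb{Z}_q,w)$-coloring of $G$ is a map $c:V(G)\to\mathbb{Z}_q$ such that for each edge $e$ oriented from $u$ to $v$ one has $c(v)-c(u)\ne w(e)$. $C(G,w;\mathbb{Z}_q)$ is the set of all $(\mathbb{Z}_q,w)$-colorings. The incidence matrix $M_G=(m_{ve})$ is the $n\times m$ matrix with $m_{ve}=1$ if $e$ is a non-loop edge with head $v$, $-1$ if $e$ is a non-loop edge with tail $v$, and $0$ otherwise. $[M_G^T,\mathbf w]$ is $M_G^T$ augmented by the column $\mathbf w$; for $S\subseteq E(G)$, $[M_G^T,\mathbf w]_S$ is its submatrix of rows indexed by $S$, and $r(\cdot)$ of a matrix is its rank. For an integer matrix $N$ of positive rank, $d(N)$ is its largest invariant factor (the last nonzero diagonal entry of its Smith normal form, taken positive). Put $$q_{\mathbf w}=\max\{d([M_G^T,\mathbf w]_S): S\subseteq E(G),\ r([M_G^T,\mathbf w]_S)\ne r(G|S)\}$$ (with $q_{\mathbf w}=0$ if there is no such $S$). Let $\tilde d_S(q)=1$ if $r([M_G^T,\mathbf w]_S)=r(G|S)$;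 $\tilde d_S(q)=1$ if $r([M_G^T,\mathbf w]_S)\ne r(G|S)$ and $d([M_G^T,\mathbf w]_S)\equiv 0\pmod q$; and $\tilde d_S(q)=0$ otherwise. The affinographic arrangement $\mathcal{A}_{(G,\mathbf w)}$ in $\mathbb{R}^n$ consists of $H_e=\{\mathbf x\in\mathbb{R}^n: x_j-x_i=w_e\}$ for each edge $e$ oriented from $i$ to $j$ ($w_e$ the entry of $\mathbf w$ at $e$); for a loop $e$ this is $\mathbb{R}^n$ if $w_e=0$ and $\emptyset$ otherwise. Its characteristic polynomial is $\chi(\mathcal{A}_{(G,\mathbf w)},t)=\sum_{S}(-1)^{|S|}t^{\dim(\bigcap_{e\in S}H_e)}$, the sum over $S\subseteq E(G)$ with $\bigcap_{e\in S}H_e\ne\emptyset$ (the intersection for $S=\emptyset$ being $\mathbb{R}^n$). -}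

module Defs where

open import Algebra.Apartness.Bundles using (HeytingCommutativeRing; HeytingField)
open import Algebra.Bundles using (CommutativeRing)
import Algebra.Properties.Monoid.Mult as Mult
import Algebra.Properties.Semiring.Sum as Sum
open import Data.Bool.Base using (if_then_else_)
open import Data.Fin.Base as Fin using (Fin; zero; suc; toℕ; fromℕ<; finToFun; punchIn; punchOut)
import Data.Fin.Properties as Fin
open import Data.Fin.Subset as Subset using (Subset; inside; outside; _∈_)
open import Data.Integer.Base as ℤ using (ℤ; +_; -[1+_]; 0ℤ; 1ℤ; -1ℤ)
import Data.Integer.DivMod as ℤ
import Data.Integer.Properties as ℤ
open import Data.List.Base as List using (List; []; _∷_)
open import Data.List.Extrema.Nat using (max)
open import Data.List.Relation.Unary.All using (All; []; _∷_)
open import Data.List.Relation.Unary.AllPairs using (AllPairs; []; _∷_)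
open import Data.Nat.Base as ℕ using (ℕ; zero; suc; NonZero; _∸_)
import Data.Nat.Divisibility as ℕ
open import Data.Nat.Induction using (<-wellFounded)
import Data.Nat.Properties as ℕ
open import Data.Product.Base using (∃; ∃₂; _×_; _,_; proj₁; proj₂)
open import Data.Rational.Base as ℚ using (ℚ; 0ℚ; 1ℚ)
import Data.Rational.Properties as ℚ
open import Data.Sum.Base using (_⊎_; inj₁; inj₂; [_,_]′)
open import Data.Vec.Base using ([]; _∷_; here; there)
open import Data.Vec.Functional as Vector using (Vector; transpose)
open import Function.Base using (_∘_; id)
open import Function.Bundles using (Bijection; Equivalence; _⇔_; mk⇔)
open import Induction.WellFounded using (Acc; acc)
open import Level using (0ℓ; _⊔_)
import Level
open import Relation.Binary.Bundles using (Setoid)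
open import Relation.Binary.Construct.Closure.Equivalence as Eq using (EqClosure)
open import Relation.Binary.Core using (Rel)
open import Relation.Binary.Structures using (IsStrictPartialOrder)
open import Relation.Binary.PropositionalEquality as ≡ using (_≡_; _≢_; refl; sym; trans; cong; cong₂; subst; subst₂)
open import Relation.Nullary.Decidable using (Dec; yes; no; does; ¬?; decidable-stable)
open import Relation.Nullary.Negation using (¬_; contradiction)
open import Relation.Unary using (Pred)

------------------------------------------------------------------------
-- Graphs and connected components

-- An oriented finite multigraph on the vertices Fin n with edges Fin m;
-- the edge e is oriented from tail e to head e.
record Graph (n m : ℕ) : Set where
  field
    tail head : Fin m → Fin n

Adjacent : ∀ {n m} → Graph n m → Subset m → Rel (Fin n) 0ℓ
Adjacent G S u v = ∃ λ e → e ∈ S × Graph.tail G e ≡ u × Graph.head G e ≡ v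

Components : ∀ {n m} → Graph n m → Subset m → Setoid 0ℓ 0ℓ
Components G S = Eq.setoid (Adjacent G S)

-- Existence of the number of components: vertices are labelled, and
-- labels are merged one edge at a time.
module ComponentExistence where

  record Labelling {n} (R : Rel (Fin n) 0ℓ) (c : ℕ) : Set where
    field
      label    : Fin n → Fin c
      sound    : ∀ {u v} → R u v → label u ≡ label v
      complete : ∀ u v → label u ≡ label v → EqClosure R u v
      onto     : ∀ i → ∃ λ v → label v ≡ i
  open Labelling

  record Merge {c} (i j : Fin (suc c)) : Set where
    field
      merge   : Fin (suc c) → Fin c
      equates : merge i ≡ merge j
      kernel  : ∀ x y → merge x ≡ merge y → x ≡ y ⊎ (x ≡ i × y ≡ j) ⊎ (x ≡ j × y ≡ i)
      covers  : ∀ k → ∃ λ x → merge x ≡ k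

  mergeAt : ∀ {c} (i j : Fin (suc c)) → i ≢ j → Merge i j
  mergeAt {c} i j i≢j = record
    { merge = λ x → to x (i Fin.≟ x)
    ; equates = equates′ (i Fin.≟ i) (i Fin.≟ j)
    ; kernel = λ x y → kernel′ x y (i Fin.≟ x) (i Fin.≟ y)
    ; covers = λ k → punchIn i k , covers′ k (i Fin.≟ punchIn i k)
    }
    where
    to : ∀ x → Dec (i ≡ x) → Fin c
    to x (yes _)  = punchOut i≢j
    to x (no i≢x) = punchOut i≢x
    equates′ : (d : Dec (i ≡ i)) (d′ : Dec (i ≡ j)) → to i d ≡ to j d′
    equates′ (no i≢i) _        = contradiction refl i≢i
    equates′ (yes _)  (yes _)  = refl
    equates′ (yes _)  (no _)   = Fin.punchOut-cong i refl
    kernel′ : ∀ x y (d : Dec (i ≡ x)) (d′ : Dec (i ≡ y)) → to x d ≡ to y d′ →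
              x ≡ y ⊎ (x ≡ i × y ≡ j) ⊎ (x ≡ j × y ≡ i)
    kernel′ x y (yes p)  (yes q)  eq = inj₁ (trans (sym p) q)
    kernel′ x y (yes p)  (no q)   eq = inj₂ (inj₁ (sym p , sym (Fin.punchOut-injective i≢j q eq)))
    kernel′ x y (no p)   (yes q)  eq = inj₂ (inj₂ (Fin.punchOut-injective p i≢j eq , sym q))
    kernel′ x y (no p)   (no q)   eq = inj₁ (Fin.punchOut-injective p q eq)
    covers′ : ∀ k (d : Dec (i ≡ punchIn i k)) → to (punchIn i k) d ≡ k
    covers′ k (yes p) = contradiction (sym p) (Fin.punchInᵢ≢i i k)
    covers′ k (no p)  = trans (Fin.punchOut-cong i refl) (Fin.punchOut-punchIn i)

  addEdge : ∀ {n c} {R R′ : Rel (Fin n) 0ℓ} (s t : Fin n) →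
            (∀ {u v} → R u v → R′ u v) → R′ s t →
            (∀ {u v} → R′ u v → R u v ⊎ (s ≡ u × t ≡ v)) →
            Labelling R c → ∃ (Labelling R′)
  addEdge {n} {zero} s t _ _ _ L = contradiction (label L s) Fin.¬Fin0
  addEdge {n} {suc c} {R} {R′} s t old new cases L = decide (label L s Fin.≟ label L t)
    where
    old* : ∀ {u v} → EqClosure R u v → EqClosure R′ u v
    old* = Eq.map old
    decide : Dec (label L s ≡ label L t) → ∃ (Labelling R′)
    decide (yes p) = suc c , record
      { label = label L
      ; sound = [ sound L , (λ where (refl , refl) → p) ]′ ∘ cases
      ; complete = λ u v → old* ∘ complete L u v
      ; onto = onto L
      }
    decide (no s≢t) = c , record
      { label = merge ∘ label L
      ; sound = [ cong merge ∘ sound L , (λ where (refl , refl) → equates) ]′ ∘ cases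
      ; complete = λ u v eq → connect u v (kernel (label L u) (label L v) eq)
      ; onto = λ i → proj₁ (onto L (proj₁ (covers i))) ,
                     trans (cong merge (proj₂ (onto L (proj₁ (covers i))))) (proj₂ (covers i))
      }
      where
      open Merge (mergeAt _ _ s≢t)
      via : ∀ u v → label L u ≡ label L s → label L v ≡ label L t → EqClosure R′ u v
      via u v p q = Eq.transitive R′ (old* (complete L u s p))
        (Eq.transitive R′ (Eq.return new) (old* (complete L t v (sym q))))
      connect : ∀ u v → label L u ≡ label L v ⊎ (label L u ≡ label L s × label L v ≡ label L t) ⊎
                        (label L u ≡ label L t × label L v ≡ label L s) → EqClosure R′ u v
      connect u v (inj₁ p)              = old* (complete L u v p)
      connect u v (inj₂ (inj₁ (p , q))) = via u v p q
      connect u v (inj₂ (inj₂ (p , q))) = Eq.symmetric R′ (via v u q p)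

  restrict : ∀ {n m} → Graph n (suc m) → Graph n m
  restrict G = record { tail = Graph.tail G ∘ suc ; head = Graph.head G ∘ suc }

  labelling : ∀ {n m} (G : Graph n m) (S : Subset m) → ∃ (Labelling (Adjacent G S))
  labelling {n} G [] = n , record
    { label = id ; sound = (λ where (() , _)) ; complete = λ u v → (λ where refl → Eq.reflexive _) ; onto = λ i → i , refl }
  labelling G (outside ∷ S) = proj₁ L , record
    { label = label (proj₂ L)
    ; sound = λ where (suc e , there e∈S , p) → sound (proj₂ L) (e , e∈S , p)
    ; complete = λ u v → Eq.map (λ where (e , e∈S , p) → suc e , there e∈S , p) ∘ complete (proj₂ L) u v
    ; onto = onto (proj₂ L)
    }
    where
    L : ∃ (Labelling (Adjacent (restrict G) S))
    L = labelling (restrict G) S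
  labelling G (inside ∷ S) = addEdge (Graph.tail G zero) (Graph.head G zero)
    (λ where (e , e∈S , p) → suc e , there e∈S , p)
    (zero , here , refl , refl)
    (λ where (zero , _ , p) → inj₂ p
             (suc e , there e∈S , p) → inj₁ (e , e∈S , p))
    (proj₂ (labelling (restrict G) S))

  abstract
    components : ∀ {n m} (G : Graph n m) (S : Subset m) → ∃ λ c → Bijection (Components G S) (≡.setoid (Fin c))
    components G S = proj₁ (labelling G S) , record
      { to = label L
      ; cong = Eq.gfold ≡.isEquivalence (label L) (sound L)
      ; bijective = complete L _ _ , λ i → proj₁ (onto L i) , λ p → trans (Eq.gfold ≡.isEquivalence (label L) (sound L) p) (proj₂ (onto L i))
      }
      where
      L : Labelling (Adjacent G S) (proj₁ (labelling G S))
      L = proj₂ (labelling G S)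

-- c(G|S)
numComponents : ∀ {n m} → Graph n m → Subset m → ℕ
numComponents G S = proj₁ (ComponentExistence.components G S)

-- r(G|S); the truncated subtraction is exact, as c(G|S) ≤ n.
graphRank : ∀ {n m} → Graph n m → Subset m → ℕ
graphRank {n} G S = n ∸ numComponents G S

------------------------------------------------------------------------
-- Colorings with values in ℤ/qℤ

module _ (q : ℕ) .{{_ : NonZero q}} where

  -- ℤ/qℤ is represented by Fin q.
  residue : ℤ → Fin q
  residue z = fromℕ< (ℤ.n%ℕd<d z q)

  subMod : Fin q → Fin q → Fin q
  subMod a b = residue (+ toℕ a ℤ.- + toℕ b)

  reduce : ∀ {m} → Vector ℤ m → Vector (Fin q) m
  reduce 𝐰 e = residue (𝐰 e)

  module _ {n m} (G : Graph n m) (w : Vector (Fin q) m) where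
    open Graph G

    IsColoring : Pred (Vector (Fin q) n) 0ℓ
    IsColoring c = ∀ e → subMod (c (head e)) (c (tail e)) ≢ w e

    isColoring? : ∀ c → Dec (IsColoring c)
    isColoring? c = Fin.all? λ e → ¬? (subMod (c (head e)) (c (tail e)) Fin.≟ w e)

    -- finToFun enumerates all maps Fin n → Fin q exactly once.
    colorings : List (Vector (Fin q) n)
    colorings = List.filter isColoring? (List.map finToFun (List.allFin (q ℕ.^ n)))

    numColorings : ℕ
    numColorings = List.length colorings

------------------------------------------------------------------------
-- Integer matrices and the Smith normal form

Matrix : Set → ℕ → ℕ → Set
Matrix A k n = Vector (Vector A n) k

module IntegerMatrix where
  open import Data.Integer.Base using (_+_; _*_)
  open Sum ℤ.+-*-semiring using (sum)
  open import Data.Integer.Divisibility.Signed using (_∣_)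

  infix  4 _≋_ _~_
  infixl 7 _⊗_

  _≋_ : ∀ {k n} → Matrix ℤ k n → Matrix ℤ k n → Set
  M ≋ N = ∀ i j → M i j ≡ N i j

  _⊗_ : ∀ {k l n} → Matrix ℤ k l → Matrix ℤ l n → Matrix ℤ k n
  (M ⊗ N) i j = sum λ t → M i t * N t j

  I : ∀ {k} → Matrix ℤ k k
  I i j = if does (i Fin.≟ j) then 1ℤ else 0ℤ

  -- Invertible over ℤ, i.e. of determinant ±1.
  Unimodular : ∀ {k} → Matrix ℤ k k → Set
  Unimodular U = ∃ λ V → U ⊗ V ≋ I × V ⊗ U ≋ I

  record _~_ {k n} (M N : Matrix ℤ k n) : Set where
    constructor equivalent
    field
      U            : Matrix ℤ k k
      V            : Matrix ℤ n n
      U-unimodular : Unimodular U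
      V-unimodular : Unimodular V
      equation     : U ⊗ M ⊗ V ≋ N

  diagonal : ∀ {k n} → Matrix ℤ k n → List ℤ
  diagonal {suc k} {suc n} D = D zero zero ∷ diagonal (λ i j → D (suc i) (suc j))
  diagonal {_}     {_}     D = []

  -- Signs of the diagonal entries are not normalised.
  IsSmith : ∀ {k n} → Matrix ℤ k n → Set
  IsSmith D = (∀ i j → toℕ i ≢ toℕ j → D i j ≡ 0ℤ) × AllPairs _∣_ (diagonal D)

-- Every integer matrix has a Smith normal form, by Euclidean row and
-- column operations.
module SmithExistence where
  open IntegerMatrix
  open import Data.Integer.Base using (-_; _+_; _-_; _*_; ∣_∣; ≢-nonZero)
  open import Data.Integer.Divisibility.Signed using (_∣_; divides; _∣?_; ∣m∣n⇒∣m+n; ∣m+n∣n⇒∣m; ∣m⇒∣m*n; ∣n⇒∣m*n)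
  open import Data.Integer.Tactic.RingSolver using (solve-∀)
  open Sum ℤ.+-*-semiring
  open ≡

  sum-zero : ∀ {k} (f : Vector ℤ k) → (∀ i → f i ≡ 0ℤ) → sum f ≡ 0ℤ
  sum-zero {zero}  f z = refl
  sum-zero {suc k} f z = cong₂ _+_ (z zero) (sum-zero (f ∘ suc) (z ∘ suc))

  I-refl : ∀ {k} (i : Fin k) → I i i ≡ 1ℤ
  I-refl i with i Fin.≟ i
  ... | yes _ = refl
  ... | no ¬p = contradiction refl ¬p

  I-≢ : ∀ {k} {i j : Fin k} → i ≢ j → I i j ≡ 0ℤ
  I-≢ {i = i} {j} i≢j with i Fin.≟ j
  ... | yes p = contradiction p i≢j
  ... | no _  = refl

  I-sym : ∀ {k} (i j : Fin k) → I i j ≡ I j i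
  I-sym i j with i Fin.≟ j
  ... | yes refl = sym (I-refl i)
  ... | no i≢j   = sym (I-≢ (i≢j ∘ sym))

  sum-I : ∀ {k} (i : Fin k) (f : Vector ℤ k) → (sum λ t → I i t * f t) ≡ f i
  sum-I {suc k} zero f = trans (cong (_+_ (1ℤ * f zero)) (sum-zero {k} _ λ t → refl)) (one (f zero))
    where
    one : ∀ x → 1ℤ * x + 0ℤ ≡ x
    one = solve-∀
  sum-I {suc k} (suc i) f = trans (ℤ.+-identityˡ _) (sum-I i (f ∘ suc))

  ⊗-cong : ∀ {k l n} {A A′ : Matrix ℤ k l} {B B′ : Matrix ℤ l n} → A ≋ A′ → B ≋ B′ → A ⊗ B ≋ A′ ⊗ B′
  ⊗-cong p q i j = sum-cong-≗ λ t → cong₂ _*_ (p i t) (q t j)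

  ⊗-assoc : ∀ {k l m n} (A : Matrix ℤ k l) (B : Matrix ℤ l m) (C : Matrix ℤ m n) → (A ⊗ B) ⊗ C ≋ A ⊗ (B ⊗ C)
  ⊗-assoc A B C i j = begin
    (sum λ t → (sum λ s → A i s * B s t) * C t j)
      ≡⟨ sum-cong-≗ (λ t → *-distribʳ-sum (C t j) (λ s → A i s * B s t)) ⟩
    (sum λ t → sum λ s → A i s * B s t * C t j)
      ≡⟨ ∑-comm (λ t s → A i s * B s t * C t j) ⟩
    (sum λ s → sum λ t → A i s * B s t * C t j)
      ≡⟨ sum-cong-≗ (λ s → trans (sum-cong-≗ λ t → ℤ.*-assoc (A i s) (B s t) (C t j)) (sym (*-distribˡ-sum (A i s) (λ t → B s t * C t j)))) ⟩
    (sum λ s → A i s * (sum λ t → B s t * C t j)) ∎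
    where open ≡-Reasoning

  ⊗-transpose : ∀ {k l n} (A : Matrix ℤ k l) (B : Matrix ℤ l n) → transpose B ⊗ transpose A ≋ transpose (A ⊗ B)
  ⊗-transpose A B i j = sum-cong-≗ λ t → ℤ.*-comm (B t i) (A j t)

  I⊗ : ∀ {k n} (A : Matrix ℤ k n) → I ⊗ A ≋ A
  I⊗ A i j = sum-I i (λ t → A t j)

  ⊗I : ∀ {k n} (A : Matrix ℤ k n) → A ⊗ I ≋ A
  ⊗I A i j = trans (sum-cong-≗ λ t → trans (ℤ.*-comm (A i t) (I t j)) (cong (_* A i t) (I-sym t j))) (sum-I j (A i))

  infixr 2 _∙_
  _∙_ : ∀ {k n} {A B C : Matrix ℤ k n} → A ≋ B → B ≋ C → A ≋ C
  (p ∙ q) i j = trans (p i j) (q i j)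

  ≋-refl : ∀ {k n} {A : Matrix ℤ k n} → A ≋ A
  ≋-refl i j = refl

  ≋-sym : ∀ {k n} {A B : Matrix ℤ k n} → A ≋ B → B ≋ A
  ≋-sym p i j = sym (p i j)

  I-unimodular : ∀ {k} → Unimodular (I {k})
  I-unimodular = I , I⊗ I , I⊗ I

  cancel : ∀ {k} (A B A′ B′ : Matrix ℤ k k) → A ⊗ A′ ≋ I → B ⊗ B′ ≋ I → (A ⊗ B) ⊗ (B′ ⊗ A′) ≋ I
  cancel A B A′ B′ p q = ⊗-assoc A B (B′ ⊗ A′) ∙ ⊗-cong {A = A} ≋-refl (≋-sym (⊗-assoc B B′ A′) ∙ ⊗-cong {B = A′} q ≋-refl ∙ I⊗ A′) ∙ p

  ⊗-unimodular : ∀ {k} {A B : Matrix ℤ k k} → Unimodular A → Unimodular B → Unimodular (A ⊗ B)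
  ⊗-unimodular {A = A} {B} (A′ , p , p′) (B′ , q , q′) = B′ ⊗ A′ , cancel A B A′ B′ p q , cancel B′ A′ B A q′ p′

  transpose-unimodular : ∀ {k} {A : Matrix ℤ k k} → Unimodular A → Unimodular (transpose A)
  transpose-unimodular {A = A} (B , p , q) = transpose B ,
    (⊗-transpose B A ∙ λ i j → trans (q j i) (I-sym j i)) ,
    (⊗-transpose A B ∙ λ i j → trans (p j i) (I-sym j i))

  ≋⇒~ : ∀ {k n} {A B : Matrix ℤ k n} → A ≋ B → A ~ B
  ≋⇒~ {A = A} p = equivalent I I I-unimodular I-unimodular (⊗I (I ⊗ A) ∙ I⊗ A ∙ p)

  ~-trans : ∀ {k n} {A B C : Matrix ℤ k n} → A ~ B → B ~ C → A ~ C
  ~-trans {A = A} {B} {C} (equivalent U V u v p) (equivalent U′ V′ u′ v′ p′) =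
    equivalent (U′ ⊗ U) (V ⊗ V′) (⊗-unimodular u′ u) (⊗-unimodular v v′)
    (≋-sym (⊗-assoc (U′ ⊗ U ⊗ A) V V′) ∙
     ⊗-cong {B = V′} (⊗-cong {B = V} (⊗-assoc U′ U A) ≋-refl ∙ ⊗-assoc U′ (U ⊗ A) V ∙ ⊗-cong {A = U′} ≋-refl p) ≋-refl ∙ p′)

  ~-transpose : ∀ {k n} {A B : Matrix ℤ k n} → A ~ B → transpose A ~ transpose B
  ~-transpose {A = A} {B} (equivalent U V u v p) =
    equivalent (transpose V) (transpose U) (transpose-unimodular v) (transpose-unimodular u)
    (⊗-assoc (transpose V) (transpose A) (transpose U) ∙
     ⊗-cong {A = transpose V} ≋-refl (⊗-transpose U A) ∙ ⊗-transpose (U ⊗ A) V ∙ λ i j → p j i)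

  ∣-sum : ∀ {g k} (f : Vector ℤ k) → (∀ i → g ∣ f i) → g ∣ sum f
  ∣-sum {k = zero}  f d = divides 0ℤ refl
  ∣-sum {k = suc k} f d = ∣m∣n⇒∣m+n (d zero) (∣-sum (f ∘ suc) (d ∘ suc))

  _∣ᴹ_ : ∀ {k n} → ℤ → Matrix ℤ k n → Set
  g ∣ᴹ A = ∀ i j → g ∣ A i j

  ∣-⊗ : ∀ {g k n} {A B : Matrix ℤ k n} → A ~ B → g ∣ᴹ A → g ∣ᴹ B
  ∣-⊗ {A = A} (equivalent U V _ _ p) d i j =
    subst (_ ∣_) (p i j) (∣-sum _ λ t → ∣m⇒∣m*n (V t j) (∣-sum _ λ s → ∣n⇒∣m*n (U i s) (d s t)))

  shear : ∀ {k n} → Vector ℤ k → Fin k → Matrix ℤ k n → Matrix ℤ k n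
  shear s p A i j = A i j + s i * A p j

  shear-⊗ : ∀ {k n} (s : Vector ℤ k) p (A : Matrix ℤ k n) → shear s p I ⊗ A ≋ shear s p A
  shear-⊗ s p A i j = begin
    (sum λ t → (I i t + s i * I p t) * A t j)
      ≡⟨ sum-cong-≗ (λ t → ring₁ (I i t) (s i) (I p t) (A t j)) ⟩
    (sum λ t → I i t * A t j + s i * (I p t * A t j))
      ≡⟨ ∑-distrib-+ (λ t → I i t * A t j) (λ t → s i * (I p t * A t j)) ⟩
    (sum λ t → I i t * A t j) + (sum λ t → s i * (I p t * A t j))
      ≡⟨ cong₂ _+_ (sum-I i (λ t → A t j)) (trans (sym (*-distribˡ-sum (s i) (λ t → I p t * A t j))) (cong (s i *_) (sum-I p (λ t → A t j)))) ⟩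
    A i j + s i * A p j ∎
    where
    open ≡-Reasoning
    ring₁ : ∀ a b c d → (a + b * c) * d ≡ a * d + b * (c * d)
    ring₁ = solve-∀

  shear-inverse : ∀ {k} (s : Vector ℤ k) p → s p ≡ 0ℤ → shear s p I ⊗ shear (-_ ∘ s) p I ≋ I
  shear-inverse s p sp≡0 i j = begin
    (shear s p I ⊗ shear (-_ ∘ s) p I) i j ≡⟨ shear-⊗ s p (shear (-_ ∘ s) p I) i j ⟩
    (I i j + - s i * I p j) + s i * (I p j + - s p * I p j) ≡⟨ cong (λ x → (I i j + - s i * I p j) + s i * (I p j + - x * I p j)) sp≡0 ⟩
    (I i j + - s i * I p j) + s i * (I p j + 0ℤ * I p j) ≡⟨ ring₁ (I i j) (s i) (I p j) ⟩
    I i j ∎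
    where
    open ≡-Reasoning
    ring₁ : ∀ a b c → (a + - b * c) + b * (c + 0ℤ * c) ≡ a
    ring₁ = solve-∀

  ~-shear : ∀ {k n} (s : Vector ℤ k) p (A : Matrix ℤ k n) → s p ≡ 0ℤ → A ~ shear s p A
  ~-shear s p A sp≡0 = equivalent (shear s p I) I
    (shear (-_ ∘ s) p I , shear-inverse s p sp≡0 ,
      λ i j → trans (⊗-cong {A = shear (-_ ∘ s) p I} ≋-refl (λ i j → cong (λ x → I i j + x * I p j) (sym (ℤ.neg-involutive (s i)))) i j)
                    (shear-inverse (-_ ∘ s) p (cong -_ sp≡0) i j))
    I-unimodular (⊗I _ ∙ shear-⊗ s p A)

  -- Adding x times row p to row i.
  RowAdded : ∀ {k n} → Matrix ℤ k n → Fin k → Fin k → ℤ → Set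
  RowAdded A i p x = ∃ λ B → A ~ B × (∀ j → B i j ≡ A i j + x * A p j) × (∀ g → g ∣ᴹ A → g ∣ᴹ B)

  abstract
    addRow : ∀ {k n} (i p : Fin k) → i ≢ p → (x : ℤ) (A : Matrix ℤ k n) → RowAdded A i p x
    addRow {k} {n} i p i≢p x A = B , A~B , Bi , λ g → ∣-⊗ A~B
      where
      s : Vector ℤ k
      s a = x * I a i
      B : Matrix ℤ k n
      B = shear s p A
      A~B : A ~ B
      A~B = ~-shear s p A (trans (cong (x *_) (I-≢ (i≢p ∘ sym))) (ℤ.*-zeroʳ x))
      Bi : ∀ j → B i j ≡ A i j + x * A p j
      Bi j = cong (λ y → A i j + y * A p j) (trans (cong (x *_) (I-refl i)) (ℤ.*-identityʳ x))

  _∣ᴹ?_ : ∀ {k n} (g : ℤ) (A : Matrix ℤ k n) → (g ∣ᴹ A) ⊎ (∃₂ λ i j → ¬ g ∣ A i j)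
  g ∣ᴹ? A with Fin.any? (λ i → Fin.any? λ j → ¬? (g ∣? A i j))
  ... | yes (i , j , ∤) = inj₂ (i , j , ∤)
  ... | no none = inj₁ λ i j → decidable-stable (g ∣? A i j) λ ∤ → none (i , j , ∤)

  divMod : ∀ a g → g ≢ 0ℤ → ∃₂ λ q r → a ≡ r + q * g × ∣ r ∣ ℕ.< ∣ g ∣
  divMod a g g≢0 = a ℤ./ g , + (a ℤ.% g) , ℤ.a≡a%n+[a/n]*n a g , ℤ.n%d<d a g
    where instance _ = ≢-nonZero g≢0

  cancelQuotient : ∀ q r g → (r + q * g) + (- q) * g ≡ r
  cancelQuotient = solve-∀

  -- One Euclidean division step inside the column of the pivot A p q.
  Reduced : ∀ {k n} → Matrix ℤ k n → (i p : Fin k) (j q : Fin n) → Set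
  Reduced A i p j q = ∃ λ B → A ~ B × B i j ≢ 0ℤ × ∣ B i j ∣ ℕ.< ∣ A p q ∣

  abstract
    reduceRow : ∀ {k n} (A : Matrix ℤ k n) i p q → A p q ≢ 0ℤ → ¬ A p q ∣ A i q → Reduced A i p q q
    reduceRow A i p q g≢0 g∤ = step (divMod (A i q) (A p q) g≢0)
      where
      i≢p : i ≢ p
      i≢p refl = g∤ (divides 1ℤ (sym (ℤ.*-identityˡ _)))
      step : (∃₂ λ d r → A i q ≡ r + d * A p q × ∣ r ∣ ℕ.< ∣ A p q ∣) → Reduced A i p q q
      step (d , r , eq , r<) = finish (addRow i p i≢p (- d) A)
        where
        finish : RowAdded A i p (- d) → Reduced A i p q q
        finish (B , A~B , B-row , _) = B , A~B , B≢0 , subst (ℕ._< ∣ A p q ∣) (sym (cong ∣_∣ Biq)) r<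
          where
          Biq : B i q ≡ r
          Biq = trans (B-row q) (trans (cong (_+ (- d) * A p q) eq) (cancelQuotient d r (A p q)))
          B≢0 : B i q ≢ 0ℤ
          B≢0 B≡0 = g∤ (divides d (trans eq (trans (cong (_+ d * A p q) (trans (sym Biq) B≡0)) (ℤ.+-identityˡ _))))

    reduceCol : ∀ {k n} (A : Matrix ℤ k n) j p q → A p q ≢ 0ℤ → ¬ A p q ∣ A p j → Reduced A p p j q
    reduceCol A j p q g≢0 g∤ = flipped (reduceRow (transpose A) j q p g≢0 g∤)
      where
      flipped : Reduced (transpose A) j q p p → Reduced A p p j q
      flipped (B , A~B , B≢0 , B<) = transpose B , ~-transpose A~B , B≢0 , B<

  HasPivot : ∀ {k n} → Matrix ℤ k n → Set
  HasPivot A = ∃ λ B → A ~ B × ∃₂ λ p q → B p q ≢ 0ℤ × B p q ∣ᴹ B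

  abstract
    pivot : ∀ {k n} (A : Matrix ℤ k n) p q → A p q ≢ 0ℤ → Acc ℕ._<_ ∣ A p q ∣ → HasPivot A
    pivot {k} {n} A p q g≢0 (acc rec) with A p q ∣ᴹ? A
    ... | inj₁ g∣A = A , ≋⇒~ ≋-refl , p , q , g≢0 , g∣A
    ... | inj₂ (i , j , g∤) = go (A p q ∣? A i q) (A p q ∣? A p j)
      where
      compose : ∀ {B} → A ~ B → HasPivot B → HasPivot A
      compose A~B (C , B~C , rest) = C , ~-trans A~B B~C , rest
      continue : ∀ i j → Reduced A i p j q → HasPivot A
      continue i j (B , A~B , B≢0 , B<) = compose A~B (pivot B i j B≢0 (rec B<))

      go : Dec (A p q ∣ A i q) → Dec (A p q ∣ A p j) → HasPivot A
      go (no g∤i) _        = continue i q (reduceRow A i p q g≢0 g∤i)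
      go (yes _)  (no g∤j) = continue p j (reduceCol A j p q g≢0 g∤j)
      go (yes (divides s eq)) (yes g∣j) = continue i j (prepend (reduceCol B j i q Biq≢0 Biq∤))
        where
        i≢p : i ≢ p
        i≢p refl = g∤ g∣j
        added : RowAdded A i p (1ℤ - s)
        added = addRow i p i≢p (1ℤ - s) A
        B : Matrix ℤ k n
        B = proj₁ added
        A~B : A ~ B
        A~B = proj₁ (proj₂ added)
        B-row : ∀ j → B i j ≡ A i j + (1ℤ - s) * A p j
        B-row = proj₁ (proj₂ (proj₂ added))
        ring₁ : ∀ s g → s * g + (1ℤ - s) * g ≡ g
        ring₁ = solve-∀
        Biq : B i q ≡ A p q
        Biq = trans (B-row q) (trans (cong (_+ (1ℤ - s) * A p q) eq) (ring₁ s (A p q)))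
        Biq≢0 : B i q ≢ 0ℤ
        Biq≢0 = g≢0 ∘ trans (sym Biq)
        Biq∤ : ¬ B i q ∣ B i j
        Biq∤ d = g∤ (∣m+n∣n⇒∣m (subst₂ _∣_ Biq (B-row j) d) (∣n⇒∣m*n (1ℤ - s) g∣j))
        prepend : Reduced B i i j q → Reduced A i p j q
        prepend (C , B~C , C≢0 , C<) = C , ~-trans A~B B~C , C≢0 , subst (λ x → _ ℕ.< ∣ x ∣) Biq C<

  RowMoved : ∀ {k n} → Matrix ℤ (suc k) n → Fin (suc k) → Fin n → Set
  RowMoved A p q = ∃ λ B → A ~ B × B zero q ≡ A p q × A p q ∣ᴹ B

  ColCleared : ∀ {k n} → Matrix ℤ (suc k) (suc n) → Set
  ColCleared A =
    ∃ λ B → A ~ B × (∀ j → B zero j ≡ A zero j) × (∀ i → B (suc i) zero ≡ 0ℤ) × A zero zero ∣ᴹ B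

  abstract
    moveRow : ∀ {k n} (A : Matrix ℤ (suc k) n) p q → A p q ∣ᴹ A → RowMoved A p q
    moveRow A zero    q g∣A = A , ≋⇒~ ≋-refl , refl , g∣A
    moveRow {k} A p@(suc p′) q g∣A = move (g∣A zero q)
      where
      ring₁ : ∀ s g → s * g + (1ℤ - s) * g ≡ g
      ring₁ = solve-∀
      move : A p q ∣ A zero q → RowMoved A p q
      move (divides s eq) = finish (addRow zero p (λ ()) (1ℤ - s) A)
        where
        finish : RowAdded A zero p (1ℤ - s) → RowMoved A p q
        finish (B , A~B , B-row , g∣B) = B , A~B , B₀q , g∣B (A p q) g∣A
          where
          B₀q : B zero q ≡ A p q
          B₀q = trans (B-row q) (trans (cong (_+ (1ℤ - s) * A p q) eq) (ring₁ s (A p q)))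

    clearCol : ∀ {k n} (A : Matrix ℤ (suc k) (suc n)) → A zero zero ∣ᴹ A → ColCleared A
    clearCol {k} {n} A g∣A = shear s zero A , A~B ,
      (λ j → ℤ.+-identityʳ (A zero j)) , (λ i → zeros i (g∣A (suc i) zero) refl) , ∣-⊗ A~B g∣A
      where
      s : Vector ℤ (suc k)
      s zero    = 0ℤ
      s (suc i) = - _∣_.quotient (g∣A (suc i) zero)
      A~B : A ~ shear s zero A
      A~B = ~-shear s zero A refl
      ring₁ : ∀ q g → q * g + (- q) * g ≡ 0ℤ
      ring₁ = solve-∀
      zeros : ∀ i (d : A zero zero ∣ A (suc i) zero) → s (suc i) ≡ - _∣_.quotient d →
              A (suc i) zero + s (suc i) * A zero zero ≡ 0ℤ
      zeros i (divides q eq) s≡ =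
        trans (cong₂ (λ x y → x + y * A zero zero) eq s≡) (ring₁ q (A zero zero))

  block : ∀ {k n} → ℤ → Matrix ℤ k n → Matrix ℤ (suc k) (suc n)
  block g A zero    zero    = g
  block g A zero    (suc j) = 0ℤ
  block g A (suc i) zero    = 0ℤ
  block g A (suc i) (suc j) = A i j

  block-cong : ∀ {k n} {g h} {A B : Matrix ℤ k n} → g ≡ h → A ≋ B → block g A ≋ block h B
  block-cong p q zero    zero    = p
  block-cong p q zero    (suc j) = refl
  block-cong p q (suc i) zero    = refl
  block-cong p q (suc i) (suc j) = q i j

  block-⊗ : ∀ {k l n} g h (A : Matrix ℤ k l) (B : Matrix ℤ l n) → block g A ⊗ block h B ≋ block (g * h) (A ⊗ B)
  block-⊗ g h A B zero    zero    = trans (cong (_+_ (g * h)) (sum-zero (λ t → block g A zero (suc t) * block h B (suc t) zero) λ t → refl)) (ℤ.+-identityʳ _)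
  block-⊗ g h A B zero    (suc j) = cong₂ _+_ (ℤ.*-zeroʳ g) (sum-zero (λ t → block g A zero (suc t) * block h B (suc t) (suc j)) λ t → refl)
  block-⊗ g h A B (suc i) zero    = trans (ℤ.+-identityˡ _) (sum-zero (λ t → A i t * block h B (suc t) zero) λ t → ℤ.*-zeroʳ (A i t))
  block-⊗ g h A B (suc i) (suc j) = ℤ.+-identityˡ _

  block-I : ∀ {k} → block 1ℤ (I {k}) ≋ I
  block-I zero    zero    = refl
  block-I zero    (suc j) = refl
  block-I (suc i) zero    = refl
  block-I (suc i) (suc j) = refl

  block-unimodular : ∀ {k} {U : Matrix ℤ k k} → Unimodular U → Unimodular (block 1ℤ U)
  block-unimodular {U = U} (V , p , q) = block 1ℤ V ,
    (block-⊗ 1ℤ 1ℤ U V ∙ block-cong refl p ∙ block-I) ,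
    (block-⊗ 1ℤ 1ℤ V U ∙ block-cong refl q ∙ block-I)

  ~-block : ∀ {k n} g {A B : Matrix ℤ k n} → A ~ B → block g A ~ block g B
  ~-block g {A} {B} (equivalent U V u v p) =
    equivalent (block 1ℤ U) (block 1ℤ V) (block-unimodular u) (block-unimodular v) λ i j →
      trans (left i j) (trans (block-⊗ (1ℤ * g) 1ℤ (U ⊗ A) V i j) (block-cong unit p i j))
    where
    left : (block 1ℤ U ⊗ block g A) ⊗ block 1ℤ V ≋ block (1ℤ * g) (U ⊗ A) ⊗ block 1ℤ V
    left i j = sum-cong-≗ λ t → cong (_* block 1ℤ V t j) (block-⊗ 1ℤ g U A i t)
    unit : 1ℤ * g * 1ℤ ≡ g
    unit = trans (ℤ.*-identityʳ (1ℤ * g)) (ℤ.*-identityˡ g)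

  Split : ∀ {k n} → Matrix ℤ (suc k) (suc n) → Set
  Split A = ∃₂ λ g B → A ~ block g B × g ∣ᴹ B

  split-~ : ∀ {k n} {A B : Matrix ℤ (suc k) (suc n)} → A ~ B → Split B → Split A
  split-~ A~B (g , C , B~C , g∣C) = g , C , ~-trans A~B B~C , g∣C

  split-transpose : ∀ {k n} {A : Matrix ℤ (suc k) (suc n)} → Split (transpose A) → Split A
  split-transpose (g , C , A~C , g∣C) =
    g , transpose C , ~-trans (~-transpose A~C) (≋⇒~ shape) , λ i j → g∣C j i
    where
    shape : transpose (block g C) ≋ block g (transpose C)
    shape zero    zero    = refl
    shape zero    (suc j) = refl
    shape (suc i) zero    = refl
    shape (suc i) (suc j) = refl

  abstract
    split-cleared : ∀ {k n} (A : Matrix ℤ (suc k) (suc n)) → A zero zero ∣ᴹ A → (∀ i → A (suc i) zero ≡ 0ℤ) → (∀ j → A zero (suc j) ≡ 0ℤ) → Split A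
    split-cleared A g∣A col row = A zero zero , (λ i j → A (suc i) (suc j)) , ≋⇒~ shape , λ i j → g∣A (suc i) (suc j)
      where
      shape : A ≋ block (A zero zero) (λ i j → A (suc i) (suc j))
      shape zero    zero    = refl
      shape zero    (suc j) = row j
      shape (suc i) zero    = col i
      shape (suc i) (suc j) = refl

    split-row : ∀ {k n} (A : Matrix ℤ (suc k) (suc n)) → A zero zero ∣ᴹ A → (∀ j → A zero (suc j) ≡ 0ℤ) → Split A
    split-row A g∣A row = continue (clearCol A g∣A)
      where
      continue : ColCleared A → Split A
      continue (B , A~B , row′ , col , g∣B) = split-~ A~B
        (split-cleared B (λ i j → subst (_∣ B i j) (sym (row′ zero)) (g∣B i j)) col (λ j → trans (row′ (suc j)) (row j)))

    split-corner : ∀ {k n} (A : Matrix ℤ (suc k) (suc n)) → A zero zero ∣ᴹ A → Split A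
    split-corner A g∣A = continue (clearCol A g∣A)
      where
      continue : ColCleared A → Split A
      continue (B , A~B , row′ , col , g∣B) = split-~ A~B (split-transpose
        (split-row (transpose B) (λ i j → subst (_∣ B j i) (sym (row′ zero)) (g∣B j i)) col))

    split-top : ∀ {k n} (A : Matrix ℤ (suc k) (suc n)) q → A zero q ∣ᴹ A → Split A
    split-top A q g∣A = split-transpose (continue (moveRow (transpose A) q zero λ i j → g∣A j i))
      where
      continue : RowMoved (transpose A) q zero → Split (transpose A)
      continue (B , A~B , e , g∣B) = split-~ A~B (split-corner B λ i j → subst (_∣ B i j) (sym e) (g∣B i j))

    split : ∀ {k n} (A : Matrix ℤ (suc k) (suc n)) p q → A p q ≢ 0ℤ → Split A
    split A p q A≢0 = continue (pivot A p q A≢0 (<-wellFounded _))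
      where
      continue′ : ∀ {B} p q → A ~ B → RowMoved B p q → Split A
      continue′ p q A~B (C , B~C , e , g∣C) =
        split-~ (~-trans A~B B~C) (split-top C q λ i j → subst (_∣ C i j) (sym e) (g∣C i j))
      continue : HasPivot A → Split A
      continue (B , A~B , p , q , _ , g∣B) = continue′ p q A~B (moveRow B p q g∣B)

  All-diagonal : ∀ {k n} g (A : Matrix ℤ k n) → g ∣ᴹ A → All (g ∣_) (diagonal A)
  All-diagonal {zero}  {_}     g A d = []
  All-diagonal {suc k} {zero}  g A d = []
  All-diagonal {suc k} {suc n} g A d = d zero zero ∷ All-diagonal g _ λ i j → d (suc i) (suc j)

  zero-smith : ∀ {k n} (A : Matrix ℤ k n) → (∀ i j → A i j ≡ 0ℤ) → AllPairs _∣_ (diagonal A)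
  zero-smith {zero}  {_}     A z = []
  zero-smith {suc k} {zero}  A z = []
  zero-smith {suc k} {suc n} A z =
    All-diagonal _ _ (λ i j → divides 0ℤ (z (suc i) (suc j))) ∷ zero-smith _ λ i j → z (suc i) (suc j)

  block-offDiagonal : ∀ {k n} g {D : Matrix ℤ k n} → (∀ i j → toℕ i ≢ toℕ j → D i j ≡ 0ℤ) →
                      ∀ i j → toℕ i ≢ toℕ j → block g D i j ≡ 0ℤ
  block-offDiagonal g off zero    zero    i≢j = contradiction refl i≢j
  block-offDiagonal g off zero    (suc j) i≢j = refl
  block-offDiagonal g off (suc i) zero    i≢j = refl
  block-offDiagonal g off (suc i) (suc j) i≢j = off i j (i≢j ∘ cong suc)

  SmithForm : ∀ {k n} → Matrix ℤ k n → Set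
  SmithForm A = ∃ λ D → A ~ D × IsSmith D

  block-smith : ∀ {k n} {A : Matrix ℤ (suc k) (suc n)} {g B} → A ~ block g B → g ∣ᴹ B → SmithForm B → SmithForm A
  block-smith {g = g} A~gB g∣B (D , B~D , off , div) =
    block g D , ~-trans A~gB (~-block g B~D) , block-offDiagonal g off , All-diagonal g D (∣-⊗ B~D g∣B) ∷ div

  abstract
    smith : ∀ {k n} (A : Matrix ℤ k n) → SmithForm A
    smith {zero}  {_}     A = A , ≋⇒~ ≋-refl , (λ ()) , []
    smith {suc k} {zero}  A = A , ≋⇒~ ≋-refl , (λ _ ()) , []
    smith {suc k} {suc n} A = decide (Fin.any? (λ i → Fin.any? λ j → ¬? (A i j ℤ.≟ 0ℤ)))
      where
      recurse : Split A → SmithForm A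
      recurse (g , B , A~gB , g∣B) = block-smith A~gB g∣B (smith B)
      decide : Dec (∃₂ λ i j → A i j ≢ 0ℤ) → SmithForm A
      decide (yes (p , q , A≢0)) = recurse (split A p q A≢0)
      decide (no none) = A , ≋⇒~ ≋-refl , (λ i j _ → zeros i j) , zero-smith A zeros
        where
        zeros : ∀ i j → A i j ≡ 0ℤ
        zeros i j = decidable-stable (A i j ℤ.≟ 0ℤ) λ ≢0 → none (i , j , ≢0)



-- The last nonzero entry, or 0 if there is none.
lastNonZero : List ℤ → ℤ
lastNonZero = List.foldr (λ x y → if does (y ℤ.≟ 0ℤ) then x else y) 0ℤ

largestInvariantFactor : ∀ {k n} → Matrix ℤ k n → ℕ
largestInvariantFactor N = ℤ.∣ lastNonZero (IntegerMatrix.diagonal (proj₁ (SmithExistence.smith N))) ∣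

------------------------------------------------------------------------
-- Dimension and rank

module LinearAlgebra {c ℓ₁ ℓ₂} (F : HeytingField c ℓ₁ ℓ₂) where
  open HeytingField F
  open CommutativeRing (HeytingCommutativeRing.commutativeRing heytingCommutativeRing) using (semiring)
  open Sum semiring using (sum)

  combination : ∀ {d n} → Vector (Vector Carrier n) d → Vector Carrier d → Vector Carrier n
  combination b a j = sum λ i → a i * b i j

  Span : ∀ {d n} → Vector (Vector Carrier n) d → Pred (Vector Carrier n) (c ⊔ ℓ₁)
  Span b v = ∃ λ a → ∀ j → v j ≈ combination b a j

  LinearlyIndependent : ∀ {d n} → Vector (Vector Carrier n) d → Set (c ⊔ ℓ₁)
  LinearlyIndependent b = ∀ a → (∀ j → combination b a j ≈ 0#) → ∀ i → a i ≈ 0#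

  HasDimension : ∀ {ℓ n} → Pred (Vector Carrier n) ℓ → ℕ → Set (c ⊔ ℓ₁ ⊔ ℓ)
  HasDimension W d = ∃ λ b → LinearlyIndependent {d} b × (∀ v → W v ⇔ Span b v)

  -- Dimension of a nonempty affine subspace, i.e. of its direction space.
  HasAffineDimension : ∀ {ℓ n} → Pred (Vector Carrier n) ℓ → ℕ → Set (c ⊔ ℓ₁ ⊔ ℓ)
  HasAffineDimension A d = ∃ λ p → A p × HasDimension (λ v → A (λ j → p j + v j)) d

-- The span of finitely many vectors in ℚⁿ has a basis, by Gaussian
-- elimination.
module RankExistence where
  open LinearAlgebra ℚ.heytingField
  open CommutativeRing ℚ.+-*-commutativeRing using (semiring; *-comm; *-assoc; distribʳ; +-identityˡ; +-identityʳ; zeroˡ; zeroʳ; *-identityˡ; *-identityʳ; +-assoc; -‿inverseˡ; -‿inverseʳ; +-comm)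
  open Sum semiring
  open import Data.Rational.Base using (_+_; _*_; -_; 1/_; ≢-nonZero)
  open import Data.Rational.Solver using (module +-*-Solver)
  open +-*-Solver using (solve; _:+_; _:*_; :-_; _:=_)
  open import Data.Vec.Functional using (tail) renaming (_∷_ to _◂_)

  Vectors : ℕ → ℕ → Set
  Vectors k n = Vector (Vector ℚ n) k

  _⊆ˢ_ : ∀ {k l n} → Vectors k n → Vectors l n → Set
  A ⊆ˢ B = ∀ v → Span A v → Span B v

  Span-resp : ∀ {k n} (A : Vectors k n) {u v} → (∀ j → u j ≡ v j) → Span A u → Span A v
  Span-resp A u≡v (a , p) = a , λ j → trans (sym (u≡v j)) (p j)

  Span-0 : ∀ {k n} (A : Vectors k n) → Span A (λ _ → 0ℚ)
  Span-0 {k} A = (λ _ → 0ℚ) , λ j → sym (trans (sum-cong-≗ λ i → zeroˡ (A i j)) (sum-replicate-zero k))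

  Span-+ : ∀ {k n} (A : Vectors k n) {u v} → Span A u → Span A v → Span A (λ j → u j + v j)
  Span-+ A (a , p) (b , q) = (λ i → a i + b i) , λ j → trans (cong₂ _+_ (p j) (q j))
    (trans (sym (∑-distrib-+ (λ i → a i * A i j) (λ i → b i * A i j))) (sum-cong-≗ λ i → sym (distribʳ (A i j) (a i) (b i))))

  Span-* : ∀ {k n} (A : Vectors k n) x {u} → Span A u → Span A (λ j → x * u j)
  Span-* A x (a , p) = (λ i → x * a i) , λ j → trans (cong (x *_) (p j))
    (trans (*-distribˡ-sum x (λ i → a i * A i j)) (sum-cong-≗ λ i → sym (*-assoc x (a i) (A i j))))

  Span-combination : ∀ {k l n} (A : Vectors k n) (B : Vectors l n) → (∀ i → Span B (A i)) → ∀ a → Span B (combination A a)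
  Span-combination {zero}  A B A⊆B a = Span-0 B
  Span-combination {suc k} A B A⊆B a =
    Span-+ B (Span-* B (a zero) (A⊆B zero)) (Span-combination (tail A) B (A⊆B ∘ suc) (tail a))

  Span-trans : ∀ {k l n} (A : Vectors k n) (B : Vectors l n) → (∀ i → Span B (A i)) → A ⊆ˢ B
  Span-trans A B A⊆B v (a , p) = Span-resp B (λ j → sym (p j)) (Span-combination A B A⊆B a)

  Span-suc : ∀ {k n} (A : Vectors (suc k) n) v → Span (tail A) v → Span A v
  Span-suc A v (a , p) = (0ℚ ◂ a) , λ j → trans (p j) (sym (trans (cong (_+ combination (tail A) a j) (zeroˡ (A zero j))) (+-identityˡ (combination (tail A) a j))))

  Span-member : ∀ {k n} (A : Vectors k n) i → Span A (A i)
  Span-member {suc k} A zero = (1ℚ ◂ λ _ → 0ℚ) , λ j →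
    sym (trans (cong₂ _+_ (*-identityˡ (A zero j)) (trans (sum-cong-≗ λ i → zeroˡ (A (suc i) j)) (sum-replicate-zero k))) (+-identityʳ _))
  Span-member A (suc i) = Span-suc A (A (suc i)) (Span-member (tail A) i)

  pad : ∀ {k n} → Vectors k n → Vectors k (suc n)
  pad A i = 0ℚ ◂ A i

  Span-pad : ∀ {k n} (A : Vectors k n) v → Span A v → Span (pad A) (0ℚ ◂ v)
  Span-pad {k} A v (a , p) = a , λ where
    zero    → sym (trans (sum-cong-≗ λ i → zeroʳ (a i)) (sum-replicate-zero k))
    (suc j) → p j

  combination-pad : ∀ {k n} (A : Vectors k n) a → combination (pad A) a zero ≡ 0ℚ
  combination-pad {k} A a = trans (sum-cong-≗ λ i → zeroʳ (a i)) (sum-replicate-zero k)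

  HasBasis : ∀ {k n} → Vectors k n → Set
  HasBasis A = ∃ (HasDimension (Span A))

  -- Two families with the same span have the same bases.
  HasBasis-resp : ∀ {k l n} {A : Vectors k n} {B : Vectors l n} →
                  (∀ i → Span B (A i)) → (∀ i → Span A (B i)) → LinearlyIndependent B → HasBasis A
  HasBasis-resp {l = l} {A = A} {B} A⊆B B⊆A ind = l , B , ind , λ v → mk⇔ (Span-trans A B A⊆B v) (Span-trans B A B⊆A v)

  flat : ∀ {k n} (A : Vectors k (suc n)) → (∀ i → A i zero ≡ 0ℚ) → HasBasis (tail ∘ A) → HasBasis A
  flat {k} A zeros (d , b , ind , eq) = HasBasis-resp {A = A} {pad b}
    (λ i → Span-resp (pad b) (λ where
       zero → sym (zeros i)
       (suc j) → refl) (Span-pad b _ (Equivalence.to (eq _) (Span-member (tail ∘ A) i))))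
    (λ i → lift i (Equivalence.from (eq (b i)) (Span-member b i)))
    (λ a p → ind a (p ∘ suc))
    where
    lift : ∀ i → Span (tail ∘ A) (b i) → Span A (pad b i)
    lift i (a , p) = a , λ where
      zero → sym (trans (sum-cong-≗ λ t → trans (cong (a t *_) (zeros t)) (zeroʳ (a t))) (sum-replicate-zero k))
      (suc j) → p j

  module Pivot {k n} (A : Vectors k (suc n)) (p : Fin k) (A≢0 : A p zero ≢ 0ℚ) where
    instance _ = ≢-nonZero A≢0

    factor : Fin k → ℚ
    factor i = A i zero * 1/ A p zero

    cleared : Vectors k (suc n)
    cleared i j = A i j + (- factor i) * A p j

    cleared-zero : ∀ i → cleared i zero ≡ 0ℚ
    cleared-zero i = trans (solve 3 (λ x y z → x :+ (:- (x :* y)) :* z := x :+ (:- (x :* (y :* z)))) refl (A i zero) (1/ A p zero) (A p zero))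
      (trans (cong (λ y → A i zero + - (A i zero * y)) (ℚ.*-inverseˡ (A p zero)))
      (trans (cong (λ y → A i zero + - y) (*-identityʳ (A i zero))) (-‿inverseʳ (A i zero))))

    A-from-cleared : ∀ i j → cleared i j + factor i * A p j ≡ A i j
    A-from-cleared i j = solve 3 (λ x y z → (x :+ (:- y) :* z) :+ y :* z := x) refl (A i j) (factor i) (A p j)

    extend : HasBasis cleared → HasBasis A
    extend (d , b , ind , eq) = HasBasis-resp {A = A} {B}
      (λ i → Span-resp B (A-from-cleared i)
        (Span-+ B (Span-suc B _ (Equivalence.to (eq (cleared i)) (Span-member cleared i))) (Span-* B (factor i) (Span-member B zero))))
      (λ where
        zero → Span-member A p
        (suc i) → Span-trans cleared A cleared⊆A (b i) (b⊆ i))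
      independent
      where
      B : Vectors (suc d) (suc n)
      B = A p ◂ b
      b⊆ : ∀ i → Span cleared (b i)
      b⊆ i = Equivalence.from (eq (b i)) (Span-member b i)
      cleared⊆A : ∀ i → Span A (cleared i)
      cleared⊆A i = Span-+ A (Span-member A i) (Span-* A (- factor i) (Span-member A p))
      b-zero : ∀ i → b i zero ≡ 0ℚ
      b-zero i = trans (proj₂ (b⊆ i) zero) (trans (sum-cong-≗ λ t → trans (cong (proj₁ (b⊆ i) t *_) (cleared-zero t)) (zeroʳ (proj₁ (b⊆ i) t))) (sum-replicate-zero k))
      independent : LinearlyIndependent B
      independent a eq0 = λ where
          zero → a₀≡0
          (suc i) → ind (tail a) rest i
        where
        first : a zero * A p zero ≡ 0ℚ
        first = trans (sym (trans (cong (_+_ (a zero * A p zero)) (trans (sum-cong-≗ λ t → trans (cong (a (suc t) *_) (b-zero t)) (zeroʳ (a (suc t)))) (sum-replicate-zero d))) (+-identityʳ _))) (eq0 zero)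
        a₀≡0 : a zero ≡ 0ℚ
        a₀≡0 = trans (sym (*-identityʳ (a zero))) (trans (cong (a zero *_) (sym (ℚ.*-inverseʳ (A p zero))))
          (trans (sym (*-assoc (a zero) (A p zero) (1/ A p zero))) (trans (cong (_* 1/ A p zero) first) (zeroˡ (1/ A p zero)))))
        rest : ∀ j → combination b (tail a) j ≡ 0ℚ
        rest j = trans (sym (trans (cong (λ x → x * A p j + combination b (tail a) j) a₀≡0) (trans (cong (_+ combination b (tail a) j) (zeroˡ (A p j))) (+-identityˡ _)))) (eq0 j)

  abstract
    hasBasis : ∀ {k n} (A : Vectors k n) → HasBasis A
    hasBasis {k} {zero} A = 0 , (λ ()) , (λ _ _ ()) , λ v → mk⇔ (λ _ → (λ ()) , λ ()) (λ _ → (λ _ → 0ℚ) , λ ())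
    hasBasis {k} {suc n} A = decide (Fin.any? λ i → ¬? (A i zero ℚ.≟ 0ℚ))
      where
      decide : Dec (∃ λ i → A i zero ≢ 0ℚ) → HasBasis A
      decide (no none) = flat A (λ i → decidable-stable (A i zero ℚ.≟ 0ℚ) λ ≢0 → none (i , ≢0)) (hasBasis (tail ∘ A))
      decide (yes (p , A≢0)) = extend (flat cleared cleared-zero (hasBasis (tail ∘ cleared)))
        where open Pivot A p A≢0

-- The rank over ℚ: the dimension of the row space.
rank : ∀ {k n} → Matrix ℤ k n → ℕ
rank N = proj₁ (RankExistence.hasBasis λ i j → N i j ℚ./ 1)

------------------------------------------------------------------------
-- The augmented incidence matrix

-- The elements of S in increasing order.
element : ∀ {m} (S : Subset m) → Fin Subset.∣ S ∣ → Fin m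
element (inside  ∷ S) zero    = zero
element (inside  ∷ S) (suc i) = suc (element S i)
element (outside ∷ S) i       = suc (element S i)

subsets : ∀ m → List (Subset m)
subsets zero    = [] ∷ []
subsets (suc m) = List.map (inside ∷_) (subsets m) List.++ List.map (outside ∷_) (subsets m)

incidence : ∀ {n m} → Graph n m → Matrix ℤ n m
incidence G v e =
  if does (tail e Fin.≟ head e) then 0ℤ else
  if does (v Fin.≟ head e) then 1ℤ else
  if does (v Fin.≟ tail e) then -1ℤ else 0ℤ
  where open Graph G

module _ {n m} (G : Graph n m) (𝐰 : Vector ℤ m) where

  augmented : Matrix ℤ m (n ℕ.+ 1)
  augmented e = transpose (incidence G) e Vector.++ Vector.replicate 1 (𝐰 e)

  -- [M_Gᵀ, 𝐰]_S
  augmentedOn : (S : Subset m) → Matrix ℤ Subset.∣ S ∣ (n ℕ.+ 1)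
  augmentedOn S = augmented ∘ element S

  EqualRank : Pred (Subset m) 0ℓ
  EqualRank S = rank (augmentedOn S) ≡ graphRank G S

  equalRank? : ∀ S → Dec (EqualRank S)
  equalRank? S = rank (augmentedOn S) ℕ.≟ graphRank G S

  -- d([M_Gᵀ, 𝐰]_S)
  factor : Subset m → ℕ
  factor S = largestInvariantFactor (augmentedOn S)

  -- q_𝐰; it is 0 when every S satisfies EqualRank.
  qBound : ℕ
  qBound = max 0 (List.map factor (List.filter (¬? ∘ equalRank?) (subsets m)))

  d̃ : ℕ → Subset m → ℕ
  d̃ q S =
    if does (equalRank? S) then 1 else
    if does (q ℕ.∣? factor S) then 1 else 0

sign : ∀ {m} → Subset m → ℤ
sign S = -1ℤ ℤ.^ Subset.∣ S ∣

sumOver : ∀ {A : Set} → List A → (A → ℤ) → ℤ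
sumOver xs f = List.foldr ℤ._+_ 0ℤ (List.map f xs)

------------------------------------------------------------------------
-- Polynomials in one variable over ℤ

-- Coefficients in order of increasing degree; trailing zeros allowed.
Polynomial : Set
Polynomial = List ℤ

coefficient : Polynomial → ℕ → ℤ
coefficient []      _       = 0ℤ
coefficient (a ∷ p) zero    = a
coefficient (a ∷ p) (suc i) = coefficient p i

infix 4 _≈ₚ_
_≈ₚ_ : Polynomial → Polynomial → Set
p ≈ₚ p′ = ∀ i → coefficient p i ≡ coefficient p′ i

infixl 6 _+ₚ_
_+ₚ_ : Polynomial → Polynomial → Polynomial
[]      +ₚ p′       = p′
(a ∷ p) +ₚ []       = a ∷ p
(a ∷ p) +ₚ (b ∷ p′) = (a ℤ.+ b) ∷ (p +ₚ p′)

monomial : ℤ → ℕ → Polynomial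
monomial a d = List.replicate d 0ℤ List.++ (a ∷ [])

evaluate : Polynomial → ℤ → ℤ
evaluate []      t = 0ℤ
evaluate (a ∷ p) t = a ℤ.+ t ℤ.* evaluate p t

sumOverₚ : ∀ {A : Set} → List A → (A → Polynomial) → Polynomial
sumOverₚ xs f = List.foldr _+ₚ_ [] (List.map f xs)

------------------------------------------------------------------------
-- Real numbers

-- The real numbers, axiomatised as a complete Archimedean ordered field;
-- arrangements are considered over an arbitrary model.
record RealNumbers c ℓ₁ ℓ₂ : Set (Level.suc (c ⊔ ℓ₁ ⊔ ℓ₂)) where
  field
    heytingField : HeytingField c ℓ₁ ℓ₂

  open HeytingField heytingField public
  open CommutativeRing (HeytingCommutativeRing.commutativeRing heytingCommutativeRing) public
    using (+-monoid)
  open Mult +-monoid public using () renaming (_×_ to _·_)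

  infix 4 _<_
  field
    _<_                  : Rel Carrier ℓ₂
    isStrictPartialOrder : IsStrictPartialOrder _≈_ _<_
    #⇔<⊎>                : ∀ x y → x # y ⇔ (x < y ⊎ y < x)
    +-monoˡ-<            : ∀ {x y} z → x < y → x + z < y + z
    *-positive           : ∀ {x y} → 0# < x → 0# < y → 0# < x * y
    archimedean          : ∀ x → ∃ λ k → x < k · 1#

  -- |x i - x j| < 1/(k+1) for all i, j ≥ N
  IsCauchy : (ℕ → Carrier) → Set ℓ₂
  IsCauchy x = ∀ k → ∃ λ N → ∀ i j → N ℕ.≤ i → N ℕ.≤ j → suc k · (x i - x j) < 1#

  ConvergesTo : (ℕ → Carrier) → Carrier → Set ℓ₂
  ConvergesTo x l = ∀ k → ∃ λ N → ∀ i → N ℕ.≤ i →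
                    suc k · (x i - l) < 1# × suc k · (l - x i) < 1#

  field
    complete : ∀ x → IsCauchy x → ∃ (ConvergesTo x)

  fromℤ : ℤ → Carrier
  fromℤ (+ k)    = k · 1#
  fromℤ -[1+ k ] = - (suc k · 1#)

------------------------------------------------------------------------
-- Arrangements and their characteristic polynomials

module _ {c ℓ₁ ℓ₂} (ℝ : RealNumbers c ℓ₁ ℓ₂) where
  open RealNumbers ℝ
  open LinearAlgebra heytingField using (HasAffineDimension)

  Arrangement : ℕ → ℕ → Set (c ⊔ Level.suc ℓ₁)
  Arrangement n m = Vector (Pred (Vector Carrier n) ℓ₁) m

  affinographic : ∀ {n m} → Graph n m → Vector ℤ m → Arrangement n m
  affinographic G 𝐰 e x = x (head e) - x (tail e) ≈ fromℤ (𝐰 e)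
    where open Graph G

  module _ {n m} (𝓐 : Arrangement n m) where

    Intersection : Subset m → Pred (Vector Carrier n) ℓ₁
    Intersection S x = ∀ e → e ∈ S → 𝓐 e x

    -- The contribution of S to the characteristic polynomial.
    IsTerm : Subset m → Polynomial → Set (c ⊔ ℓ₁)
    IsTerm S p =
      (∃ λ d → HasAffineDimension (Intersection S) d × p ≈ₚ monomial (sign S) d)
      ⊎ (¬ (∃ λ x → Intersection S x) × p ≈ₚ [])

    -- "χ(𝓐, t) = p".  This is a relation because dimension and emptiness
    -- of an intersection are not computable for general 𝓐; it determines
    -- p up to _≈ₚ_.
    IsCharacteristicPolynomial : Polynomial → Set (c ⊔ ℓ₁)
    IsCharacteristicPolynomial p =
      ∃ λ (term : Subset m → Polynomial) →
        (∀ S → IsTerm S (term S)) × p ≈ₚ sumOverₚ (subsets m) term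

{-# OPTIONS --safe #-}
module Submission where

-- By inclusion–exclusion, #C(G, w; ℤ_q) is the alternating sum over S of the number of
-- maps V → ℤ_q violating every edge of S.  Those maps are the potentials of w on G|S
-- modulo q: they are constant on components up to one of them, so there are q^c(G|S) of
-- them or none.  Over ℤ the image of the coboundary x ↦ (x_head - x_tail) is saturated
-- (subtract the value at the root of each component).  Hence an integer potential exists
-- iff one exists over ℚ or ℝ, which is the equality of ranks, and otherwise the largest
-- invariant factor d of [M_Gᵀ, 𝐰]_S, the generator of the annihilator of the torsion of
-- the cokernel, is the number such that a potential modulo q exists iff q ∣ d.

open import Defs
open import Algebra.Apartness.Bundles using (HeytingCommutativeRing)
open import Algebra.Bundles using (AbelianGroup; CommutativeRing)
import Algebra.Properties.AbelianGroup
import Algebra.Properties.CommutativeMonoid.Sum as CommutativeMonoidSum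
import Algebra.Properties.Monoid.Mult as Mult
import Algebra.Properties.Ring as RingProperties
import Algebra.Properties.Semiring.Sum as Sum
open import Data.Bool.Base using (true; false; if_then_else_)
open import Data.Fin.Base as Fin using (Fin; zero; suc; toℕ; finToFun; funToFin; punchIn; _↑ˡ_; _↑ʳ_)
import Data.Fin.Properties as Fin
open import Data.Fin.Subset as Subset using (Subset; inside; outside; _∈_)
open import Data.Fin.Subset.Properties using (_∈?_)
open import Data.Integer.Base as ℤ using (ℤ; +_; -[1+_]; 0ℤ; 1ℤ; -1ℤ; ≢-nonZero)
import Data.Integer.DivMod as ℤ
open import Data.Integer.Divisibility.Signed using (_∣_; divides; ∣m∣n⇒∣m+n; ∣m∣n⇒∣m-n; ∣m⇒∣-m; ∣-trans; ∣-refl; ∣⇒∣ᵤ; ∣ᵤ⇒∣; ∣n⇒∣m*n; ∣m⇒∣m*n)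
import Data.Integer.Properties as ℤ
open import Data.Integer.Tactic.RingSolver using (solve-∀)
open import Data.List.Base as List using (List; []; _∷_; length)
open import Data.List.Extrema.Nat using (xs≤max)
open import Data.List.Membership.Propositional using () renaming (_∈_ to _∈ˡ_)
open import Data.List.Membership.Propositional.Properties using (∈-lookup; ∈-filter⁺; ∈-filter⁻; ∈-allFin; ∈-map⁺; ∈-++⁺ˡ; ∈-++⁺ʳ)
import Data.List.Properties as List
open import Data.List.Relation.Unary.All as All using (All; []; _∷_)
open import Data.List.Relation.Unary.AllPairs using (AllPairs; []; _∷_)
open import Data.List.Relation.Unary.Any as Any using ()
open import Data.List.Relation.Unary.Any.Properties using (lookup-index)
open import Data.List.Relation.Unary.Unique.Propositional using (Unique)
open import Data.List.Relation.Unary.Unique.Propositional.Properties using (allFin⁺; filter⁺)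
open import Data.Nat.Base as ℕ using (ℕ; zero; suc; NonZero; _∸_)
import Data.Nat.Divisibility as ℕ
open import Data.Nat.Induction using (<-wellFounded)
import Data.Nat.Properties as ℕ
open import Data.Product.Base using (∃; ∃₂; _×_; _,_; proj₁; proj₂)
open import Data.Rational.Base as ℚ using (ℚ; 0ℚ; 1ℚ; _/_)
import Data.Rational.Properties as ℚ
open import Data.Rational.Solver using (module +-*-Solver)
open import Data.Rational.Unnormalised.Base as ℚᵘ using (mkℚᵘ; *≡*)
import Data.Rational.Unnormalised.Properties as ℚᵘ
open import Data.Sum.Base using (inj₁; inj₂; [_,_]′)
open import Data.Unit.Base using (⊤; tt)
open import Data.Vec.Base using ([]; _∷_; here; there)
open import Data.Vec.Functional as Vector using (Vector)
open import Data.Vec.Functional.Properties using (lookup-++ˡ; lookup-++ʳ; insertAt-lookup; insertAt-punchIn)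
open import Function.Base using (_∘_; id)
open import Function.Bundles using (Bijection; Equivalence; mk⇔)
open import Induction.WellFounded using (Acc; acc)
open import Level using (_⊔_)
open import Relation.Binary.Construct.Closure.Equivalence as Eq using ()
open import Relation.Binary.Core using (Rel)
open import Relation.Binary.PropositionalEquality using (_≡_; _≢_; _≗_; refl; sym; trans; cong; cong₂; subst; subst₂; module ≡-Reasoning)
open import Relation.Binary.Structures using (IsEquivalence; IsStrictPartialOrder)
open import Relation.Nullary.Decidable using (Dec; yes; no; does; ¬?; map′; _→-dec_; _×-dec_; dec-true; dec-false; decidable-stable)
open import Relation.Nullary.Negation using (¬_; contradiction)
open import Relation.Unary using (Decidable)

-- Counting maps between finite sets

-- The divisibility criterion has a short reason. Let L be the quotient of ℤ^S by the coboundaries;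
-- saturation makes L torsion-free, hence free. If there is no integer potential, the class of `𝐰`
-- in L is g ≥ 1 times a primitive vector. The cokernel of the augmented matrix is L modulo that
-- class, so its torsion is ℤ/g and the largest invariant factor is g. A potential modulo q exists
-- exactly when the class of `𝐰` lies in qL, that is, when q divides g. No basis of L is chosen: the
-- Smith form enters only through two properties of d, that d annihilates the torsion of the
-- cokernel and that some class has order exactly d. The second obstacle is constructive: equality
-- in a model of the reals is not decidable, so the existence of a real solution cannot be tested
-- there. But the differences of a solution within a component are integers that are read off from
-- `𝐰` along paths, before any solution is known. Existence over ℚ or ℝ is thereby reduced to
-- existence over ℤ, where it is decidable.

lookup-injective : ∀ {A : Set} {xs : List A} → Unique xs → ∀ i j → List.lookup xs i ≡ List.lookup xs j → i ≡ j
lookup-injective (_ ∷ _)     zero    zero    _  = refl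
lookup-injective (x≢ ∷ _)    zero    (suc j) eq = contradiction eq (All.lookup x≢ (∈-lookup j))
lookup-injective (x≢ ∷ _)    (suc i) zero    eq = contradiction (sym eq) (All.lookup x≢ (∈-lookup i))
lookup-injective (_ ∷ uniq)  (suc i) (suc j) eq = cong suc (lookup-injective uniq i j eq)

-- Each position of `xs` is sent to the position at which its image is found in `ys`; this is an
-- injection between finite index sets.
length-≤ : ∀ {A B : Set} {xs : List A} {ys : List B} → Unique xs → (f : A → B) →
           (∀ {x} → x ∈ˡ xs → f x ∈ˡ ys) →
           (∀ {x x′} → x ∈ˡ xs → x′ ∈ˡ xs → f x ≡ f x′ → x ≡ x′) → length xs ℕ.≤ length ys
length-≤ {xs = xs} {ys} uniq f maps inj = Fin.injective⇒≤ λ {i} {j} eq →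
  lookup-injective uniq i j (inj (∈-lookup i) (∈-lookup j)
    (trans (lookup-index (maps (∈-lookup i))) (trans (cong (List.lookup ys) eq) (sym (lookup-index (maps (∈-lookup j)))))))

allMaps : ∀ n q → List (Vector (Fin q) n)
allMaps n q = List.map finToFun (List.allFin (q ℕ.^ n))

count : ∀ {n q} {P : Vector (Fin q) n → Set} → Decidable P → ℕ
count {n} {q} P? = length (List.filter P? (allMaps n q))

filter-map : ∀ {A B : Set} {P : B → Set} (P? : Decidable P) (f : A → B) xs →
             List.filter P? (List.map f xs) ≡ List.map f (List.filter (P? ∘ f) xs)
filter-map P? f []       = refl
filter-map P? f (x ∷ xs) with does (P? (f x))
... | true  = cong (f x ∷_) (filter-map P? f xs)
... | false = filter-map P? f xs

count-codes : ∀ {n q} {P : Vector (Fin q) n → Set} (P? : Decidable P) →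
              count P? ≡ length (List.filter (P? ∘ finToFun {q} {n}) (List.allFin (q ℕ.^ n)))
count-codes {n} {q} P? = trans (cong length (filter-map P? finToFun (List.allFin (q ℕ.^ n)))) (List.length-map (finToFun {q} {n}) (List.filter (P? ∘ finToFun) (List.allFin (q ℕ.^ n))))

funToFin-injective : ∀ {n q} {f g : Vector (Fin q) n} → funToFin f ≡ funToFin g → f ≗ g
funToFin-injective {f = f} {g} eq i =
  trans (sym (Fin.finToFun-funToFin f i)) (trans (cong (λ k → finToFun k i) eq) (Fin.finToFun-funToFin g i))

finToFun-injective : ∀ {n q} {i j : Fin (q ℕ.^ n)} → finToFun {q} {n} i ≗ finToFun j → i ≡ j
finToFun-injective {zero}  {q} {zero} {zero} eq = refl
finToFun-injective {suc n} {q} {i} {j} eq =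
  trans (sym (Fin.combine-remQuot {q} (q ℕ.^ n) i)) (trans (cong₂ Fin.combine (eq zero) (finToFun-injective {n} {q} (eq ∘ suc))) (Fin.combine-remQuot {q} (q ℕ.^ n) j))

-- The comparison is made on the codes in `Fin (q ^ n)`, because maps that agree pointwise need not
-- be equal as functions. Decoding the code of `F f` returns `F f` only pointwise, which is why `Q`
-- must respect `_≗_`.
count-≤ : ∀ {n q n′ q′} {P : Vector (Fin q) n → Set} {Q : Vector (Fin q′) n′ → Set}
          (P? : Decidable P) (Q? : Decidable Q) → (∀ {f g} → f ≗ g → Q f → Q g) →
          (F : Vector (Fin q) n → Vector (Fin q′) n′) → (∀ {f} → P f → Q (F f)) →
          (∀ {f g} → P f → P g → F f ≗ F g → f ≗ g) → count P? ℕ.≤ count Q?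
count-≤ {n} {q} {n′} {q′} {P} P? Q? resp F maps inj =
  subst₂ ℕ._≤_ (sym (count-codes {n} {q} P?)) (sym (count-codes {n′} {q′} Q?))
    (length-≤ (filter⁺ (P? ∘ finToFun) (allFin⁺ (q ℕ.^ n))) (funToFin ∘ F ∘ finToFun)
      (λ x∈ → ∈-filter⁺ (Q? ∘ finToFun) (∈-allFin _) (resp (sym ∘ Fin.finToFun-funToFin _) (maps (holds x∈))))
      (λ x∈ y∈ eq → finToFun-injective {n} {q} (inj (holds x∈) (holds y∈) (funToFin-injective eq))))
  where
  holds : ∀ {x} → x ∈ˡ List.filter (P? ∘ finToFun {q} {n}) (List.allFin (q ℕ.^ n)) → P (finToFun x)
  holds x∈ = proj₂ (∈-filter⁻ (P? ∘ finToFun) {xs = List.allFin (q ℕ.^ n)} x∈)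

count-all : ∀ {n q} {P : Vector (Fin q) n → Set} (P? : Decidable P) → (∀ f → P f) → count P? ≡ q ℕ.^ n
count-all {n} {q} P? all = trans (cong length (List.filter-all P? (All.universal all (allMaps n q))))
  (trans (List.length-map (finToFun {q} {n}) (List.allFin (q ℕ.^ n))) (List.length-tabulate {n = q ℕ.^ n} id))

count-none : ∀ {n q} {P : Vector (Fin q) n → Set} (P? : Decidable P) → (∀ f → ¬ P f) → count P? ≡ 0
count-none {n} {q} P? none = cong length (List.filter-none P? (All.universal none (allMaps n q)))

-- Inclusion–exclusion

sumOver-cong : ∀ {A : Set} (xs : List A) {f g : A → ℤ} → (∀ x → f x ≡ g x) → sumOver xs f ≡ sumOver xs g
sumOver-cong []       eq = refl
sumOver-cong (x ∷ xs) eq = cong₂ ℤ._+_ (eq x) (sumOver-cong xs eq)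

sumOver-++ : ∀ {A : Set} (xs ys : List A) f → sumOver (xs List.++ ys) f ≡ sumOver xs f ℤ.+ sumOver ys f
sumOver-++ []       ys f = sym (ℤ.+-identityˡ _)
sumOver-++ (x ∷ xs) ys f = trans (cong (ℤ._+_ (f x)) (sumOver-++ xs ys f)) (sym (ℤ.+-assoc (f x) _ _))

sumOver-map : ∀ {A B : Set} (g : A → B) xs f → sumOver (List.map g xs) f ≡ sumOver xs (f ∘ g)
sumOver-map g []       f = refl
sumOver-map g (x ∷ xs) f = cong (ℤ._+_ (f (g x))) (sumOver-map g xs f)

sumOver-* : ∀ {A : Set} (xs : List A) a f → a ℤ.* sumOver xs f ≡ sumOver xs (λ x → a ℤ.* f x)
sumOver-* []       a f = ℤ.*-zeroʳ a
sumOver-* (x ∷ xs) a f = trans (ℤ.*-distribˡ-+ a (f x) _) (cong (ℤ._+_ (a ℤ.* f x)) (sumOver-* xs a f))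

sumOver-+ : ∀ {A : Set} (xs : List A) f g → sumOver xs (λ x → f x ℤ.+ g x) ≡ sumOver xs f ℤ.+ sumOver xs g
sumOver-+ []       f g = refl
sumOver-+ (x ∷ xs) f g = trans (cong (ℤ._+_ (f x ℤ.+ g x)) (sumOver-+ xs f g)) (interchange (f x) (g x) _ _)
  where
  interchange : ∀ a b c d → (a ℤ.+ b) ℤ.+ (c ℤ.+ d) ≡ (a ℤ.+ c) ℤ.+ (b ℤ.+ d)
  interchange = solve-∀

sumOver-0 : ∀ {A : Set} (xs : List A) → sumOver xs (λ _ → 0ℤ) ≡ 0ℤ
sumOver-0 []       = refl
sumOver-0 (x ∷ xs) = trans (ℤ.+-identityˡ _) (sumOver-0 xs)

indicator : ∀ {P : Set} → Dec P → ℤ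
indicator d = if does d then 1ℤ else 0ℤ

indicator-⇔ : ∀ {P Q : Set} (d : Dec P) (e : Dec Q) → (P → Q) → (Q → P) → indicator d ≡ indicator e
indicator-⇔ (yes p) (yes q) _ _ = refl
indicator-⇔ (yes p) (no ¬q) f _ = contradiction (f p) ¬q
indicator-⇔ (no ¬p) (yes q) _ g = contradiction (g q) ¬p
indicator-⇔ (no ¬p) (no ¬q) _ _ = refl

indicator-× : ∀ {P Q : Set} (d : Dec P) (e : Dec Q) → indicator (d ×-dec e) ≡ indicator d ℤ.* indicator e
indicator-× (yes p) (yes q) = refl
indicator-× (yes p) (no ¬q) = refl
indicator-× (no ¬p) e       = refl

indicator-¬ : ∀ {P : Set} (d : Dec P) → indicator (¬? d) ≡ 1ℤ ℤ.+ -1ℤ ℤ.* indicator d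
indicator-¬ (yes p) = refl
indicator-¬ (no ¬p) = refl

length-filter-suc : ∀ {A : Set} {P : A → Set} (P? : Decidable P) x xs →
                    + length (List.filter P? (x ∷ xs)) ≡ indicator (P? x) ℤ.+ + length (List.filter P? xs)
length-filter-suc P? x xs with does (P? x)
... | true  = refl
... | false = refl

module _ {m} {P : Fin m → Set} (P? : Decidable P) where

  none? : Dec (∀ e → ¬ P e)
  none? = Fin.all? (¬? ∘ P?)

  allOf? : ∀ S → Dec (∀ e → e ∈ S → P e)
  allOf? S = Fin.all? λ e → (e ∈? S) →-dec P? e

-- This is the expansion of the product of the factors 1 - [P e] over all e, by induction on the
-- number of factors.
inclusion-exclusion-pointwise : ∀ {m} {P : Fin m → Set} (P? : Decidable P) →
  indicator (none? P?) ≡ sumOver (subsets m) λ S → sign S ℤ.* indicator (allOf? P? S)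
inclusion-exclusion-pointwise {zero}  {P} P? = refl
inclusion-exclusion-pointwise {suc m} {P} P? = begin
  indicator (none? P?)
    ≡⟨ indicator-⇔ (none? P?) (¬? (P? zero) ×-dec none? (P? ∘ suc)) (λ f → f zero , f ∘ suc) (λ (f , g) → λ where zero → f; (suc e) → g e) ⟩
  indicator (¬? (P? zero) ×-dec none? (P? ∘ suc))
    ≡⟨ indicator-× (¬? (P? zero)) (none? (P? ∘ suc)) ⟩
  indicator (¬? (P? zero)) ℤ.* indicator (none? (P? ∘ suc))
    ≡⟨ cong₂ ℤ._*_ (indicator-¬ (P? zero)) (inclusion-exclusion-pointwise (P? ∘ suc)) ⟩
  (1ℤ ℤ.+ -1ℤ ℤ.* i) ℤ.* Σ
    -- The first summand collects the subsets that contain `zero`, the second those that do not, in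
    -- the order in which `subsets` lists them.
    ≡⟨ expand i Σ ⟩
  (-1ℤ ℤ.* i) ℤ.* Σ ℤ.+ Σ
    ≡⟨ cong₂ ℤ._+_ (trans (sumOver-* (subsets m) (-1ℤ ℤ.* i) _) (trans (sumOver-cong (subsets m) with-zero) (sym (sumOver-map (inside ∷_) (subsets m) _))))
                   (trans (sumOver-cong (subsets m) without-zero) (sym (sumOver-map (outside ∷_) (subsets m) _))) ⟩
  sumOver (List.map (inside ∷_) (subsets m)) term ℤ.+ sumOver (List.map (outside ∷_) (subsets m)) term
    ≡⟨ sumOver-++ (List.map (inside ∷_) (subsets m)) _ term ⟨
  sumOver (subsets (suc m)) term ∎
  where
  open ≡-Reasoning
  term : Subset (suc m) → ℤ
  term S = sign S ℤ.* indicator (allOf? P? S)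
  i Σ : ℤ
  i = indicator (P? zero)
  Σ = sumOver (subsets m) λ S → sign S ℤ.* indicator (allOf? (P? ∘ suc) S)
  expand : ∀ i s → (1ℤ ℤ.+ -1ℤ ℤ.* i) ℤ.* s ≡ (-1ℤ ℤ.* i) ℤ.* s ℤ.+ s
  expand = solve-∀
  rearrange : ∀ i s t → (-1ℤ ℤ.* i) ℤ.* (s ℤ.* t) ≡ (-1ℤ ℤ.* s) ℤ.* (i ℤ.* t)
  rearrange = solve-∀
  with-zero : ∀ S → (-1ℤ ℤ.* i) ℤ.* (sign S ℤ.* indicator (allOf? (P? ∘ suc) S)) ≡ term (inside ∷ S)
  with-zero S = trans (rearrange i (sign S) _) (cong ((-1ℤ ℤ.* sign S) ℤ.*_)
    (trans (sym (indicator-× (P? zero) (allOf? (P? ∘ suc) S)))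
      (indicator-⇔ (P? zero ×-dec allOf? (P? ∘ suc) S) (allOf? P? (inside ∷ S))
        (λ (f , g) → λ where zero _ → f; (suc e) (there e∈S) → g e e∈S)
        (λ f → f zero here , λ e e∈S → f (suc e) (there e∈S)))))
  without-zero : ∀ S → sign S ℤ.* indicator (allOf? (P? ∘ suc) S) ≡ term (outside ∷ S)
  without-zero S = cong (sign S ℤ.*_) (indicator-⇔ (allOf? (P? ∘ suc) S) (allOf? P? (outside ∷ S))
    (λ g → λ where (suc e) (there e∈S) → g e e∈S)
    (λ f e e∈S → f (suc e) (there e∈S)))

inclusion-exclusion : ∀ {A : Set} {m} {P : A → Fin m → Set} (P? : ∀ x → Decidable (P x)) (xs : List A) →
  + length (List.filter (none? ∘ P?) xs) ≡ sumOver (subsets m) λ S → sign S ℤ.* + length (List.filter (λ x → allOf? (P? x) S) xs)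
inclusion-exclusion {m = m} P? [] = sym (trans (sumOver-cong (subsets m) λ S → ℤ.*-zeroʳ (sign S)) (sumOver-0 (subsets m)))
inclusion-exclusion {m = m} P? (x ∷ xs) = begin
  + length (List.filter (none? ∘ P?) (x ∷ xs))
    ≡⟨ length-filter-suc (none? ∘ P?) x xs ⟩
  indicator (none? (P? x)) ℤ.+ + length (List.filter (none? ∘ P?) xs)
    ≡⟨ cong₂ ℤ._+_ (inclusion-exclusion-pointwise (P? x)) (inclusion-exclusion P? xs) ⟩
  sumOver (subsets m) (λ S → sign S ℤ.* indicator (allOf? (P? x) S)) ℤ.+ sumOver (subsets m) (λ S → sign S ℤ.* N S)
    ≡⟨ sumOver-+ (subsets m) _ _ ⟨
  sumOver (subsets m) (λ S → sign S ℤ.* indicator (allOf? (P? x) S) ℤ.+ sign S ℤ.* N S)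
    ≡⟨ sumOver-cong (subsets m) (λ S → trans (sym (ℤ.*-distribˡ-+ (sign S) _ _)) (cong (sign S ℤ.*_) (sym (length-filter-suc (λ x → allOf? (P? x) S) x xs)))) ⟩
  sumOver (subsets m) (λ S → sign S ℤ.* + length (List.filter (λ x → allOf? (P? x) S) (x ∷ xs))) ∎
  where
  open ≡-Reasoning
  N : Subset m → ℤ
  N S = + length (List.filter (λ x → allOf? (P? x) S) xs)

-- Components and potentials

element-∈ : ∀ {m} (S : Subset m) i → element S i ∈ S
element-∈ (inside  ∷ S) zero    = here
element-∈ (inside  ∷ S) (suc i) = there (element-∈ S i)
element-∈ (outside ∷ S) i       = there (element-∈ S i)

element-onto : ∀ {m} (S : Subset m) e → e ∈ S → ∃ λ i → element S i ≡ e
element-onto (inside  ∷ S) zero    _           = zero , refl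
element-onto (inside  ∷ S) (suc e) (there e∈S) = let i , eq = element-onto S e e∈S in suc i , cong suc eq
element-onto (outside ∷ S) (suc e) (there e∈S) = let i , eq = element-onto S e e∈S in i , cong suc eq

module ComponentsOf {n m} (G : Graph n m) (S : Subset m) where
  open Graph G public
  private
    bijection = proj₂ (ComponentExistence.components G S)

  #C : ℕ
  #C = numComponents G S

  component : Fin n → Fin #C
  component = Bijection.to bijection

  root : Fin #C → Fin n
  root i = proj₁ (Bijection.surjective bijection i)

  component-root : ∀ i → component (root i) ≡ i
  component-root i = proj₂ (Bijection.surjective bijection i) (Eq.reflexive _)

  component-edge : ∀ {e} → e ∈ S → component (tail e) ≡ component (head e)
  component-edge e∈S = Bijection.cong bijection (Eq.return (_ , e∈S , refl , refl))

  rootOf : Fin n → Fin n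
  rootOf = root ∘ component

  rootOf-edge : ∀ {e} → e ∈ S → rootOf (tail e) ≡ rootOf (head e)
  rootOf-edge = cong root ∘ component-edge

  root-injective : ∀ {i j} → root i ≡ root j → i ≡ j
  root-injective {i} {j} eq = trans (sym (component-root i)) (trans (cong component eq) (component-root j))

  numComponents-≤ : #C ℕ.≤ n
  numComponents-≤ = Fin.injective⇒≤ root-injective

  -- A vertex and its root have the same label, hence are joined by a walk along edges of `S`, which
  -- can be folded into any equivalence relation that relates the ends of every such edge. All
  -- statements about components are instances, with congruence, integrality of differences or
  -- equality as the relation.
  connected : ∀ {ℓ} {_~_ : Rel (Fin n) ℓ} → IsEquivalence _~_ → (∀ e → e ∈ S → tail e ~ head e) → ∀ v → v ~ rootOf v
  connected equiv edges v = Eq.fold equiv (λ where (e , e∈S , refl , refl) → edges e e∈S)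
    (Bijection.injective bijection (sym (component-root (component v))))

  connected-∣ : ∀ d (x : Vector ℤ n) → (∀ e → e ∈ S → d ∣ x (head e) ℤ.- x (tail e)) → ∀ v → d ∣ x v ℤ.- x (rootOf v)
  connected-∣ d x edges v = flipped (connected equiv edges v)
    where
    _~_ : Rel (Fin n) _
    u ~ v = d ∣ x v ℤ.- x u
    negate : ∀ a b → ℤ.- (a ℤ.- b) ≡ b ℤ.- a
    negate = solve-∀
    flipped : ∀ {u v} → u ~ v → v ~ u
    flipped {u} {v} p = subst (d ∣_) (negate (x v) (x u)) (∣m⇒∣-m p)
    telescope : ∀ a b c → (a ℤ.- b) ℤ.+ (b ℤ.- c) ≡ a ℤ.- c
    telescope = solve-∀
    equiv : IsEquivalence _~_
    equiv = record
      { refl  = λ {v} → divides 0ℤ (ℤ.+-inverseʳ (x v))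
      ; sym   = flipped
      ; trans = λ {u} {v} {w} p r → subst (d ∣_) (telescope (x w) (x v) (x u)) (∣m∣n⇒∣m+n r p)
      }

  -- Subtract from x its value at the root of each component.
  coboundary-saturated : ∀ d (x : Vector ℤ n) → (∀ e → e ∈ S → d ∣ x (head e) ℤ.- x (tail e)) →
    ∃ λ y → ∀ e → e ∈ S → x (head e) ℤ.- x (tail e) ≡ d ℤ.* (y (head e) ℤ.- y (tail e))
  coboundary-saturated d x edges = y , λ e e∈S → begin
    x (head e) ℤ.- x (tail e)
      ≡⟨ regroup (x (head e)) (x (tail e)) (x (rootOf (head e))) ⟩
    (x (head e) ℤ.- x (rootOf (head e))) ℤ.- (x (tail e) ℤ.- x (rootOf (head e)))
      ≡⟨ cong₂ ℤ._-_ (y-eq (head e)) (trans (cong (λ r → x (tail e) ℤ.- x r) (sym (rootOf-edge e∈S))) (y-eq (tail e))) ⟩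
    y (head e) ℤ.* d ℤ.- y (tail e) ℤ.* d
      ≡⟨ factor-out (y (head e)) (y (tail e)) d ⟩
    d ℤ.* (y (head e) ℤ.- y (tail e)) ∎
    where
    open ≡-Reasoning
    y : Vector ℤ n
    y v = _∣_.quotient (connected-∣ d x edges v)
    y-eq : ∀ v → x v ℤ.- x (rootOf v) ≡ y v ℤ.* d
    y-eq v = _∣_.equality (connected-∣ d x edges v)
    regroup : ∀ a b r → a ℤ.- b ≡ (a ℤ.- r) ℤ.- (b ℤ.- r)
    regroup = solve-∀
    factor-out : ∀ a b d → a ℤ.* d ℤ.- b ℤ.* d ≡ d ℤ.* (a ℤ.- b)
    factor-out = solve-∀

  IsPotential : Vector ℤ m → Vector ℤ n → Set
  IsPotential 𝐰 φ = ∀ e → e ∈ S → φ (head e) ℤ.- φ (tail e) ≡ 𝐰 e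

  IsPotentialMod : ℤ → Vector ℤ m → Vector ℤ n → Set
  IsPotentialMod d 𝐰 φ = ∀ e → e ∈ S → d ∣ φ (head e) ℤ.- φ (tail e) ℤ.- 𝐰 e

-- Potentials with values in a group containing ℤ

record Embedding {a ℓ} (A : AbelianGroup a ℓ) : Set (a ⊔ ℓ) where
  open AbelianGroup A using (Carrier; _≈_; _∙_; _⁻¹)
  field
    ι         : ℤ → Carrier
    -‿homo    : ∀ x y → ι (x ℤ.- y) ≈ ι x ∙ ι y ⁻¹
    injective : ∀ {x y} → ι x ≈ ι y → x ≡ y

module _ {a ℓ} (A : AbelianGroup a ℓ) (embedding : Embedding A) {n m} (G : Graph n m) (S : Subset m) (𝐰 : Vector ℤ m) where
  open AbelianGroup A renaming (refl to ≈-refl; sym to ≈-sym; trans to ≈-trans)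
  open Algebra.Properties.AbelianGroup A using (⁻¹-anti-homo-//; //-rightDividesˡ)
  open Embedding embedding
  open ComponentsOf G S
  open import Relation.Binary.Reasoning.Setoid setoid

  IsSolution : Vector Carrier n → Set ℓ
  IsSolution x = ∀ e → e ∈ S → x (head e) ∙ x (tail e) ⁻¹ ≈ ι (𝐰 e)

  private
    cancel : ∀ a b r → (a ∙ r ⁻¹) ∙ (b ∙ r ⁻¹) ⁻¹ ≈ a ∙ b ⁻¹
    cancel a b r = begin
      (a ∙ r ⁻¹) ∙ (b ∙ r ⁻¹) ⁻¹ ≈⟨ ∙-congˡ (⁻¹-anti-homo-// b r) ⟩
      (a ∙ r ⁻¹) ∙ (r ∙ b ⁻¹)    ≈⟨ assoc _ _ _ ⟨
      ((a ∙ r ⁻¹) ∙ r) ∙ b ⁻¹    ≈⟨ ∙-congʳ (//-rightDividesˡ r a) ⟩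
      a ∙ b ⁻¹                   ∎

    -- One integer serves all solutions at once. The relation can therefore be established along
    -- paths before a solution is known, and it holds vacuously if there is none.
    _~_ : Rel (Fin n) (a ⊔ ℓ)
    u ~ v = ∃ λ k → ∀ x → IsSolution x → x u ∙ x v ⁻¹ ≈ ι k

    ~-refl : ∀ {v} → v ~ v
    ~-refl {v} = 0ℤ , λ x _ → begin
      x v ∙ x v ⁻¹     ≈⟨ inverseʳ (x v) ⟩
      ε                ≈⟨ inverseʳ (ι 0ℤ) ⟨
      ι 0ℤ ∙ ι 0ℤ ⁻¹   ≈⟨ -‿homo 0ℤ 0ℤ ⟨
      ι 0ℤ             ∎

    close : ∀ {u v w} → u ~ w → v ~ w → u ~ v
    close (k , p) (l , q) = k ℤ.- l , λ x solution →
      ≈-trans (≈-sym (cancel _ _ _)) (≈-trans (∙-cong (p x solution) (⁻¹-cong (q x solution))) (≈-sym (-‿homo k l)))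

    ~-sym : ∀ {u v} → u ~ v → v ~ u
    ~-sym = close ~-refl

    distances : ∀ v → v ~ rootOf v
    distances = connected (record { refl = ~-refl ; sym = ~-sym ; trans = λ p q → close p (~-sym q) })
      (λ e e∈S → ~-sym (𝐰 e , λ x solution → solution e e∈S))

  -- The only possible solution vanishing at all roots, whatever the group.
  candidate : Vector ℤ n
  candidate v = proj₁ (distances v)

  -- The image of `candidate` in the group is `x` minus its value at the root of each component.
  -- Both ends of an edge of `S` have the same root, so the subtraction preserves the differences
  -- along edges; injectivity then brings the equation back to ℤ.
  candidate-potential : ∀ x → IsSolution x → IsPotential 𝐰 candidate
  candidate-potential x solution e e∈S = injective (begin
    ι (candidate (head e) ℤ.- candidate (tail e))
      ≈⟨ -‿homo _ _ ⟩
    ι (candidate (head e)) ∙ ι (candidate (tail e)) ⁻¹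
      ≈⟨ ∙-cong (proj₂ (distances (head e)) x solution)
           (⁻¹-cong (≈-trans (∙-congˡ (⁻¹-cong (reflexive (cong x (sym (rootOf-edge e∈S)))))) (proj₂ (distances (tail e)) x solution))) ⟨
    (x (head e) ∙ x (rootOf (head e)) ⁻¹) ∙ (x (tail e) ∙ x (rootOf (head e)) ⁻¹) ⁻¹
      ≈⟨ cancel _ _ _ ⟩
    x (head e) ∙ x (tail e) ⁻¹
      ≈⟨ solution e e∈S ⟩
    ι (𝐰 e) ∎)

  potential-descends : ∀ x → IsSolution x → ∃ (IsPotential 𝐰)
  potential-descends x solution = candidate , candidate-potential x solution

ℤ-embedding : Embedding ℤ.+-0-abelianGroup
ℤ-embedding = record { ι = id ; -‿homo = λ _ _ → refl ; injective = id }

module _ {n m} (G : Graph n m) (S : Subset m) (𝐰 : Vector ℤ m) where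
  open ComponentsOf G S

  abstract
    -- The candidate computed over ℤ is a potential as soon as any potential exists, so a search
    -- through infinitely many maps becomes a check of finitely many edges.
    potential? : Dec (∃ (IsPotential 𝐰))
    potential? = map′ (φ ,_) (λ (ψ , solution) → candidate-potential ℤ.+-0-abelianGroup ℤ-embedding G S 𝐰 ψ solution)
      (Fin.all? λ e → (e ∈? S) →-dec (φ (head e) ℤ.- φ (tail e) ℤ.≟ 𝐰 e))
      where
      φ : Vector ℤ n
      φ = candidate ℤ.+-0-abelianGroup ℤ-embedding G S 𝐰

-- Counting violating maps modulo q

module _ (q : ℕ) .{{_ : NonZero q}} where

  residue-∣ : ∀ z → + q ∣ z ℤ.- + toℕ (residue q z)
  residue-∣ z = divides (z ℤ./ℕ q) (begin
    z ℤ.- + toℕ (residue q z)  ≡⟨ cong (λ r → z ℤ.- + r) (Fin.toℕ-fromℕ< _) ⟩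
    z ℤ.- + (z ℤ.%ℕ q)         ≡⟨ cong (ℤ._- + (z ℤ.%ℕ q)) (ℤ.a≡a%ℕn+[a/ℕn]*n z q) ⟩
    (+ (z ℤ.%ℕ q) ℤ.+ z ℤ./ℕ q ℤ.* + q) ℤ.- + (z ℤ.%ℕ q) ≡⟨ cancel (+ (z ℤ.%ℕ q)) _ ⟩
    z ℤ./ℕ q ℤ.* + q ∎)
    where
    open ≡-Reasoning
    cancel : ∀ a b → (a ℤ.+ b) ℤ.- a ≡ b
    cancel = solve-∀

  -- Two representatives differ by less than `q` in absolute value, and the only such multiple of
  -- `q` is 0.
  toℕ-≡ : ∀ {a b : Fin q} → + q ∣ + toℕ a ℤ.- + toℕ b → a ≡ b
  toℕ-≡ {a} {b} d = Fin.toℕ-injective (ℤ.+-injective (ℤ.i-j≡0⇒i≡j (+ toℕ a) (+ toℕ b) (ℤ.∣i∣≡0⇒i≡0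
    (vanishes ℤ.∣ + toℕ a ℤ.- + toℕ b ∣ (∣⇒∣ᵤ d) small))))
    where
    vanishes : ∀ k → q ℕ.∣ k → k ℕ.< q → k ≡ 0
    vanishes zero    _ _   = refl
    vanishes (suc k) d k<q = contradiction k<q (ℕ.≤⇒≯ (ℕ.∣⇒≤ d))
    small : ℤ.∣ + toℕ a ℤ.- + toℕ b ∣ ℕ.< q
    small = ℕ.≤-<-trans
      (ℕ.≤-trans (ℕ.≤-reflexive (cong ℤ.∣_∣ (ℤ.m-n≡m⊖n (toℕ a) (toℕ b)))) (ℤ.∣m⊝n∣≤m⊔n (toℕ a) (toℕ b)))
      (ℕ.⊔-lub (Fin.toℕ<n a) (Fin.toℕ<n b))

  residue-≡⇒∣ : ∀ x y → residue q x ≡ residue q y → + q ∣ x ℤ.- y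
  residue-≡⇒∣ x y eq = subst (+ q ∣_) (regroup x y (+ toℕ (residue q x)))
    (∣m∣n⇒∣m-n (residue-∣ x) (subst (λ r → + q ∣ y ℤ.- + toℕ r) (sym eq) (residue-∣ y)))
    where
    regroup : ∀ x y r → (x ℤ.- r) ℤ.- (y ℤ.- r) ≡ x ℤ.- y
    regroup = solve-∀

  ∣⇒residue-≡ : ∀ x y → + q ∣ x ℤ.- y → residue q x ≡ residue q y
  ∣⇒residue-≡ x y d = toℕ-≡ (subst (+ q ∣_) (regroup x y _ _) (∣m∣n⇒∣m+n (∣m∣n⇒∣m-n d (residue-∣ x)) (residue-∣ y)))
    where
    regroup : ∀ x y r s → (x ℤ.- y ℤ.- (x ℤ.- r)) ℤ.+ (y ℤ.- s) ≡ r ℤ.- s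
    regroup = solve-∀

  module _ {n m} (G : Graph n m) (𝐰 : Vector ℤ m) where
    open Graph G

    lift : Vector (Fin q) n → Vector ℤ n
    lift c v = + toℕ (c v)

    Violates : Vector (Fin q) n → Fin m → Set
    Violates c e = subMod q (c (head e)) (c (tail e)) ≡ reduce q 𝐰 e

    violates? : ∀ c e → Dec (Violates c e)
    violates? c e = subMod q (c (head e)) (c (tail e)) Fin.≟ reduce q 𝐰 e

    violates⇒∣ : ∀ c e → Violates c e → + q ∣ lift c (head e) ℤ.- lift c (tail e) ℤ.- 𝐰 e
    violates⇒∣ c e = residue-≡⇒∣ (lift c (head e) ℤ.- lift c (tail e)) (𝐰 e)

    ∣⇒violates : ∀ c e → + q ∣ lift c (head e) ℤ.- lift c (tail e) ℤ.- 𝐰 e → Violates c e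
    ∣⇒violates c e = ∣⇒residue-≡ (lift c (head e) ℤ.- lift c (tail e)) (𝐰 e)

    module _ (S : Subset m) where
      open ComponentsOf G S using (#C; root; component; rootOf; component-root; component-edge; rootOf-edge; connected-∣; IsPotentialMod)

      AllViolated : Vector (Fin q) n → Set
      AllViolated c = ∀ e → e ∈ S → Violates c e

      allViolated? : ∀ c → Dec (AllViolated c)
      allViolated? c = allOf? (violates? c) S

      allViolated⇒potential : ∀ c → AllViolated c → IsPotentialMod (+ q) 𝐰 (lift c)
      allViolated⇒potential c all e e∈S = violates⇒∣ c e (all e e∈S)

      allViolated-resp : ∀ {c c′} → c ≗ c′ → AllViolated c → AllViolated c′
      allViolated-resp eq all e e∈S = trans (sym (cong₂ (subMod q) (eq (head e)) (eq (tail e)))) (all e e∈S)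

      -- The weights cancel in the difference of two such maps, which is therefore constant modulo
      -- `q` on each component, and vanishes if it vanishes at the roots.
      allViolated-determined : ∀ {c c′} → AllViolated c → AllViolated c′ → c ∘ root ≗ c′ ∘ root → c ≗ c′
      allViolated-determined {c} {c′} all all′ eq v = toℕ-≡ (subst (+ q ∣_) (drop (eq (component v)))
        (connected-∣ (+ q) difference (λ e e∈S → subst (+ q ∣_) (regroup (lift c (head e)) (lift c (tail e)) (lift c′ (head e)) (lift c′ (tail e)) (𝐰 e))
          (∣m∣n⇒∣m-n (allViolated⇒potential c all e e∈S) (allViolated⇒potential c′ all′ e e∈S))) v))
        where
        difference : Vector ℤ n
        difference u = lift c u ℤ.- lift c′ u
        regroup : ∀ a b a′ b′ w → (a ℤ.- b ℤ.- w) ℤ.- (a′ ℤ.- b′ ℤ.- w) ≡ (a ℤ.- a′) ℤ.- (b ℤ.- b′)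
        regroup = solve-∀
        simplify : ∀ a b r → (a ℤ.- b) ℤ.- (r ℤ.- r) ≡ a ℤ.- b
        simplify = solve-∀
        drop : c (rootOf v) ≡ c′ (rootOf v) → difference v ℤ.- difference (rootOf v) ≡ lift c v ℤ.- lift c′ v
        drop p = trans (cong (λ r → difference v ℤ.- (lift c (rootOf v) ℤ.- + toℕ r)) (sym p)) (simplify (lift c v) (lift c′ v) (lift c (rootOf v)))

      module _ (φ : Vector ℤ n) (φ-potential : IsPotentialMod (+ q) 𝐰 φ) where

        translate : Vector (Fin q) #C → Vector (Fin q) n
        translate g v = residue q (+ toℕ (g (component v)) ℤ.+ φ v)

        translate-violates : ∀ g → AllViolated (translate g)
        translate-violates g e e∈S = ∣⇒violates (translate g) e (subst (+ q ∣_)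
          (trans (cong (λ k → (φ (head e) ℤ.- φ (tail e) ℤ.- 𝐰 e ℤ.- (gh ℤ.+ φ (head e) ℤ.- lift (translate g) (head e))) ℤ.+ (+ toℕ (g k) ℤ.+ φ (tail e) ℤ.- lift (translate g) (tail e))) (component-edge e∈S))
            (regroup (φ (head e)) (φ (tail e)) (𝐰 e) gh _ _))
          (∣m∣n⇒∣m+n (∣m∣n⇒∣m-n (φ-potential e e∈S) (residue-∣ (gh ℤ.+ φ (head e)))) (residue-∣ (+ toℕ (g (component (tail e))) ℤ.+ φ (tail e)))))
          where
          gh : ℤ
          gh = + toℕ (g (component (head e)))
          regroup : ∀ a b w g r s → (a ℤ.- b ℤ.- w ℤ.- (g ℤ.+ a ℤ.- r)) ℤ.+ (g ℤ.+ b ℤ.- s) ≡ r ℤ.- s ℤ.- w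
          regroup = solve-∀

        translate-injective : ∀ {g g′} → translate g ≗ translate g′ → g ≗ g′
        translate-injective {g} {g′} eq i = toℕ-≡ (subst (+ q ∣_) (cancel (+ toℕ (g i)) (+ toℕ (g′ i)) (φ (root i)))
          (subst (λ k → + q ∣ (+ toℕ (g k) ℤ.+ φ (root i)) ℤ.- (+ toℕ (g′ k) ℤ.+ φ (root i))) (component-root i) (residue-≡⇒∣ (+ toℕ (g (component (root i))) ℤ.+ φ (root i)) (+ toℕ (g′ (component (root i))) ℤ.+ φ (root i)) (eq (root i)))))
          where
          cancel : ∀ a b f → (a ℤ.+ f) ℤ.- (b ℤ.+ f) ≡ a ℤ.- b
          cancel = solve-∀

        -- Restriction to the roots and translation of `φ` by one residue per component are
        -- injections in opposite directions, so it is enough to compare cardinalities and no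
        -- inverse has to be exhibited.
        count-allViolated : count {n} {q} allViolated? ≡ q ℕ.^ #C
        count-allViolated = trans
          (ℕ.≤-antisym
            (count-≤ allViolated? all? (λ _ _ → tt) (_∘ root) (λ _ → tt) allViolated-determined)
            (count-≤ all? allViolated? allViolated-resp translate (λ {g} _ → translate-violates g) (λ _ _ → translate-injective)))
          (count-all all? (λ _ → tt))
          where
          all? : (g : Vector (Fin q) #C) → Dec ⊤
          all? _ = yes tt

      count-allViolated-none : ¬ ∃ (IsPotentialMod (+ q) 𝐰) → count {n} {q} allViolated? ≡ 0
      count-allViolated-none none = count-none allViolated? λ c all → none (lift c , allViolated⇒potential c all)

    numColorings-inclusion-exclusion : + numColorings q G (reduce q 𝐰) ≡ sumOver (subsets m) λ S → sign S ℤ.* + count {n} {q} (allViolated? S)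
    numColorings-inclusion-exclusion = inclusion-exclusion violates? (allMaps n q)

-- The representatives 0, ..., q-1 of a coloring are read modulo pq. Since q divides pq, an edge
-- violated modulo pq would already be violated modulo q.
numColorings-mono : ∀ {n m} (G : Graph n m) (𝐰 : Vector ℤ m) p q .{{_ : NonZero p}} .{{_ : NonZero q}} .{{pq≢0 : NonZero (p ℕ.* q)}} →
  numColorings q G (reduce q 𝐰) ℕ.≤ numColorings (p ℕ.* q) G (reduce (p ℕ.* q) 𝐰)
numColorings-mono G 𝐰 p q = count-≤ (isColoring? q G (reduce q 𝐰)) (isColoring? (p ℕ.* q) G (reduce (p ℕ.* q) 𝐰))
  (λ eq colors e → colors e ∘ trans (cong₂ (subMod (p ℕ.* q)) (eq (head e)) (eq (tail e))))
  (inclusion ∘_)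
  (λ {c} colors e violated → colors e (∣⇒violates q G 𝐰 c e (subst₂ (λ a b → + q ∣ + a ℤ.- + b ℤ.- 𝐰 e)
    (Fin.toℕ-inject≤ (c (head e)) q≤pq) (Fin.toℕ-inject≤ (c (tail e)) q≤pq)
    (∣-trans (∣ᵤ⇒∣ (ℕ.n∣m*n p)) (violates⇒∣ (p ℕ.* q) G 𝐰 (inclusion ∘ c) e violated)))))
  (λ _ _ eq v → Fin.inject≤-injective q≤pq q≤pq _ _ (eq v))
  where
  open Graph G
  q≤pq : q ℕ.≤ p ℕ.* q
  q≤pq = ℕ.m≤n*m q p
  inclusion : Fin q → Fin (p ℕ.* q)
  inclusion a = Fin.inject≤ a q≤pq

-- The augmented incidence matrix

augment : ∀ {A : Set} {n} → Vector A n → A → Vector A (n ℕ.+ 1)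
augment x k = x Vector.++ Vector.replicate 1 k

initial : ∀ {A : Set} {n} → Vector A (n ℕ.+ 1) → Vector A n
initial y v = y (v ↑ˡ 1)

final : ∀ {A : Set} {n} → Vector A (n ℕ.+ 1) → A
final {n = n} y = y (n ↑ʳ zero)

initial-augment : ∀ {A : Set} {n} (x : Vector A n) k v → initial (augment x k) v ≡ x v
initial-augment x k = lookup-++ˡ x (Vector.replicate 1 k)

final-augment : ∀ {A : Set} {n} (x : Vector A n) k → final (augment x k) ≡ k
final-augment x k = lookup-++ʳ x (Vector.replicate 1 k) zero

-- The incidence matrix as a coboundary, over any commutative ring

module RingSums {c ℓ} (R : CommutativeRing c ℓ) where
  open CommutativeRing R renaming (refl to ≈-refl; sym to ≈-sym; trans to ≈-trans; zero to *-zero)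
  open RingProperties ring using (-0#≈0#; -‿distribˡ-*; -‿distribʳ-*)
  open Sum semiring public using (sum; sum-cong-≋; sum-replicate-zero)
  open import Relation.Binary.Reasoning.Setoid setoid

  sum-0 : ∀ {n} (f : Vector Carrier n) → (∀ i → f i ≈ 0#) → sum f ≈ 0#
  sum-0 {n} f f≈0 = ≈-trans (sum-cong-≋ f≈0) (sum-replicate-zero n)

  sum-single : ∀ {n} (i : Fin n) (f : Vector Carrier n) → (∀ j → j ≢ i → f j ≈ 0#) → sum f ≈ f i
  sum-single zero    f f≈0 = ≈-trans (+-congˡ (sum-0 (f ∘ suc) λ j → f≈0 (suc j) λ ())) (+-identityʳ _)
  sum-single (suc i) f f≈0 = ≈-trans (+-cong (f≈0 zero λ ()) (sum-single i (f ∘ suc) λ j j≢i → f≈0 (suc j) (j≢i ∘ Fin.suc-injective))) (+-identityˡ _)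

  sum-++ : ∀ {m n} (f : Vector Carrier (m ℕ.+ n)) → sum f ≈ sum (λ i → f (i ↑ˡ n)) + sum (λ j → f (m ↑ʳ j))
  sum-++ {zero}  f = ≈-sym (+-identityˡ _)
  sum-++ {suc m} f = ≈-trans (+-congˡ (sum-++ {m} (f ∘ suc))) (≈-sym (+-assoc _ _ _))

  unit : ∀ {n} → Fin n → Vector Carrier n
  unit u v with v Fin.≟ u
  ... | yes _ = 1#
  ... | no _  = 0#

  unit-≡ : ∀ {n} (u : Fin n) {v} → v ≡ u → unit u v ≈ 1#
  unit-≡ u {v} v≡u with v Fin.≟ u
  ... | yes _  = ≈-refl
  ... | no v≢u = contradiction v≡u v≢u

  unit-≢ : ∀ {n} (u : Fin n) {v} → v ≢ u → unit u v ≈ 0#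
  unit-≢ u {v} v≢u with v Fin.≟ u
  ... | yes v≡u = contradiction v≡u v≢u
  ... | no _    = ≈-refl

  sum-unit : ∀ {n} (u : Fin n) (x : Vector Carrier n) → sum (λ v → unit u v * x v) ≈ x u
  sum-unit u x = ≈-trans (sum-single u _ λ v v≢u → ≈-trans (*-congʳ (unit-≢ u v≢u)) (zeroˡ (x v)))
    (≈-trans (*-congʳ (unit-≡ u refl)) (*-identityˡ (x u)))

  module _ (ι : ℤ → Carrier) (ι-0 : ι 0ℤ ≈ 0#) (ι-1 : ι 1ℤ ≈ 1#) (ι--1 : ι -1ℤ ≈ - 1#) {n m} (G : Graph n m) where
    open Graph G
    open Sum semiring using (∑-distrib-+)

    private
      -- For a loop the two unit vectors coincide and cancel, in agreement with the zero column
      -- prescribed for loops. After this lemma loops need no separate treatment.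
      incidence-unit : ∀ e v → ι (incidence G v e) ≈ unit (head e) v - unit (tail e) v
      incidence-unit e v with tail e Fin.≟ head e | v Fin.≟ head e | v Fin.≟ tail e
      ... | yes _   | yes _   | yes _   = ≈-trans ι-0 (≈-sym (-‿inverseʳ 1#))
      ... | yes t≡h | yes v≡h | no v≢t  = contradiction (trans v≡h (sym t≡h)) v≢t
      ... | yes t≡h | no v≢h  | yes v≡t = contradiction (trans v≡t t≡h) v≢h
      ... | yes _   | no _    | no _    = ≈-trans ι-0 (≈-sym (-‿inverseʳ 0#))
      ... | no t≢h  | yes v≡h | yes v≡t = contradiction (trans (sym v≡t) v≡h) t≢h
      ... | no _    | yes _   | no _    = ≈-trans ι-1 (≈-sym (≈-trans (+-congˡ -0#≈0#) (+-identityʳ 1#)))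
      ... | no _    | no _    | yes _   = ≈-trans ι--1 (≈-sym (+-identityˡ (- 1#)))
      ... | no _    | no _    | no _    = ≈-trans ι-0 (≈-sym (-‿inverseʳ 0#))

    sum-incidence : ∀ e (x : Vector Carrier n) → sum (λ v → ι (incidence G v e) * x v) ≈ x (head e) - x (tail e)
    sum-incidence e x = begin
      sum (λ v → ι (incidence G v e) * x v)
        ≈⟨ sum-cong-≋ (λ v → ≈-trans (*-congʳ (incidence-unit e v)) (≈-trans (distribʳ (x v) _ _) (+-congˡ (≈-trans (≈-sym (-‿distribˡ-* _ _)) (-‿distribʳ-* _ _))))) ⟩
      sum (λ v → unit (head e) v * x v + unit (tail e) v * - x v)
        ≈⟨ ∑-distrib-+ (λ v → unit (head e) v * x v) (λ v → unit (tail e) v * - x v) ⟩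
      sum (λ v → unit (head e) v * x v) + sum (λ v → unit (tail e) v * - x v)
        ≈⟨ +-cong (sum-unit (head e) x) (sum-unit (tail e) (λ v → - x v)) ⟩
      x (head e) - x (tail e) ∎

    -- A vector is split into a vertex function and a last coordinate that multiplies the weights.
    -- The incidence entries are only 0, 1 and -1, so a map `ι` respecting these three suffices; the
    -- identity of ℤ and the inclusion into ℚ are the two uses.
    sum-augmented : ∀ 𝐰 e (y : Vector Carrier (n ℕ.+ 1)) →
      sum (λ j → ι (augmented G 𝐰 e j) * y j) ≈ (y (head e ↑ˡ 1) - y (tail e ↑ˡ 1)) + ι (𝐰 e) * y (n ↑ʳ zero)
    sum-augmented 𝐰 e y = begin
      sum (λ j → ι (augmented G 𝐰 e j) * y j)
        ≈⟨ sum-++ {n} {1} (λ j → ι (augmented G 𝐰 e j) * y j) ⟩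
      sum (λ v → ι (augmented G 𝐰 e (v ↑ˡ 1)) * y (v ↑ˡ 1)) + (ι (augmented G 𝐰 e (n ↑ʳ zero)) * y (n ↑ʳ zero) + 0#)
        ≈⟨ +-cong (sum-cong-≋ λ v → *-congʳ (reflexive (cong ι (initial-augment (λ u → incidence G u e) (𝐰 e) v))))
                  (≈-trans (+-identityʳ _) (*-congʳ (reflexive (cong ι (final-augment (λ u → incidence G u e) (𝐰 e)))))) ⟩
      sum (λ v → ι (incidence G v e) * y (v ↑ˡ 1)) + ι (𝐰 e) * y (n ↑ʳ zero)
        ≈⟨ +-congʳ (sum-incidence e (λ v → y (v ↑ˡ 1))) ⟩
      (y (head e ↑ˡ 1) - y (tail e ↑ˡ 1)) + ι (𝐰 e) * y (n ↑ʳ zero) ∎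

-- The Smith normal form

module SmithTheory where
  open IntegerMatrix
  open SmithExistence using (I-refl; sum-I; ⊗-cong; ⊗-assoc; I⊗; ⊗I; _∙_; ≋-refl; ≋-sym; divMod; SmithForm)
  open RingSums ℤ.+-*-commutativeRing using (sum-0; sum-single; sum-augmented)
  open Sum ℤ.+-*-semiring using (sum; sum-cong-≗; *-distribˡ-sum)

  lastNonZero-All : ∀ {P : ℤ → Set} {xs} → All P xs → lastNonZero xs ≢ 0ℤ → P (lastNonZero xs)
  lastNonZero-All []                   ≢0 = contradiction refl ≢0
  lastNonZero-All {xs = x ∷ xs} (p ∷ ps) ≢0 with lastNonZero xs ℤ.≟ 0ℤ
  ... | yes _   = p
  ... | no ≢0′ = lastNonZero-All ps ≢0′

  lastNonZero-0 : ∀ xs → lastNonZero xs ≡ 0ℤ → All (_≡ 0ℤ) xs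
  lastNonZero-0 []       _  = []
  lastNonZero-0 (x ∷ xs) eq with lastNonZero xs ℤ.≟ 0ℤ
  ... | yes eq′ = eq ∷ lastNonZero-0 xs eq′
  ... | no ≢0   = contradiction eq ≢0

  -- If all later entries vanish, a nonzero entry is itself the last one; otherwise it divides every
  -- later entry, in particular the last nonzero one.
  lastNonZero-∣ : ∀ {xs} → AllPairs _∣_ xs → All (λ x → x ≢ 0ℤ → x ∣ lastNonZero xs) xs
  lastNonZero-∣ []                       = []
  lastNonZero-∣ {x ∷ xs} (x∣ ∷ pairs) with lastNonZero xs ℤ.≟ 0ℤ
  ... | yes eq = (λ _ → ∣-refl) ∷ All.map (λ ≡0 ≢0 → contradiction ≡0 ≢0) (lastNonZero-0 xs eq)
  ... | no ≢0  = (λ _ → lastNonZero-All x∣ ≢0) ∷ lastNonZero-∣ pairs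

  diagonal-All⁺ : ∀ {P : ℤ → Set} {k n} (D : Matrix ℤ k n) → (∀ i j → toℕ i ≡ toℕ j → P (D i j)) → All P (diagonal D)
  diagonal-All⁺ {k = zero}  {n}     D p = []
  diagonal-All⁺ {k = suc k} {zero}  D p = []
  diagonal-All⁺ {k = suc k} {suc n} D p = p zero zero refl ∷ diagonal-All⁺ _ (λ i j → p (suc i) (suc j) ∘ cong suc)

  diagonal-All⁻ : ∀ {P : ℤ → Set} {k n} (D : Matrix ℤ k n) → All P (diagonal D) → ∀ i j → toℕ i ≡ toℕ j → P (D i j)
  diagonal-All⁻ {k = suc k} {suc n} D (p ∷ ps) zero    zero    eq = p
  diagonal-All⁻ {k = suc k} {suc n} D (p ∷ ps) (suc i) (suc j) eq = diagonal-All⁻ _ ps i j (ℕ.suc-injective eq)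

  infixl 7 _⊙_
  _⊙_ : ∀ {k n} → Matrix ℤ k n → Vector ℤ n → Vector ℤ k
  (M ⊙ y) i = sum λ j → M i j ℤ.* y j

  module _ {k n} (M : Matrix ℤ k n) where

    ⊙-cong : ∀ {y z} → y ≗ z → M ⊙ y ≗ M ⊙ z
    ⊙-cong eq i = sum-cong-≗ λ j → cong (M i j ℤ.*_) (eq j)

    ⊙-scale : ∀ a y → M ⊙ (λ j → a ℤ.* y j) ≗ λ i → a ℤ.* (M ⊙ y) i
    ⊙-scale a y i = trans (sum-cong-≗ λ j → swap (M i j) a (y j)) (sym (*-distribˡ-sum a λ j → M i j ℤ.* y j))
      where
      swap : ∀ m a b → m ℤ.* (a ℤ.* b) ≡ a ℤ.* (m ℤ.* b)
      swap = solve-∀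

    ⊗-⊙ : ∀ {l} (A : Matrix ℤ l k) y → (A ⊗ M) ⊙ y ≗ A ⊙ (M ⊙ y)
    ⊗-⊙ A y i = ⊗-assoc A M (λ j (_ : Fin 1) → y j) i zero

  ≋-⊙ : ∀ {k n} {A B : Matrix ℤ k n} → A ≋ B → ∀ y → A ⊙ y ≗ B ⊙ y
  ≋-⊙ eq y i = sum-cong-≗ λ j → cong (ℤ._* y j) (eq i j)

  I-⊙ : ∀ {k} (y : Vector ℤ k) → I ⊙ y ≗ y
  I-⊙ y i = sum-I i y

  *-cancel-≢0 : ∀ a {b c} → a ≢ 0ℤ → a ℤ.* b ≡ a ℤ.* c → b ≡ c
  *-cancel-≢0 a a≢0 = ℤ.*-cancelˡ-≡ a _ _ {{≢-nonZero a≢0}}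

  -- The rows can be solved independently. A nonzero diagonal entry divides `d`, so the equation
  -- with `d` is solvable; where the diagonal entry is zero or missing, the hypothesis gives s u =
  -- 0, hence u = 0 in that row, and 0 solves it.
  diagonal-multiple : ∀ {k n} (D : Matrix ℤ k n) → (∀ i j → toℕ i ≢ toℕ j → D i j ≡ 0ℤ) →
    ∀ d → All (λ x → x ≢ 0ℤ → x ∣ d) (diagonal D) → ∀ s → s ≢ 0ℤ → ∀ (u : Vector ℤ k) z → (∀ i → (D ⊙ z) i ≡ s ℤ.* u i) →
    ∃ λ y → ∀ i → (D ⊙ y) i ≡ d ℤ.* u i
  diagonal-multiple {zero}  {n}     D off d all s s≢0 u z eq = (λ _ → 0ℤ) , λ ()
  diagonal-multiple {suc k} {zero}  D off d all s s≢0 u z eq = (λ ()) , λ i →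
    sym (trans (cong (d ℤ.*_) (*-cancel-≢0 s s≢0 (trans (sym (eq i)) (sym (ℤ.*-zeroʳ s))))) (ℤ.*-zeroʳ d))
  diagonal-multiple {suc k} {suc n} D off d (D₀∣d ∷ all) s s≢0 u z eq = y , λ where
      zero    → trans (top y) (proj₂ first)
      (suc i) → trans (below y i) (proj₂ rest i)
    where
    D′ : Matrix ℤ k n
    D′ i j = D (suc i) (suc j)
    top : ∀ y → (D ⊙ y) zero ≡ D zero zero ℤ.* y zero
    top y = trans (cong (ℤ._+_ (D zero zero ℤ.* y zero)) (sum-0 (λ j → D zero (suc j) ℤ.* y (suc j)) λ j → cong (ℤ._* y (suc j)) (off zero (suc j) λ ()))) (ℤ.+-identityʳ _)
    below : ∀ y i → (D ⊙ y) (suc i) ≡ (D′ ⊙ (y ∘ suc)) i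
    below y i = trans (cong (λ a → a ℤ.* y zero ℤ.+ (D′ ⊙ (y ∘ suc)) i) (off (suc i) zero λ ())) (ℤ.+-identityˡ _)
    rest : ∃ λ y → ∀ i → (D′ ⊙ y) i ≡ d ℤ.* u (suc i)
    rest = diagonal-multiple D′ (λ i j i≢j → off (suc i) (suc j) (i≢j ∘ ℕ.suc-injective)) d all s s≢0 (u ∘ suc) (z ∘ suc)
      λ i → trans (sym (below z i)) (eq (suc i))
    first : ∃ λ y₀ → D zero zero ℤ.* y₀ ≡ d ℤ.* u zero
    first with D zero zero ℤ.≟ 0ℤ
    ... | yes D₀≡0 = 0ℤ , trans (ℤ.*-zeroʳ (D zero zero)) (sym (trans (cong (d ℤ.*_) u₀≡0) (ℤ.*-zeroʳ d)))
      where
      u₀≡0 : u zero ≡ 0ℤ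
      u₀≡0 = *-cancel-≢0 s s≢0 (trans (sym (eq zero)) (trans (top z) (trans (cong (ℤ._* z zero) D₀≡0) (sym (ℤ.*-zeroʳ s)))))
    ... | no D₀≢0 with D₀∣d D₀≢0
    ...   | divides q d≡ = q ℤ.* u zero , trans (swap (D zero zero) q (u zero)) (cong (ℤ._* u zero) (sym d≡))
      where
      swap : ∀ a q u → a ℤ.* (q ℤ.* u) ≡ q ℤ.* a ℤ.* u
      swap = solve-∀
    y : Vector ℤ (suc n)
    y = proj₁ first Vector.∷ proj₁ rest

  -- Only the equivalence and the shape of `D` are used, not the elimination that produced it. The
  -- number `d` may be negative; divisibility is insensitive to this.
  module SmithProperties {k n} (M D : Matrix ℤ k n) (M~D : M ~ D) (smith : IsSmith D) where
    open _~_ M~D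
    private
      U⁻¹ : Matrix ℤ k k
      U⁻¹ = proj₁ U-unimodular
      V⁻¹ : Matrix ℤ n n
      V⁻¹ = proj₁ V-unimodular
      UU⁻¹ : U ⊗ U⁻¹ ≋ I
      UU⁻¹ = proj₁ (proj₂ U-unimodular)
      U⁻¹U : U⁻¹ ⊗ U ≋ I
      U⁻¹U = proj₂ (proj₂ U-unimodular)
      off : ∀ i j → toℕ i ≢ toℕ j → D i j ≡ 0ℤ
      off = proj₁ smith

      UM≋DV⁻¹ : U ⊗ M ≋ D ⊗ V⁻¹
      UM≋DV⁻¹ = ≋-sym (⊗I (U ⊗ M)) ∙ ⊗-cong {A = U ⊗ M} ≋-refl (≋-sym (proj₁ (proj₂ V-unimodular)))
        ∙ ≋-sym (⊗-assoc (U ⊗ M) V V⁻¹) ∙ ⊗-cong {B = V⁻¹} equation ≋-refl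

      MV≋U⁻¹D : M ⊗ V ≋ U⁻¹ ⊗ D
      MV≋U⁻¹D = ≋-sym (I⊗ (M ⊗ V)) ∙ ⊗-cong {B = M ⊗ V} (≋-sym U⁻¹U) ≋-refl ∙ ⊗-assoc U⁻¹ U (M ⊗ V)
        ∙ ⊗-cong {A = U⁻¹} ≋-refl (≋-sym (⊗-assoc U M V) ∙ equation)

      UM-⊙ : ∀ z → U ⊙ (M ⊙ z) ≗ D ⊙ (V⁻¹ ⊙ z)
      UM-⊙ z i = trans (sym (⊗-⊙ M U z i)) (trans (≋-⊙ UM≋DV⁻¹ z i) (⊗-⊙ V⁻¹ D z i))

      MV-⊙ : ∀ y → M ⊙ (V ⊙ y) ≗ U⁻¹ ⊙ (D ⊙ y)
      MV-⊙ y i = trans (sym (⊗-⊙ V M y i)) (trans (≋-⊙ MV≋U⁻¹D y i) (⊗-⊙ D U⁻¹ y i))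

      U⁻¹U-⊙ : ∀ v → U⁻¹ ⊙ (U ⊙ v) ≗ v
      U⁻¹U-⊙ v i = trans (sym (⊗-⊙ U U⁻¹ v i)) (trans (≋-⊙ U⁻¹U v i) (I-⊙ v i))

    d : ℤ
    d = lastNonZero (diagonal D)

    -- The hypothesis says that `v` is a torsion class in the cokernel of `M`, and the conclusion
    -- that `d` kills it. Multiplication by `U` turns the equation into one about `D`, and `V`
    -- carries the solution back.
    d-annihilates : ∀ s → s ≢ 0ℤ → ∀ (v : Vector ℤ k) z → (∀ i → (M ⊙ z) i ≡ s ℤ.* v i) → ∃ λ y → ∀ i → (M ⊙ y) i ≡ d ℤ.* v i
    d-annihilates s s≢0 v z eq = V ⊙ y , λ i → begin
      (M ⊙ (V ⊙ y)) i                     ≡⟨ MV-⊙ y i ⟩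
      (U⁻¹ ⊙ (D ⊙ y)) i                   ≡⟨ ⊙-cong U⁻¹ (proj₂ multiple) i ⟩
      (U⁻¹ ⊙ (λ j → d ℤ.* (U ⊙ v) j)) i   ≡⟨ ⊙-scale U⁻¹ d (U ⊙ v) i ⟩
      d ℤ.* (U⁻¹ ⊙ (U ⊙ v)) i             ≡⟨ cong (d ℤ.*_) (U⁻¹U-⊙ v i) ⟩
      d ℤ.* v i                           ∎
      where
      open ≡-Reasoning
      multiple : ∃ λ y → ∀ i → (D ⊙ y) i ≡ d ℤ.* (U ⊙ v) i
      multiple = diagonal-multiple D off d (lastNonZero-∣ (proj₂ smith)) s s≢0 (U ⊙ v) (V⁻¹ ⊙ z)
        λ i → trans (sym (UM-⊙ z i)) (trans (⊙-cong U eq i) (⊙-scale U s v i))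
      y : Vector ℤ n
      y = proj₁ multiple

    -- Some diagonal entry D i j equals `d`. Column i of the inverse of `U` then represents a class
    -- of order exactly `d` in the cokernel, and column j of `V` witnesses that `d` kills it.
    d-exact : d ≢ 0ℤ → ∃₂ λ (v : Vector ℤ k) y → (∀ i → (M ⊙ y) i ≡ d ℤ.* v i) × (∀ a z → (∀ i → (M ⊙ z) i ≡ a ℤ.* v i) → d ∣ a)
    d-exact d≢0 = entry (lastNonZero-All {λ x → ∃₂ λ i j → toℕ i ≡ toℕ j × D i j ≡ x} (diagonal-All⁺ D λ i j i≡j → i , j , i≡j , refl) d≢0)
      where
      open ≡-Reasoning
      entry : (∃₂ λ i j → toℕ i ≡ toℕ j × D i j ≡ d) →
              ∃₂ λ (v : Vector ℤ k) y → (∀ i → (M ⊙ y) i ≡ d ℤ.* v i) × (∀ a z → (∀ i → (M ⊙ z) i ≡ a ℤ.* v i) → d ∣ a)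
      entry (i , j , i≡j , Dij) = v , (λ t → V t j) , image , exact
        where
        v : Vector ℤ k
        v s = U⁻¹ s i
        image : ∀ s → (M ⊗ V) s j ≡ d ℤ.* v s
        image s = begin
          (M ⊗ V) s j       ≡⟨ MV≋U⁻¹D s j ⟩
          (U⁻¹ ⊗ D) s j     ≡⟨ sum-single i _ (λ t t≢i → trans (cong (U⁻¹ s t ℤ.*_) (off t j λ t≡j → t≢i (Fin.toℕ-injective (trans t≡j (sym i≡j))))) (ℤ.*-zeroʳ (U⁻¹ s t))) ⟩
          U⁻¹ s i ℤ.* D i j ≡⟨ trans (ℤ.*-comm (U⁻¹ s i) (D i j)) (cong (ℤ._* v s) Dij) ⟩
          d ℤ.* v s         ∎
        exact : ∀ a z → (∀ s → (M ⊙ z) s ≡ a ℤ.* v s) → d ∣ a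
        exact a z eq = divides ((V⁻¹ ⊙ z) j) (begin
          a                               ≡⟨ ℤ.*-identityʳ a ⟨
          -- The 1 is the diagonal entry (i, i) of the product of `U` and its inverse, that is,
          -- coordinate i of `v` in the Smith basis.
          a ℤ.* 1ℤ                        ≡⟨ cong (a ℤ.*_) (trans (UU⁻¹ i i) (I-refl i)) ⟨
          a ℤ.* (U ⊙ v) i                 ≡⟨ ⊙-scale U a v i ⟨
          (U ⊙ (λ s → a ℤ.* v s)) i       ≡⟨ ⊙-cong U eq i ⟨
          (U ⊙ (M ⊙ z)) i                 ≡⟨ UM-⊙ z i ⟩
          (D ⊙ (V⁻¹ ⊙ z)) i               ≡⟨ sum-single j _ (λ t t≢j → cong (ℤ._* (V⁻¹ ⊙ z) t) (off i t λ i≡t → t≢j (Fin.toℕ-injective (trans (sym i≡t) i≡j)))) ⟩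
          D i j ℤ.* (V⁻¹ ⊙ z) j           ≡⟨ trans (cong (ℤ._* (V⁻¹ ⊙ z) j) Dij) (ℤ.*-comm d _) ⟩
          (V⁻¹ ⊙ z) j ℤ.* d               ∎)

    d≡0⇒image-trivial : d ≡ 0ℤ → ∀ z i → (M ⊙ z) i ≡ 0ℤ
    d≡0⇒image-trivial d≡0 z i = begin
      (M ⊙ z) i                ≡⟨ U⁻¹U-⊙ (M ⊙ z) i ⟨
      (U⁻¹ ⊙ (U ⊙ (M ⊙ z))) i  ≡⟨ ⊙-cong U⁻¹ (UM-⊙ z) i ⟩
      (U⁻¹ ⊙ (D ⊙ (V⁻¹ ⊙ z))) i
        ≡⟨ sum-0 (λ s → U⁻¹ i s ℤ.* (D ⊙ (V⁻¹ ⊙ z)) s) (λ s → trans (cong (U⁻¹ i s ℤ.*_) (sum-0 (λ t → D s t ℤ.* (V⁻¹ ⊙ z) t) λ t → cong (ℤ._* (V⁻¹ ⊙ z) t) (D≡0 s t))) (ℤ.*-zeroʳ (U⁻¹ i s))) ⟩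
      0ℤ ∎
      where
      open ≡-Reasoning
      D≡0 : ∀ s t → D s t ≡ 0ℤ
      D≡0 s t with toℕ s ℕ.≟ toℕ t
      ... | yes s≡t = diagonal-All⁻ D (lastNonZero-0 (diagonal D) d≡0) s t s≡t
      ... | no s≢t  = off s t s≢t

  bezout : ∀ a b → Acc ℕ._<_ ℤ.∣ b ∣ → ∃ λ g → g ∣ a × g ∣ b × ∃₂ λ x y → g ≡ x ℤ.* a ℤ.+ y ℤ.* b
  bezout a b (acc rec) with b ℤ.≟ 0ℤ
  ... | yes refl = a , ∣-refl , divides 0ℤ refl , 1ℤ , 0ℤ , unit a
    where
    unit : ∀ a → a ≡ 1ℤ ℤ.* a ℤ.+ 0ℤ ℤ.* 0ℤ
    unit = solve-∀
  ... | no b≢0 with divMod a b b≢0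
  ...   | q , r , a≡ , r< with bezout b r (rec r<)
  ...     | g , g∣b , g∣r , x , y , g≡ =
    g , subst (g ∣_) (sym a≡) (∣m∣n⇒∣m+n g∣r (∣n⇒∣m*n q g∣b)) , g∣b , y , x ℤ.- y ℤ.* q ,
    trans g≡ (trans (regroup x y b q r) (cong (λ c → y ℤ.* c ℤ.+ (x ℤ.- y ℤ.* q) ℤ.* b) (sym a≡)))
    where
    regroup : ∀ x y b q r → x ℤ.* b ℤ.+ y ℤ.* r ≡ y ℤ.* (r ℤ.+ q ℤ.* b) ℤ.+ (x ℤ.- y ℤ.* q) ℤ.* b
    regroup = solve-∀

  -- The largest invariant factor and potentials modulo q

  module FactorProperties {n m} (G : Graph n m) (𝐰 : Vector ℤ m) (S : Subset m) where
    open ComponentsOf G S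
    private
      M : Matrix ℤ Subset.∣ S ∣ (n ℕ.+ 1)
      M = augmentedOn G 𝐰 S
      form : SmithForm M
      form = SmithExistence.smith M
    open SmithProperties M (proj₁ form) (proj₁ (proj₂ form)) (proj₂ (proj₂ form))

    δ : Vector ℤ n → Vector ℤ m
    δ x e = x (head e) ℤ.- x (tail e)

    M-⊙ : ∀ y i → (M ⊙ y) i ≡ δ (initial y) (element S i) ℤ.+ 𝐰 (element S i) ℤ.* final y
    M-⊙ y i = sum-augmented id refl refl refl G 𝐰 (element S i) y

    M-⊙-augment : ∀ x k i → (M ⊙ augment x k) i ≡ δ x (element S i) ℤ.+ 𝐰 (element S i) ℤ.* k
    M-⊙-augment x k i = trans (M-⊙ (augment x k) i) (cong₂ (λ a b → a ℤ.+ 𝐰 (element S i) ℤ.* b)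
      (cong₂ ℤ._-_ (initial-augment x k _) (initial-augment x k _)) (final-augment x k))

    onRows : ∀ {P : Fin m → Set} → (∀ i → P (element S i)) → ∀ e → e ∈ S → P e
    onRows p e e∈S with element-onto S e e∈S
    ... | i , refl = p i

    -- If there is no nonzero invariant factor the whole matrix acts as zero. Its last column is `𝐰`
    -- on `S`, so the zero map is a potential.
    factor≡0⇒potential : factor G 𝐰 S ≡ 0 → ∃ (IsPotential 𝐰)
    factor≡0⇒potential factor≡0 = (λ _ → 0ℤ) , onRows λ i → sym (trans (sym (simplify (𝐰 (element S i))))
      (trans (sym (M-⊙-augment (λ _ → 0ℤ) 1ℤ i)) (d≡0⇒image-trivial (ℤ.∣i∣≡0⇒i≡0 factor≡0) (augment (λ _ → 0ℤ) 1ℤ) i)))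
      where
      simplify : ∀ a → (0ℤ ℤ.- 0ℤ) ℤ.+ a ℤ.* 1ℤ ≡ a
      simplify = solve-∀

    -- Take a class `v` of exact order d and a vector (x, y₀) with δ x + y₀ 𝐰 = d v. If y₀ is
    -- invertible modulo d, this equation expresses 𝐰 as a coboundary modulo d. A common divisor g
    -- of y₀ and d also divides δ x, and by saturation the equation can be divided by g; exactness
    -- of the order then forces g to be a unit.
    potential-mod-factor : factor G 𝐰 S ≢ 0 → ∃ (IsPotentialMod (+ factor G 𝐰 S) 𝐰)
    potential-mod-factor factor≢0 = solve-mod (d-exact d≢0)
      where
      d≢0 : d ≢ 0ℤ
      d≢0 = factor≢0 ∘ cong ℤ.∣_∣
      solve-mod : (∃₂ λ (v : Vector ℤ Subset.∣ S ∣) y → (∀ i → (M ⊙ y) i ≡ d ℤ.* v i) × (∀ a z → (∀ i → (M ⊙ z) i ≡ a ℤ.* v i) → d ∣ a)) →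
                  ∃ (IsPotentialMod (+ ℤ.∣ d ∣) 𝐰)
      solve-mod (v , y , image , exact) = unit (bezout y₀ d (<-wellFounded _))
        where
        x : Vector ℤ n
        x = initial y
        y₀ : ℤ
        y₀ = final y
        row : ∀ i → δ x (element S i) ℤ.+ 𝐰 (element S i) ℤ.* y₀ ≡ d ℤ.* v i
        row i = trans (sym (M-⊙ y i)) (image i)
        unit : (∃ λ g → g ∣ y₀ × g ∣ d × ∃₂ λ a b → g ≡ a ℤ.* y₀ ℤ.+ b ℤ.* d) → ∃ (IsPotentialMod (+ ℤ.∣ d ∣) 𝐰)
        unit (g , g∣y₀@(divides y₀′ y₀≡) , g∣d@(divides d′ d≡) , a , b , g≡) =
          -- Since q a y₀ + q b d = 1, the number q a inverts y₀ modulo d, and 𝐰 is congruent to -(q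
          -- a) δ x.
          (λ u → ℤ.- (q ℤ.* a) ℤ.* x u) , onRows λ i → ∣-trans (∣ᵤ⇒∣ ℕ.∣-refl) (divides (ℤ.- (q ℤ.* a ℤ.* v i ℤ.+ q ℤ.* b ℤ.* 𝐰 (element S i))) (solved i))
          where
          open ≡-Reasoning
          g≢0 : g ≢ 0ℤ
          g≢0 refl = d≢0 (trans d≡ (ℤ.*-zeroʳ d′))
          d′≢0 : d′ ≢ 0ℤ
          d′≢0 refl = d≢0 d≡
          cancel : ∀ a b → (a ℤ.+ b) ℤ.- b ≡ a
          cancel = solve-∀
          saturated : ∃ λ x′ → ∀ e → e ∈ S → δ x e ≡ g ℤ.* δ x′ e
          saturated = coboundary-saturated g x (onRows λ i → subst (g ∣_)
            (trans (cong (ℤ._- (𝐰 (element S i) ℤ.* y₀)) (sym (row i))) (cancel (δ x (element S i)) (𝐰 (element S i) ℤ.* y₀)))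
            (∣m∣n⇒∣m-n (∣m⇒∣m*n (v i) g∣d) (∣n⇒∣m*n (𝐰 (element S i)) g∣y₀)))
          x′ : Vector ℤ n
          x′ = proj₁ saturated
          factor-g : ∀ g a w b → g ℤ.* (a ℤ.+ w ℤ.* b) ≡ g ℤ.* a ℤ.+ w ℤ.* (b ℤ.* g)
          factor-g = solve-∀
          swap : ∀ d g v → (d ℤ.* g) ℤ.* v ≡ g ℤ.* (d ℤ.* v)
          swap = solve-∀
          divided : ∀ i → (M ⊙ augment x′ y₀′) i ≡ d′ ℤ.* v i
          divided i = *-cancel-≢0 g g≢0 (begin
            g ℤ.* (M ⊙ augment x′ y₀′) i
              ≡⟨ cong (g ℤ.*_) (M-⊙-augment x′ y₀′ i) ⟩
            g ℤ.* (δ x′ (element S i) ℤ.+ 𝐰 (element S i) ℤ.* y₀′)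
              ≡⟨ factor-g g (δ x′ (element S i)) (𝐰 (element S i)) y₀′ ⟩
            g ℤ.* δ x′ (element S i) ℤ.+ 𝐰 (element S i) ℤ.* (y₀′ ℤ.* g)
              ≡⟨ cong₂ (λ p r → p ℤ.+ 𝐰 (element S i) ℤ.* r) (proj₂ saturated _ (element-∈ S i)) y₀≡ ⟨
            δ x (element S i) ℤ.+ 𝐰 (element S i) ℤ.* y₀
              ≡⟨ row i ⟩
            d ℤ.* v i
              ≡⟨ cong (ℤ._* v i) d≡ ⟩
            (d′ ℤ.* g) ℤ.* v i
              ≡⟨ swap d′ g (v i) ⟩
            g ℤ.* (d′ ℤ.* v i) ∎)
          -- Here `d′` is d / g, and the divided equation shows that it already kills the class of
          -- `v`.
          d∣d′ : d ∣ d′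
          d∣d′ = exact d′ (augment x′ y₀′) divided
          -- From d′ = q d and d = d′ g follows q g = 1, so `q` is the inverse of the unit g.
          q : ℤ
          q = _∣_.quotient d∣d′
          rotate : ∀ q d g → q ℤ.* (d ℤ.* g) ≡ d ℤ.* (q ℤ.* g)
          rotate = solve-∀
          qg≡1 : 1ℤ ≡ q ℤ.* (a ℤ.* y₀ ℤ.+ b ℤ.* d)
          qg≡1 = trans (*-cancel-≢0 d′ d′≢0 (begin
            d′ ℤ.* 1ℤ          ≡⟨ ℤ.*-identityʳ d′ ⟩
            d′                 ≡⟨ _∣_.equality d∣d′ ⟩
            q ℤ.* d            ≡⟨ cong (q ℤ.*_) d≡ ⟩
            q ℤ.* (d′ ℤ.* g)   ≡⟨ rotate q d′ g ⟩
            d′ ℤ.* (q ℤ.* g)   ∎)) (cong (q ℤ.*_) g≡)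
          expand : ∀ q a b x₁ x₀ w y₀ d → ℤ.- (q ℤ.* a) ℤ.* x₁ ℤ.- ℤ.- (q ℤ.* a) ℤ.* x₀ ℤ.- q ℤ.* (a ℤ.* y₀ ℤ.+ b ℤ.* d) ℤ.* w
            ≡ ℤ.- (q ℤ.* a ℤ.* (x₁ ℤ.- x₀ ℤ.+ w ℤ.* y₀) ℤ.+ q ℤ.* b ℤ.* w ℤ.* d)
          expand = solve-∀
          collect : ∀ q a b v w d → ℤ.- (q ℤ.* a ℤ.* (d ℤ.* v) ℤ.+ q ℤ.* b ℤ.* w ℤ.* d) ≡ ℤ.- (q ℤ.* a ℤ.* v ℤ.+ q ℤ.* b ℤ.* w) ℤ.* d
          collect = solve-∀
          solved : ∀ i → ℤ.- (q ℤ.* a) ℤ.* x (head (element S i)) ℤ.- ℤ.- (q ℤ.* a) ℤ.* x (tail (element S i)) ℤ.- 𝐰 (element S i)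
                   ≡ ℤ.- (q ℤ.* a ℤ.* v i ℤ.+ q ℤ.* b ℤ.* 𝐰 (element S i)) ℤ.* d
          solved i = begin
            ψ ℤ.- 𝐰 e
              ≡⟨ cong (λ r → ψ ℤ.- r) (trans (sym (ℤ.*-identityˡ (𝐰 e))) (cong (ℤ._* 𝐰 e) qg≡1)) ⟩
            ψ ℤ.- q ℤ.* (a ℤ.* y₀ ℤ.+ b ℤ.* d) ℤ.* 𝐰 e
              ≡⟨ expand q a b (x (head e)) (x (tail e)) (𝐰 e) y₀ d ⟩
            ℤ.- (q ℤ.* a ℤ.* (δ x e ℤ.+ 𝐰 e ℤ.* y₀) ℤ.+ q ℤ.* b ℤ.* 𝐰 e ℤ.* d)
              ≡⟨ cong (λ r → ℤ.- (q ℤ.* a ℤ.* r ℤ.+ q ℤ.* b ℤ.* 𝐰 e ℤ.* d)) (row i) ⟩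
            ℤ.- (q ℤ.* a ℤ.* (d ℤ.* v i) ℤ.+ q ℤ.* b ℤ.* 𝐰 e ℤ.* d)
              ≡⟨ collect q a b (v i) (𝐰 e) d ⟩
            ℤ.- (q ℤ.* a ℤ.* v i ℤ.+ q ℤ.* b ℤ.* 𝐰 e) ℤ.* d ∎
            where
            e : Fin m
            e = element S i
            ψ : ℤ
            ψ = ℤ.- (q ℤ.* a) ℤ.* x (head e) ℤ.- ℤ.- (q ℤ.* a) ℤ.* x (tail e)

    -- Write 𝐰 = δ φ + q v on `S`. The vector (-φ, 1) is mapped to q v, so `v` is a torsion class
    -- and d v = δ x + y₀ 𝐰 for some (x, y₀). Substituting for 𝐰 makes (d - y₀ q) v a coboundary. If
    -- the coefficient were nonzero, saturation would make `v` a coboundary and 𝐰 one as well; hence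
    -- d = y₀ q.
    potential-mod⇒∣factor : ¬ ∃ (IsPotential 𝐰) → ∀ q → q ≢ 0 → ∃ (IsPotentialMod (+ q) 𝐰) → q ℕ.∣ factor G 𝐰 S
    potential-mod⇒∣factor none q q≢0 (φ , solves) = decide (d-annihilates (+ q) (q≢0 ∘ ℤ.+-injective) v (augment (ℤ.-_ ∘ φ) 1ℤ) rows)
      where
      defect : ∀ i → + q ∣ δ φ (element S i) ℤ.- 𝐰 (element S i)
      defect i = solves (element S i) (element-∈ S i)
      v : Vector ℤ Subset.∣ S ∣
      v i = ℤ.- _∣_.quotient (defect i)
      w-eq : ∀ i → 𝐰 (element S i) ≡ δ φ (element S i) ℤ.+ + q ℤ.* v i
      w-eq i = trans (complement (δ φ (element S i)) (𝐰 (element S i))) (trans (cong (λ r → δ φ (element S i) ℤ.- r) (_∣_.equality (defect i)))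
        (negate (δ φ (element S i)) (_∣_.quotient (defect i)) (+ q)))
        where
        complement : ∀ a w → w ≡ a ℤ.- (a ℤ.- w)
        complement = solve-∀
        negate : ∀ a k q → a ℤ.- k ℤ.* q ≡ a ℤ.+ q ℤ.* (ℤ.- k)
        negate = solve-∀
      rows : ∀ i → (M ⊙ augment (ℤ.-_ ∘ φ) 1ℤ) i ≡ + q ℤ.* v i
      rows i = trans (M-⊙-augment (ℤ.-_ ∘ φ) 1ℤ i) (trans (cong (λ w → δ (ℤ.-_ ∘ φ) (element S i) ℤ.+ w ℤ.* 1ℤ) (w-eq i))
        (cancel (φ (head (element S i))) (φ (tail (element S i))) (+ q ℤ.* v i)))
        where
        cancel : ∀ a b k → ((ℤ.- a) ℤ.- (ℤ.- b)) ℤ.+ ((a ℤ.- b) ℤ.+ k) ℤ.* 1ℤ ≡ k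
        cancel = solve-∀
      decide : (∃ λ y → ∀ i → (M ⊙ y) i ≡ d ℤ.* v i) → q ℕ.∣ factor G 𝐰 S
      decide (y , image) = by-case (t ℤ.≟ 0ℤ)
        where
        open ≡-Reasoning
        x : Vector ℤ n
        x = initial y
        y₀ t : ℤ
        y₀ = final y
        -- `t` is the coefficient with δ (x + y₀ φ) = t v.
        t = d ℤ.- y₀ ℤ.* + q
        z : Vector ℤ n
        z u = x u ℤ.+ y₀ ℤ.* φ u
        δz : ∀ i → δ z (element S i) ≡ t ℤ.* v i
        δz i = begin
          δ z e
            ≡⟨ regroup (x (head e)) (x (tail e)) y₀ (φ (head e)) (φ (tail e)) (+ q) (v i) ⟩
          (δ x e ℤ.+ (δ φ e ℤ.+ + q ℤ.* v i) ℤ.* y₀) ℤ.- y₀ ℤ.* + q ℤ.* v i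
            ≡⟨ cong (λ w → (δ x e ℤ.+ w ℤ.* y₀) ℤ.- y₀ ℤ.* + q ℤ.* v i) (w-eq i) ⟨
          (δ x e ℤ.+ 𝐰 e ℤ.* y₀) ℤ.- y₀ ℤ.* + q ℤ.* v i
            ≡⟨ cong (λ r → r ℤ.- y₀ ℤ.* + q ℤ.* v i) (trans (sym (M-⊙ y i)) (image i)) ⟩
          d ℤ.* v i ℤ.- y₀ ℤ.* + q ℤ.* v i
            ≡⟨ collect d (y₀ ℤ.* + q) (v i) ⟩
          t ℤ.* v i ∎
          where
          e : Fin m
          e = element S i
          regroup : ∀ x₁ x₀ y f₁ f₀ q v → (x₁ ℤ.+ y ℤ.* f₁) ℤ.- (x₀ ℤ.+ y ℤ.* f₀)
            ≡ ((x₁ ℤ.- x₀) ℤ.+ ((f₁ ℤ.- f₀) ℤ.+ q ℤ.* v) ℤ.* y) ℤ.- y ℤ.* q ℤ.* v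
          regroup = solve-∀
          collect : ∀ d y v → d ℤ.* v ℤ.- y ℤ.* v ≡ (d ℤ.- y) ℤ.* v
          collect = solve-∀
        by-case : Dec (t ≡ 0ℤ) → q ℕ.∣ factor G 𝐰 S
        by-case (yes t≡0) = ∣⇒∣ᵤ (divides y₀ (ℤ.i-j≡0⇒i≡j d (y₀ ℤ.* + q) t≡0))
        by-case (no t≢0)  = contradiction (potential (coboundary-saturated t z (onRows λ i → divides (v i) (trans (δz i) (ℤ.*-comm t (v i)))))) none
          where
          potential : (∃ λ y → ∀ e → e ∈ S → δ z e ≡ t ℤ.* δ y e) → ∃ (IsPotential 𝐰)
          potential (y , eq) = (λ u → φ u ℤ.+ + q ℤ.* y u) , onRows λ i → begin
            (φ (head (element S i)) ℤ.+ + q ℤ.* y (head (element S i))) ℤ.- (φ (tail (element S i)) ℤ.+ + q ℤ.* y (tail (element S i)))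
              ≡⟨ regroup (φ (head (element S i))) _ (+ q) _ (y (tail (element S i))) ⟩
            δ φ (element S i) ℤ.+ + q ℤ.* δ y (element S i)
              ≡⟨ cong (λ r → δ φ (element S i) ℤ.+ + q ℤ.* r) (*-cancel-≢0 t t≢0 (trans (sym (eq _ (element-∈ S i))) (δz i))) ⟩
            δ φ (element S i) ℤ.+ + q ℤ.* v i
              ≡⟨ w-eq i ⟨
            𝐰 (element S i) ∎
            where
            regroup : ∀ f₁ f₀ q y₁ y₀ → (f₁ ℤ.+ q ℤ.* y₁) ℤ.- (f₀ ℤ.+ q ℤ.* y₀) ≡ (f₁ ℤ.- f₀) ℤ.+ q ℤ.* (y₁ ℤ.- y₀)
            regroup = solve-∀

open SmithTheory using (module FactorProperties)

-- The rank over ℚ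

module RankTheory where
  ℚ-embedding : Embedding ℚ.+-0-abelianGroup
  ℚ-embedding = record
    { ι = _/ 1
    ; -‿homo = λ x y → ℚ.toℚᵘ-injective (begin
        ℚ.toℚᵘ ((x ℤ.- y) / 1)                     ≈⟨ ℚ.toℚᵘ-fromℚᵘ (mkℚᵘ (x ℤ.- y) 0) ⟩
        mkℚᵘ (x ℤ.- y) 0                           ≈⟨ *≡* (over-1 x y) ⟩
        mkℚᵘ x 0 ℚᵘ.- mkℚᵘ y 0                     ≈⟨ ℚᵘ.+-cong (ℚ.toℚᵘ-fromℚᵘ (mkℚᵘ x 0)) (ℚᵘ.-‿cong (ℚ.toℚᵘ-fromℚᵘ (mkℚᵘ y 0))) ⟨
        ℚ.toℚᵘ (x / 1) ℚᵘ.- ℚ.toℚᵘ (y / 1)         ≈⟨ ℚᵘ.+-congʳ (ℚ.toℚᵘ (x / 1)) (ℚ.toℚᵘ-homo‿- (y / 1)) ⟨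
        ℚ.toℚᵘ (x / 1) ℚᵘ.+ ℚ.toℚᵘ (ℚ.- (y / 1))   ≈⟨ ℚ.toℚᵘ-homo-+ (x / 1) (ℚ.- (y / 1)) ⟨
        ℚ.toℚᵘ (x / 1 ℚ.- y / 1)                   ∎)
    ; injective = λ {x} {y} eq → integral x y (ℚ./-injective-≃ (mkℚᵘ x 0) (mkℚᵘ y 0) eq)
    }
    where
    open import Relation.Binary.Reasoning.Setoid ℚᵘ.≃-setoid
    over-1 : ∀ x y → (x ℤ.- y) ℤ.* 1ℤ ≡ (x ℤ.* 1ℤ ℤ.+ (ℤ.- y) ℤ.* 1ℤ) ℤ.* 1ℤ
    over-1 = solve-∀
    integral : ∀ x y → mkℚᵘ x 0 ℚᵘ.≃ mkℚᵘ y 0 → x ≡ y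
    integral x y (*≡* eq) = trans (sym (ℤ.*-identityʳ x)) (trans eq (ℤ.*-identityʳ y))

  open RingSums ℚ.+-*-commutativeRing using (sum-0; sum-single; sum-++; sum-augmented; unit; unit-≡; unit-≢; sum-unit)
  open CommutativeRing ℚ.+-*-commutativeRing using (semiring; +-commutativeMonoid)
  open Sum semiring using (sum; sum-cong-≗; ∑-comm; ∑-distrib-+; *-distribˡ-sum; *-distribʳ-sum)
  open CommutativeMonoidSum +-commutativeMonoid using (sum-remove)
  open +-*-Solver using (solve; _:+_; _:*_; :-_; _:-_; _:=_; con)
  open RankExistence using (Vectors; hasBasis; Span-member)
  open LinearAlgebra ℚ.heytingField using (combination; Span; LinearlyIndependent; HasDimension)

  -- Linear dependence and orthogonality over ℚ

  NonTrivial : ∀ {n} → Vector ℚ n → Set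
  NonTrivial a = ∃ λ i → a i ≢ 0ℚ

  -- Elimination on the first coordinate: if it vanishes everywhere it is dropped, otherwise one
  -- pivot vector is used up together with it, so vectors stay more numerous than coordinates.
  dependence : ∀ {k l} → k ℕ.< l → (C : Vectors l k) → ∃ λ a → NonTrivial a × (∀ j → combination C a j ≡ 0ℚ)
  dependence {zero}  {suc l} _ C = (λ _ → 1ℚ) , (zero , λ ()) , λ ()
  dependence {suc k} {suc l} (ℕ.s≤s k<l) C = decide (Fin.any? λ i → ¬? (C i zero ℚ.≟ 0ℚ))
    where
    decide : Dec (∃ λ i → C i zero ≢ 0ℚ) → ∃ λ a → NonTrivial a × (∀ j → combination C a j ≡ 0ℚ)
    decide (no none) = extend (dependence (ℕ.m<n⇒m<1+n k<l) λ i j → C i (suc j))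
      where
      extend : (∃ λ a → NonTrivial a × (∀ j → combination (λ i j → C i (suc j)) a j ≡ 0ℚ)) → ∃ λ a → NonTrivial a × (∀ j → combination C a j ≡ 0ℚ)
      extend (a , nontrivial , rest) = a , nontrivial , λ where
        zero    → sum-0 (λ i → a i ℚ.* C i zero) λ i → trans (cong (a i ℚ.*_) (decidable-stable (C i zero ℚ.≟ 0ℚ) λ ≢0 → none (i , ≢0))) (ℚ.*-zeroʳ (a i))
        (suc j) → rest j
    decide (yes (p , C≢0)) = insert (dependence k<l λ i j → cleared i (suc j))
      where
      instance _ = ℚ.≢-nonZero C≢0
      multiplier : Fin l → ℚ
      multiplier i = C (punchIn p i) zero ℚ.* ℚ.1/ C p zero
      cleared : Vectors l (suc k)
      cleared i j = C (punchIn p i) j ℚ.- multiplier i ℚ.* C p j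
      cleared-zero : ∀ i → cleared i zero ≡ 0ℚ
      cleared-zero i = trans (cong (λ x → C (punchIn p i) zero ℚ.- x) (trans (ℚ.*-assoc (C (punchIn p i) zero) (ℚ.1/ C p zero) (C p zero))
        (trans (cong (C (punchIn p i) zero ℚ.*_) (ℚ.*-inverseˡ (C p zero))) (ℚ.*-identityʳ (C (punchIn p i) zero))))) (ℚ.+-inverseʳ (C (punchIn p i) zero))
      insert : (∃ λ a → NonTrivial a × (∀ j → combination (λ i j → cleared i (suc j)) a j ≡ 0ℚ)) → ∃ λ a → NonTrivial a × (∀ j → combination C a j ≡ 0ℚ)
      insert (a , (i , aᵢ≢0) , rest) = a⁺ , (punchIn p i , aᵢ≢0 ∘ trans (sym (insertAt-punchIn a p a₀ i))) , λ j → begin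
        combination C a⁺ j
          ≡⟨ sum-remove {i = p} (λ i → a⁺ i ℚ.* C i j) ⟩
        a⁺ p ℚ.* C p j ℚ.+ sum (λ i → a⁺ (punchIn p i) ℚ.* C (punchIn p i) j)
          ≡⟨ cong₂ (λ x y → x ℚ.* C p j ℚ.+ y) (insertAt-lookup a p a₀) (sum-cong-≗ λ i → trans (cong (ℚ._* C (punchIn p i) j) (insertAt-punchIn a p a₀ i))
               (separate (a i) (C (punchIn p i) j) (multiplier i) (C p j))) ⟩
        a₀ ℚ.* C p j ℚ.+ sum (λ i → a i ℚ.* cleared i j ℚ.+ a i ℚ.* multiplier i ℚ.* C p j)
          ≡⟨ cong (a₀ ℚ.* C p j ℚ.+_) (trans (∑-distrib-+ (λ i → a i ℚ.* cleared i j) (λ i → a i ℚ.* multiplier i ℚ.* C p j))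
               (cong₂ ℚ._+_ (vanish j) (sym (*-distribʳ-sum (C p j) (λ i → a i ℚ.* multiplier i))))) ⟩
        a₀ ℚ.* C p j ℚ.+ (0ℚ ℚ.+ sum (λ i → a i ℚ.* multiplier i) ℚ.* C p j)
          ≡⟨ solve 2 (λ s c → (:- s) :* c :+ (con 0ℚ :+ s :* c) := con 0ℚ) refl (sum (λ i → a i ℚ.* multiplier i)) (C p j) ⟩
        0ℚ ∎
        where
        open ≡-Reasoning
        -- The coefficient of the pivot vector undoes the multiples of it that were subtracted in
        -- `cleared`.
        a₀ : ℚ
        a₀ = ℚ.- sum (λ i → a i ℚ.* multiplier i)
        a⁺ : Vector ℚ (suc l)
        a⁺ = Vector.insertAt a p a₀
        separate : ∀ a c m d → a ℚ.* c ≡ a ℚ.* (c ℚ.- m ℚ.* d) ℚ.+ a ℚ.* m ℚ.* d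
        separate = solve 4 (λ a c m d → a :* c := a :* (c :- m :* d) :+ a :* m :* d) refl
        vanish : ∀ j → sum (λ i → a i ℚ.* cleared i j) ≡ 0ℚ
        vanish zero    = sum-0 (λ i → a i ℚ.* cleared i zero) λ i → trans (cong (a i ℚ.*_) (cleared-zero i)) (ℚ.*-zeroʳ (a i))
        vanish (suc j) = rest j

  ⟨_,_⟩ : ∀ {n} → Vector ℚ n → Vector ℚ n → ℚ
  ⟨ u , v ⟩ = sum λ j → u j ℚ.* v j

  ⟨⟩-comm : ∀ {n} (u v : Vector ℚ n) → ⟨ u , v ⟩ ≡ ⟨ v , u ⟩
  ⟨⟩-comm u v = sum-cong-≗ λ j → ℚ.*-comm (u j) (v j)

  ⟨⟩-combination : ∀ {k n} (B : Vectors k n) a y → ⟨ combination B a , y ⟩ ≡ sum λ i → a i ℚ.* ⟨ B i , y ⟩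
  ⟨⟩-combination B a y = begin
    sum (λ j → sum (λ i → a i ℚ.* B i j) ℚ.* y j)
      ≡⟨ sum-cong-≗ (λ j → *-distribʳ-sum (y j) (λ i → a i ℚ.* B i j)) ⟩
    sum (λ j → sum λ i → a i ℚ.* B i j ℚ.* y j)
      ≡⟨ ∑-comm (λ j i → a i ℚ.* B i j ℚ.* y j) ⟩
    sum (λ i → sum λ j → a i ℚ.* B i j ℚ.* y j)
      ≡⟨ sum-cong-≗ (λ i → trans (sum-cong-≗ λ j → ℚ.*-assoc (a i) (B i j) (y j)) (sym (*-distribˡ-sum (a i) (λ j → B i j ℚ.* y j)))) ⟩
    sum (λ i → a i ℚ.* ⟨ B i , y ⟩) ∎
    where open ≡-Reasoning

  Span-annihilated : ∀ {k n} (A : Vectors k n) y → (∀ i → ⟨ A i , y ⟩ ≡ 0ℚ) → ∀ {u} → Span A u → ⟨ u , y ⟩ ≡ 0ℚ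
  Span-annihilated A y A⊥y {u} (a , eq) = begin
    ⟨ u , y ⟩                       ≡⟨ sum-cong-≗ (λ j → cong (ℚ._* y j) (eq j)) ⟩
    ⟨ combination A a , y ⟩         ≡⟨ ⟨⟩-combination A a y ⟩
    sum (λ i → a i ℚ.* ⟨ A i , y ⟩) ≡⟨ sum-0 _ (λ i → trans (cong (a i ℚ.*_) (A⊥y i)) (ℚ.*-zeroʳ (a i))) ⟩
    0ℚ                              ∎
    where open ≡-Reasoning

  -- If E together with the rows of A has no common kernel, and Y is a family in
  -- the kernel of A dual to E, then E is a basis of a complement of the row space.
  module _ {k n l} (A : Vectors k n) (E Y : Vectors l n)
           (A⊥Y : ∀ i j → ⟨ A i , Y j ⟩ ≡ 0ℚ)
           (EY-≢ : ∀ i j → i ≢ j → ⟨ E i , Y j ⟩ ≡ 0ℚ)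
           (EY-≡ : ∀ i → ⟨ E i , Y i ⟩ ≡ 1ℚ)
           (kernel : ∀ y → (∀ i → ⟨ A i , y ⟩ ≡ 0ℚ) → (∀ j → ⟨ E j , y ⟩ ≡ 0ℚ) → ∀ i → y i ≡ 0ℚ)
           where

    -- Both inequalities come from `dependence`, applied once to the rows and once to the columns of
    -- the family `B` that joins `b` and `E`.
    dimension-complement : ∀ {r} → HasDimension (Span A) r → r ℕ.+ l ≡ n
    dimension-complement {r} (b , independent , spans) = ℕ.≤-antisym (ℕ.≮⇒≥ upper) (ℕ.≮⇒≥ lower)
      where
      open ≡-Reasoning
      b∈ : ∀ i → Span A (b i)
      b∈ i = Equivalence.from (spans (b i)) (Span-member b i)
      B : Vectors (r ℕ.+ l) n
      B = b Vector.++ E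
      upper : ¬ n ℕ.< r ℕ.+ l
      upper n< = refute (dependence n< B)
        where
        refute : ¬ ∃ λ a → NonTrivial a × (∀ j → combination B a j ≡ 0ℚ)
        refute (a , (i , aᵢ≢0) , dependent) = aᵢ≢0 (trans (cong a (sym (Fin.join-splitAt r l i))) (vanish (Fin.splitAt r i)))
          where
          aᵇ : Vector ℚ r
          aᵇ i = a (i ↑ˡ l)
          aᴱ : Vector ℚ l
          aᴱ i = a (r ↑ʳ i)
          halves : ∀ j → combination b aᵇ j ℚ.+ combination E aᴱ j ≡ 0ℚ
          halves j = trans (sym (trans (sum-++ {r} {l} (λ i → a i ℚ.* B i j))
            (cong₂ ℚ._+_ (sum-cong-≗ λ i → cong (λ v → aᵇ i ℚ.* v j) (lookup-++ˡ b E i))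
                         (sum-cong-≗ λ i → cong (λ v → aᴱ i ℚ.* v j) (lookup-++ʳ b E i))))) (dependent j)
          -- Pairing the relation with `Y t` kills the part in the row space and leaves the
          -- coefficient of `E t`.
          aᴱ≡0 : ∀ t → aᴱ t ≡ 0ℚ
          aᴱ≡0 t = begin
            aᴱ t
              ≡⟨ trans (cong (aᴱ t ℚ.*_) (EY-≡ t)) (ℚ.*-identityʳ (aᴱ t)) ⟨
            aᴱ t ℚ.* ⟨ E t , Y t ⟩
              ≡⟨ sum-single t _ (λ i i≢t → trans (cong (aᴱ i ℚ.*_) (EY-≢ i t i≢t)) (ℚ.*-zeroʳ (aᴱ i))) ⟨
            sum (λ i → aᴱ i ℚ.* ⟨ E i , Y t ⟩)
              ≡⟨ ⟨⟩-combination E aᴱ (Y t) ⟨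
            ⟨ combination E aᴱ , Y t ⟩
              ≡⟨ trans (cong (ℚ._+ ⟨ combination E aᴱ , Y t ⟩) (Span-annihilated b (Y t) (λ i → Span-annihilated A (Y t) (λ i → A⊥Y i t) (b∈ i)) {combination b aᵇ} (aᵇ , λ _ → refl))) (ℚ.+-identityˡ _) ⟨
            ⟨ combination b aᵇ , Y t ⟩ ℚ.+ ⟨ combination E aᴱ , Y t ⟩
              ≡⟨ ∑-distrib-+ (λ j → combination b aᵇ j ℚ.* Y t j) (λ j → combination E aᴱ j ℚ.* Y t j) ⟨
            sum (λ j → combination b aᵇ j ℚ.* Y t j ℚ.+ combination E aᴱ j ℚ.* Y t j)
              ≡⟨ sum-0 _ (λ j → trans (sym (ℚ.*-distribʳ-+ (Y t j) (combination b aᵇ j) (combination E aᴱ j))) (trans (cong (ℚ._* Y t j) (halves j)) (ℚ.*-zeroˡ (Y t j)))) ⟩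
            0ℚ ∎
          aᵇ≡0 : ∀ i → aᵇ i ≡ 0ℚ
          aᵇ≡0 = independent aᵇ λ j → trans (sym (trans (cong (combination b aᵇ j ℚ.+_) (sum-0 (λ i → aᴱ i ℚ.* E i j) λ i → trans (cong (ℚ._* E i j) (aᴱ≡0 i)) (ℚ.*-zeroˡ (E i j)))) (ℚ.+-identityʳ _))) (halves j)
          vanish : ∀ s → a (Fin.join r l s) ≡ 0ℚ
          vanish (inj₁ i) = aᵇ≡0 i
          vanish (inj₂ i) = aᴱ≡0 i
      -- With too few vectors some nonzero `y` is orthogonal to all of `B`, hence to the rows of `A`
      -- and to `E`, against `kernel`.
      lower : ¬ r ℕ.+ l ℕ.< n
      lower <n = refute (dependence <n λ j i → B i j)
        where
        refute : ¬ ∃ λ y → NonTrivial y × (∀ i → combination (λ j i → B i j) y i ≡ 0ℚ)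
        refute (y , (i , yᵢ≢0) , orthogonal) = yᵢ≢0 (kernel y
          (λ i → Span-annihilated b y (λ i → trans (cong ⟨_, y ⟩ (sym (lookup-++ˡ b E i))) (B⊥y (i ↑ˡ l))) (Equivalence.to (spans (A i)) (Span-member A i)))
          (λ j → trans (cong ⟨_, y ⟩ (sym (lookup-++ʳ b E j))) (B⊥y (r ↑ʳ j))) i)
          where
          B⊥y : ∀ i → ⟨ B i , y ⟩ ≡ 0ℚ
          B⊥y i = trans (⟨⟩-comm (B i) y) (orthogonal i)

  ⟨augment,⟩ : ∀ {n} (x : Vector ℚ n) k y → ⟨ augment x k , y ⟩ ≡ ⟨ x , initial y ⟩ ℚ.+ k ℚ.* final y
  ⟨augment,⟩ {n} x k y = trans (sum-++ {n} {1} (λ j → augment x k j ℚ.* y j)) (cong₂ ℚ._+_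
    (sum-cong-≗ λ v → cong (ℚ._* initial y v) (initial-augment x k v))
    (trans (ℚ.+-identityʳ _) (cong (ℚ._* final y) (final-augment x k))))

  ⟨augment-unit,⟩ : ∀ {n} (u : Fin n) k y → ⟨ augment (unit u) k , y ⟩ ≡ initial y u ℚ.+ k ℚ.* final y
  ⟨augment-unit,⟩ u k y = trans (⟨augment,⟩ (unit u) k y) (cong (ℚ._+ k ℚ.* final y) (sum-unit u (initial y)))

  initial-final-≡0 : ∀ {n} (y : Vector ℚ (n ℕ.+ 1)) → (∀ v → initial y v ≡ 0ℚ) → final y ≡ 0ℚ → ∀ j → y j ≡ 0ℚ
  initial-final-≡0 {n} y initial≡0 final≡0 j = trans (cong y (sym (Fin.join-splitAt n 1 j))) (parts (Fin.splitAt n j))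
    where
    parts : ∀ s → y (Fin.join n 1 s) ≡ 0ℚ
    parts (inj₁ v)    = initial≡0 v
    parts (inj₂ zero) = final≡0

  -- The rank of the augmented incidence matrix

  module RankProperties {n m} (G : Graph n m) (𝐰 : Vector ℤ m) (S : Subset m) where
    open ComponentsOf G S
    open ≡-Reasoning

    private
      A : Vectors Subset.∣ S ∣ (n ℕ.+ 1)
      A i j = augmentedOn G 𝐰 S i j / 1

      basis : HasDimension (Span A) (rank (augmentedOn G 𝐰 S))
      basis = proj₂ (hasBasis A)

      ⟨A,⟩ : ∀ i y → ⟨ A i , y ⟩ ≡ (initial y (head (element S i)) ℚ.- initial y (tail (element S i))) ℚ.+ 𝐰 (element S i) / 1 ℚ.* final y
      ⟨A,⟩ i y = sum-augmented (_/ 1) refl refl refl G 𝐰 (element S i) y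

      ⟨A,augment⟩ : ∀ i x k → ⟨ A i , augment x k ⟩ ≡ (x (head (element S i)) ℚ.- x (tail (element S i))) ℚ.+ 𝐰 (element S i) / 1 ℚ.* k
      ⟨A,augment⟩ i x k = trans (⟨A,⟩ i (augment x k)) (cong₂ (λ a b → a ℚ.+ 𝐰 (element S i) / 1 ℚ.* b)
        (cong₂ ℚ._-_ (initial-augment x k _) (initial-augment x k _)) (final-augment x k))

      indicatorOf : Fin #C → Vector ℚ n
      indicatorOf j v = unit j (component v)

      A⊥indicator : ∀ i j → ⟨ A i , augment (indicatorOf j) 0ℚ ⟩ ≡ 0ℚ
      A⊥indicator i j = trans (⟨A,augment⟩ i (indicatorOf j) 0ℚ) (trans
        (cong (λ c → (unit j c ℚ.- unit j (component (tail (element S i)))) ℚ.+ 𝐰 (element S i) / 1 ℚ.* 0ℚ) (sym (component-edge (element-∈ S i))))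
        (solve 2 (λ a b → (a :- a) :+ b :* con 0ℚ := con 0ℚ) refl (unit j (component (tail (element S i)))) (𝐰 (element S i) / 1)))

      ⟨root,indicator⟩ : ∀ i k j → ⟨ augment (unit (root i)) k , augment (indicatorOf j) 0ℚ ⟩ ≡ unit j i
      ⟨root,indicator⟩ i k j = begin
        ⟨ augment (unit (root i)) k , augment (indicatorOf j) 0ℚ ⟩
          ≡⟨ ⟨augment-unit,⟩ (root i) k (augment (indicatorOf j) 0ℚ) ⟩
        initial (augment (indicatorOf j) 0ℚ) (root i) ℚ.+ k ℚ.* final (augment (indicatorOf j) 0ℚ)
          ≡⟨ cong₂ (λ a b → a ℚ.+ k ℚ.* b) (initial-augment (indicatorOf j) 0ℚ (root i)) (final-augment (indicatorOf j) 0ℚ) ⟩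
        unit j (component (root i)) ℚ.+ k ℚ.* 0ℚ
          ≡⟨ trans (cong (unit j (component (root i)) ℚ.+_) (ℚ.*-zeroʳ k)) (ℚ.+-identityʳ _) ⟩
        unit j (component (root i))
          ≡⟨ cong (unit j) (component-root i) ⟩
        unit j i ∎

      -- With last coordinate 0 the rows say that the vertex function has zero coboundary on `S`; it
      -- is constant on components and determined by its values at the roots.
      kernel-trivial : ∀ y → (∀ i → ⟨ A i , y ⟩ ≡ 0ℚ) → final y ≡ 0ℚ → (∀ j → initial y (root j) ≡ 0ℚ) → ∀ i → y i ≡ 0ℚ
      kernel-trivial y A⊥y final≡0 root≡0 = initial-final-≡0 y (λ v → trans (constant v) (root≡0 (component v))) final≡0
        where
        x : Vector ℚ n
        x = initial y
        constant : ∀ v → x v ≡ x (rootOf v)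
        constant = connected {_~_ = λ u v → x u ≡ x v} (record { refl = refl ; sym = sym ; trans = trans }) (onRows λ i →
          sym (zero-difference (trans (sym (trans (⟨A,⟩ i y) (trans (cong (λ k → (x (head (element S i)) ℚ.- x (tail (element S i))) ℚ.+ 𝐰 (element S i) / 1 ℚ.* k) final≡0)
            (drop (x (head (element S i)) ℚ.- x (tail (element S i))) (𝐰 (element S i) / 1))))) (A⊥y i))))
          where
          open FactorProperties G 𝐰 S using (onRows)
          drop : ∀ a w → a ℚ.+ w ℚ.* 0ℚ ≡ a
          drop = solve 2 (λ a w → a :+ w :* con 0ℚ := a) refl
          zero-difference : ∀ {a b} → a ℚ.- b ≡ 0ℚ → a ≡ b
          zero-difference {a} {b} eq = trans (solve 2 (λ a b → a := (a :- b) :+ b) refl a b) (trans (cong (ℚ._+ b) eq) (ℚ.+-identityˡ b))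

    -- The kernel has a basis consisting of the component indicators and one further vector (-φ, 1),
    -- which gives a nullity of `suc #C`.
    rank-potential : ∃ (IsPotential 𝐰) → rank (augmentedOn G 𝐰 S) ℕ.+ suc #C ≡ n ℕ.+ 1
    rank-potential (φ , potential) = dimension-complement A E Y A⊥Y EY-≢ EY-≡ kernel basis
      where
      φ′ : Vector ℚ n
      φ′ v = φ v / 1
      E Y : Vectors (suc #C) (n ℕ.+ 1)
      E zero    = augment (λ _ → 0ℚ) 1ℚ
      -- The last coordinate is chosen so that evaluation at the root vanishes on (-φ, 1), as
      -- duality with `Y` requires.
      E (suc i) = augment (unit (root i)) (φ′ (root i))
      Y zero    = augment (λ v → ℚ.- φ′ v) 1ℚ
      Y (suc j) = augment (indicatorOf j) 0ℚ
      ⟨E₀,⟩ : ∀ y → ⟨ E zero , y ⟩ ≡ final y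
      ⟨E₀,⟩ y = trans (⟨augment,⟩ (λ _ → 0ℚ) 1ℚ y) (trans (cong₂ ℚ._+_ (sum-0 (λ v → 0ℚ ℚ.* initial y v) λ v → ℚ.*-zeroˡ (initial y v)) (ℚ.*-identityˡ (final y))) (ℚ.+-identityˡ (final y)))
      A⊥Y : ∀ i j → ⟨ A i , Y j ⟩ ≡ 0ℚ
      A⊥Y i (suc j) = A⊥indicator i j
      A⊥Y i zero    = begin
        ⟨ A i , Y zero ⟩
          ≡⟨ ⟨A,augment⟩ i (λ v → ℚ.- φ′ v) 1ℚ ⟩
        (ℚ.- φ′ (head e) ℚ.- ℚ.- φ′ (tail e)) ℚ.+ 𝐰 e / 1 ℚ.* 1ℚ
          ≡⟨ cong (λ w → (ℚ.- φ′ (head e) ℚ.- ℚ.- φ′ (tail e)) ℚ.+ w ℚ.* 1ℚ) (trans (cong (_/ 1) (sym (potential e (element-∈ S i)))) (Embedding.-‿homo ℚ-embedding (φ (head e)) (φ (tail e)))) ⟩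
        (ℚ.- φ′ (head e) ℚ.- ℚ.- φ′ (tail e)) ℚ.+ (φ′ (head e) ℚ.- φ′ (tail e)) ℚ.* 1ℚ
          ≡⟨ solve 2 (λ a b → (:- a :- :- b) :+ (a :- b) :* con 1ℚ := con 0ℚ) refl (φ′ (head e)) (φ′ (tail e)) ⟩
        0ℚ ∎
        where
        e : Fin m
        e = element S i
      EY-≢ : ∀ i j → i ≢ j → ⟨ E i , Y j ⟩ ≡ 0ℚ
      EY-≢ zero    zero    i≢j = contradiction refl i≢j
      EY-≢ zero    (suc j) _   = trans (⟨E₀,⟩ (Y (suc j))) (final-augment (indicatorOf j) 0ℚ)
      EY-≢ (suc i) zero    _   = begin
        ⟨ E (suc i) , Y zero ⟩
          ≡⟨ ⟨augment-unit,⟩ (root i) (φ′ (root i)) (Y zero) ⟩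
        initial (Y zero) (root i) ℚ.+ φ′ (root i) ℚ.* final (Y zero)
          ≡⟨ cong₂ (λ a b → a ℚ.+ φ′ (root i) ℚ.* b) (initial-augment (λ v → ℚ.- φ′ v) 1ℚ (root i)) (final-augment (λ v → ℚ.- φ′ v) 1ℚ) ⟩
        ℚ.- φ′ (root i) ℚ.+ φ′ (root i) ℚ.* 1ℚ
          ≡⟨ solve 1 (λ a → :- a :+ a :* con 1ℚ := con 0ℚ) refl (φ′ (root i)) ⟩
        0ℚ ∎
      EY-≢ (suc i) (suc j) i≢j = trans (⟨root,indicator⟩ i (φ′ (root i)) j) (unit-≢ j (i≢j ∘ cong suc))
      EY-≡ : ∀ i → ⟨ E i , Y i ⟩ ≡ 1ℚ
      EY-≡ zero    = trans (⟨E₀,⟩ (Y zero)) (final-augment (λ v → ℚ.- φ′ v) 1ℚ)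
      EY-≡ (suc i) = trans (⟨root,indicator⟩ i (φ′ (root i)) i) (unit-≡ i refl)
      kernel : ∀ y → (∀ i → ⟨ A i , y ⟩ ≡ 0ℚ) → (∀ j → ⟨ E j , y ⟩ ≡ 0ℚ) → ∀ i → y i ≡ 0ℚ
      kernel y A⊥y E⊥y = kernel-trivial y A⊥y final≡0 λ j → trans (sym (drop (initial y (root j)) (φ′ (root j))))
        (trans (cong (λ k → initial y (root j) ℚ.+ φ′ (root j) ℚ.* k) (sym final≡0)) (trans (sym (⟨augment-unit,⟩ (root j) (φ′ (root j)) y)) (E⊥y (suc j))))
        where
        final≡0 : final y ≡ 0ℚ
        final≡0 = trans (sym (⟨E₀,⟩ y)) (E⊥y zero)
        drop : ∀ a w → a ℚ.+ w ℚ.* 0ℚ ≡ a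
        drop = solve 2 (λ a w → a :+ w :* con 0ℚ := a) refl

    -- A kernel vector with nonzero last coordinate could be rescaled to a rational potential, which
    -- descends to ℤ. Hence only the component indicators span the kernel.
    rank-¬potential : ¬ ∃ (IsPotential 𝐰) → rank (augmentedOn G 𝐰 S) ℕ.+ #C ≡ n ℕ.+ 1
    rank-¬potential none = dimension-complement A E (λ j → augment (indicatorOf j) 0ℚ) A⊥indicator
      (λ i j i≢j → trans (⟨root,indicator⟩ i 0ℚ j) (unit-≢ j i≢j))
      (λ i → trans (⟨root,indicator⟩ i 0ℚ i) (unit-≡ i refl)) kernel basis
      where
      E : Vectors #C (n ℕ.+ 1)
      E i = augment (unit (root i)) 0ℚ
      kernel : ∀ y → (∀ i → ⟨ A i , y ⟩ ≡ 0ℚ) → (∀ j → ⟨ E j , y ⟩ ≡ 0ℚ) → ∀ i → y i ≡ 0ℚ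
      kernel y A⊥y E⊥y with final y ℚ.≟ 0ℚ
      ... | yes final≡0 = kernel-trivial y A⊥y final≡0 λ j → trans (sym (trans (⟨augment-unit,⟩ (root j) 0ℚ y)
              (solve 2 (λ a b → a :+ con 0ℚ :* b := a) refl (initial y (root j)) (final y)))) (E⊥y j)
      ... | no final≢0  = contradiction (potential-descends ℚ.+-0-abelianGroup ℚ-embedding G S 𝐰 x (onRows solution)) none
        where
        open FactorProperties G 𝐰 S using (onRows)
        instance _ = ℚ.≢-nonZero final≢0
        -- Scaling by -1 / `final y` turns δ y + `final y` 𝐰 = 0 into δ x = 𝐰.
        c : ℚ
        c = ℚ.- ℚ.1/ final y
        x : Vector ℚ n
        x v = initial y v ℚ.* c
        solution : ∀ i → x (head (element S i)) ℚ.- x (tail (element S i)) ≡ 𝐰 (element S i) / 1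
        solution i = begin
          a ℚ.* c ℚ.- b ℚ.* c
            ≡⟨ solve 5 (λ a b w f i → a :* (:- i) :- b :* (:- i) := ((a :- b) :+ w :* f) :* (:- i) :+ w :* (f :* i)) refl a b w (final y) (ℚ.1/ final y) ⟩
          ((a ℚ.- b) ℚ.+ w ℚ.* final y) ℚ.* c ℚ.+ w ℚ.* (final y ℚ.* ℚ.1/ final y)
            ≡⟨ cong₂ (λ p q → p ℚ.* c ℚ.+ w ℚ.* q) (trans (sym (⟨A,⟩ i y)) (A⊥y i)) (ℚ.*-inverseʳ (final y)) ⟩
          0ℚ ℚ.* c ℚ.+ w ℚ.* 1ℚ
            ≡⟨ solve 2 (λ c w → con 0ℚ :* c :+ w :* con 1ℚ := w) refl c w ⟩
          w ∎
          where
          a b w : ℚ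
          a = initial y (head (element S i))
          b = initial y (tail (element S i))
          w = 𝐰 (element S i) / 1

    potential⇒equalRank : ∃ (IsPotential 𝐰) → EqualRank G 𝐰 S
    potential⇒equalRank potential = trans (sym (ℕ.m+n∸n≡m (rank (augmentedOn G 𝐰 S)) #C)) (cong (_∸ #C) (ℕ.suc-injective
      (trans (sym (ℕ.+-suc _ #C)) (trans (rank-potential potential) (ℕ.+-comm n 1)))))

    -- The rank exceeds that of the graph by exactly one. As `#C` is at most `n`, the truncated
    -- subtraction in `graphRank` is exact, and equality would give n = n + 1.
    ¬potential⇒¬equalRank : ¬ ∃ (IsPotential 𝐰) → ¬ EqualRank G 𝐰 S
    ¬potential⇒¬equalRank none equal = ℕ.m≢1+m+n n (trans (sym (ℕ.m∸n+n≡m numComponents-≤))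
      (trans (cong (ℕ._+ #C) (sym equal)) (trans (rank-¬potential none) (trans (ℕ.+-comm n 1) (cong suc (sym (ℕ.+-identityʳ n)))))))

    equalRank⇒potential : EqualRank G 𝐰 S → ∃ (IsPotential 𝐰)
    equalRank⇒potential equal = decidable-stable (potential? G S 𝐰) λ none → ¬potential⇒¬equalRank none equal

open RankTheory using (module RankProperties)

-- Intersections over the real numbers

module RealProperties {c ℓ₁ ℓ₂} (ℝ : RealNumbers c ℓ₁ ℓ₂) where
  open RealNumbers ℝ using (_<_; isStrictPartialOrder; #⇔<⊎>; +-monoˡ-<; *-positive; fromℤ; _·_; invertible⇒#; heytingField; heytingCommutativeRing)
  private
    ring : CommutativeRing c ℓ₁
    ring = HeytingCommutativeRing.commutativeRing heytingCommutativeRing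
  open CommutativeRing ring hiding (ring) renaming (refl to ≈-refl; sym to ≈-sym; trans to ≈-trans; zero to *-zero)
  open RingProperties (CommutativeRing.ring ring) using (-0#≈0#; -‿involutive; -‿distribˡ-*; -‿+-comm; +-cancelˡ) renaming (x∙y⁻¹≈ε⇒x≈y to x-y≈0⇒x≈y; x≈y⇒x∙y⁻¹≈ε to x≈y⇒x-y≈0)
  open Mult +-monoid using (×-homo-+)
  open IsStrictPartialOrder isStrictPartialOrder using (irrefl; <-respˡ-≈; <-respʳ-≈) renaming (trans to <-trans)
  open import Relation.Binary.Reasoning.Setoid setoid

  -- An invertible difference makes 1 apart from 0, so one of the two is smaller. If it were 1, then
  -- -1 would be positive, and so would its square 1.
  0<1 : 0# < 1#
  0<1 = [ (λ 1<0 → <-respʳ-≈ square (*-positive (0<-1 1<0) (0<-1 1<0))) , id ]′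
    (Equivalence.to (#⇔<⊎> 1# 0#) (invertible⇒# (1# , ≈-trans (*-identityˡ _) 1-0 , ≈-trans (*-identityʳ _) 1-0)))
    where
    1-0 : 1# - 0# ≈ 1#
    1-0 = ≈-trans (+-congˡ -0#≈0#) (+-identityʳ 1#)
    0<-1 : 1# < 0# → 0# < - 1#
    0<-1 1<0 = <-respˡ-≈ (-‿inverseʳ 1#) (<-respʳ-≈ (+-identityˡ (- 1#)) (+-monoˡ-< (- 1#) 1<0))
    square : - 1# * - 1# ≈ 1#
    square = ≈-trans (≈-sym (-‿distribˡ-* 1# (- 1#))) (≈-trans (-‿cong (*-identityˡ (- 1#))) (-‿involutive 1#))

  0<·1 : ∀ k → 0# < suc k · 1#
  0<·1 zero    = <-respʳ-≈ (≈-sym (+-identityʳ 1#)) 0<1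
  0<·1 (suc k) = <-trans 0<1 (<-respˡ-≈ (+-identityˡ 1#) (<-respʳ-≈ (+-comm (suc k · 1#) 1#) (+-monoˡ-< 1# (0<·1 k))))

  -- The order forces characteristic zero: a positive multiple of 1 is positive, hence not 0.
  fromℤ-≈0 : ∀ z → fromℤ z ≈ 0# → z ≡ 0ℤ
  fromℤ-≈0 (+ zero)    _  = refl
  fromℤ-≈0 (+ suc k)   eq = contradiction (0<·1 k) (irrefl (≈-sym eq))
  fromℤ-≈0 -[1+ k ]    eq = contradiction (0<·1 k) (irrefl (≈-sym (≈-trans (≈-sym (-‿involutive _)) (≈-trans (-‿cong eq) -0#≈0#))))

  fromℤ-⊖ : ∀ m n → fromℤ (m ℤ.⊖ n) ≈ m · 1# - n · 1#
  fromℤ-⊖ zero    zero    = ≈-sym (-‿inverseʳ 0#)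
  fromℤ-⊖ (suc m) zero    = ≈-sym (≈-trans (+-congˡ -0#≈0#) (+-identityʳ _))
  fromℤ-⊖ zero    (suc n) = ≈-sym (+-identityˡ _)
  fromℤ-⊖ (suc m) (suc n) = begin
    fromℤ (suc m ℤ.⊖ suc n)               ≈⟨ reflexive (cong fromℤ (ℤ.[1+m]⊖[1+n]≡m⊖n m n)) ⟩
    fromℤ (m ℤ.⊖ n)                       ≈⟨ fromℤ-⊖ m n ⟩
    m · 1# - n · 1#                       ≈⟨ +-congʳ (≈-trans (+-congʳ (-‿inverseʳ 1#)) (+-identityˡ _)) ⟨
    ((1# - 1#) + m · 1#) - n · 1#         ≈⟨ +-congʳ (≈-trans (+-assoc _ _ _) (≈-trans (+-congˡ (+-comm _ _)) (≈-sym (+-assoc _ _ _)))) ⟩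
    ((1# + m · 1#) - 1#) - n · 1#         ≈⟨ ≈-trans (+-assoc _ _ _) (+-congˡ (-‿+-comm 1# (n · 1#))) ⟩
    (1# + m · 1#) - (1# + n · 1#)         ∎

  fromℤ-neg : ∀ k → fromℤ (ℤ.- (+ k)) ≈ - (k · 1#)
  fromℤ-neg zero    = ≈-sym -0#≈0#
  fromℤ-neg (suc k) = ≈-refl

  fromℤ-minus : ∀ x y → fromℤ (x ℤ.- y) ≈ fromℤ x - fromℤ y
  fromℤ-minus (+ m)    (+ n)    = ≈-trans (reflexive (cong fromℤ (ℤ.m-n≡m⊖n m n))) (fromℤ-⊖ m n)
  fromℤ-minus (+ m)    -[1+ n ] = ≈-trans (×-homo-+ 1# m (suc n)) (+-congˡ (≈-sym (-‿involutive _)))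
  fromℤ-minus -[1+ m ] (+ n)    = begin
    fromℤ (-[1+ m ] ℤ.- + n)           ≈⟨ reflexive (cong fromℤ (ℤ.neg-distrib-+ (+ suc m) (+ n))) ⟨
    fromℤ (ℤ.- (+ (suc m ℕ.+ n)))      ≈⟨ fromℤ-neg (suc m ℕ.+ n) ⟩
    - ((suc m ℕ.+ n) · 1#)             ≈⟨ -‿cong (×-homo-+ 1# (suc m) n) ⟩
    - (suc m · 1# + n · 1#)            ≈⟨ -‿+-comm _ _ ⟨
    - (suc m · 1#) - n · 1#            ∎
  fromℤ-minus -[1+ m ] -[1+ n ] = begin
    fromℤ (suc n ℤ.⊖ suc m)            ≈⟨ fromℤ-⊖ (suc n) (suc m) ⟩
    suc n · 1# - suc m · 1#            ≈⟨ +-comm _ _ ⟩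
    - (suc m · 1#) + suc n · 1#        ≈⟨ +-congˡ (-‿involutive _) ⟨
    - (suc m · 1#) - - (suc n · 1#)    ∎

  fromℤ-embedding : Embedding +-abelianGroup
  fromℤ-embedding = record
    { ι = fromℤ
    ; -‿homo = fromℤ-minus
    ; injective = λ {x} {y} eq → ℤ.i-j≡0⇒i≡j x y (fromℤ-≈0 (x ℤ.- y) (≈-trans (fromℤ-minus x y) (x≈y⇒x-y≈0 eq)))
    }

  module _ {n m} (G : Graph n m) (𝐰 : Vector ℤ m) (S : Subset m) where
    open ComponentsOf G S
    open LinearAlgebra heytingField using (combination; Span; LinearlyIndependent; HasDimension; HasAffineDimension)
    open RingSums ring using (sum; sum-single; unit; unit-≡; unit-≢)

    intersection-empty : ¬ ∃ (IsPotential 𝐰) → ¬ ∃ (Intersection ℝ (affinographic ℝ G 𝐰) S)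
    intersection-empty none (x , x∈) = none (potential-descends +-abelianGroup fromℤ-embedding G S 𝐰 x x∈)

    private
      b : Vector (Vector Carrier n) #C
      b i v = unit i (component v)

      combination-b : ∀ a v → combination b a v ≈ a (component v)
      combination-b a v = ≈-trans (sum-single (component v) _ λ i i≢ → ≈-trans (*-congˡ (unit-≢ i (i≢ ∘ sym))) (zeroʳ (a i)))
        (≈-trans (*-congˡ (unit-≡ (component v) refl)) (*-identityʳ _))

      translate-difference : ∀ p₁ p₀ v₁ v₀ → (p₁ + v₁) - (p₀ + v₀) ≈ (p₁ - p₀) + (v₁ - v₀)
      translate-difference p₁ p₀ v₁ v₀ = begin
        (p₁ + v₁) - (p₀ + v₀)       ≈⟨ +-congˡ (-‿+-comm p₀ v₀) ⟨
        (p₁ + v₁) + (- p₀ + - v₀)   ≈⟨ +-assoc _ _ _ ⟩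
        p₁ + (v₁ + (- p₀ + - v₀))   ≈⟨ +-congˡ (≈-trans (≈-sym (+-assoc _ _ _)) (≈-trans (+-congʳ (+-comm _ _)) (+-assoc _ _ _))) ⟩
        p₁ + (- p₀ + (v₁ - v₀))     ≈⟨ +-assoc _ _ _ ⟨
        (p₁ - p₀) + (v₁ - v₀)       ∎

    -- The image of the integer potential serves as base point. The directions are the functions
    -- constant on components, with the component indicators as basis and the values at the roots as
    -- coordinates.
    intersection-dimension : ∃ (IsPotential 𝐰) → HasAffineDimension (Intersection ℝ (affinographic ℝ G 𝐰) S) #C
    intersection-dimension (φ , potential) = p , p∈ , b , independent , λ v → mk⇔ (to v) (from v)
      where
      p : Vector Carrier n
      p = fromℤ ∘ φ
      p∈ : ∀ e → e ∈ S → p (head e) - p (tail e) ≈ fromℤ (𝐰 e)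
      p∈ e e∈S = ≈-trans (≈-sym (fromℤ-minus (φ (head e)) (φ (tail e)))) (reflexive (cong fromℤ (potential e e∈S)))
      independent : LinearlyIndependent b
      independent a eq i = ≈-trans (reflexive (cong a (sym (component-root i)))) (≈-trans (≈-sym (combination-b a (root i))) (eq (root i)))
      to : ∀ v → (∀ e → e ∈ S → (p (head e) + v (head e)) - (p (tail e) + v (tail e)) ≈ fromℤ (𝐰 e)) → Span b v
      to v solves = v ∘ root , λ u → ≈-trans (constant u) (≈-sym (combination-b (v ∘ root) u))
        where
        constant : ∀ u → v u ≈ v (rootOf u)
        constant = connected {_~_ = λ u u′ → v u ≈ v u′} (record { refl = ≈-refl ; sym = ≈-sym ; trans = ≈-trans }) λ e e∈S →
          ≈-sym (x-y≈0⇒x≈y _ _ (+-cancelˡ (fromℤ (𝐰 e)) _ _ (begin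
            fromℤ (𝐰 e) + (v (head e) - v (tail e))
              ≈⟨ +-congʳ (p∈ e e∈S) ⟨
            (p (head e) - p (tail e)) + (v (head e) - v (tail e))
              ≈⟨ translate-difference _ _ _ _ ⟨
            (p (head e) + v (head e)) - (p (tail e) + v (tail e))
              ≈⟨ solves e e∈S ⟩
            fromℤ (𝐰 e)
              ≈⟨ +-identityʳ _ ⟨
            fromℤ (𝐰 e) + 0# ∎)))
      from : ∀ v → Span b v → ∀ e → e ∈ S → (p (head e) + v (head e)) - (p (tail e) + v (tail e)) ≈ fromℤ (𝐰 e)
      from v (a , eq) e e∈S = begin
        (p (head e) + v (head e)) - (p (tail e) + v (tail e))
          ≈⟨ translate-difference _ _ _ _ ⟩
        (p (head e) - p (tail e)) + (v (head e) - v (tail e))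
          ≈⟨ +-cong (p∈ e e∈S) (x≈y⇒x-y≈0 (≈-trans (value (head e)) (≈-trans (reflexive (cong a (sym (component-edge e∈S)))) (≈-sym (value (tail e)))))) ⟩
        fromℤ (𝐰 e) + 0#
          ≈⟨ +-identityʳ _ ⟩
        fromℤ (𝐰 e) ∎
        where
        value : ∀ u → v u ≈ a (component u)
        value u = ≈-trans (eq u) (combination-b a u)

-- Polynomials and the expansion

coefficient-+ₚ : ∀ p p′ i → coefficient (p +ₚ p′) i ≡ coefficient p i ℤ.+ coefficient p′ i
coefficient-+ₚ []      p′       i       = sym (ℤ.+-identityˡ _)
coefficient-+ₚ (a ∷ p) []       i       = sym (ℤ.+-identityʳ _)
coefficient-+ₚ (a ∷ p) (b ∷ p′) zero    = refl
coefficient-+ₚ (a ∷ p) (b ∷ p′) (suc i) = coefficient-+ₚ p p′ i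

evaluate-+ₚ : ∀ p p′ t → evaluate (p +ₚ p′) t ≡ evaluate p t ℤ.+ evaluate p′ t
evaluate-+ₚ []      p′       t = sym (ℤ.+-identityˡ _)
evaluate-+ₚ (a ∷ p) []       t = sym (ℤ.+-identityʳ _)
evaluate-+ₚ (a ∷ p) (b ∷ p′) t = trans (cong (λ x → a ℤ.+ b ℤ.+ t ℤ.* x) (evaluate-+ₚ p p′ t)) (regroup a b t (evaluate p t) (evaluate p′ t))
  where
  regroup : ∀ a b t x y → a ℤ.+ b ℤ.+ t ℤ.* (x ℤ.+ y) ≡ (a ℤ.+ t ℤ.* x) ℤ.+ (b ℤ.+ t ℤ.* y)
  regroup = solve-∀

evaluate-monomial : ∀ a d t → evaluate (monomial a d) t ≡ a ℤ.* t ℤ.^ d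
evaluate-monomial a zero    t = constant a t
  where
  constant : ∀ a t → a ℤ.+ t ℤ.* 0ℤ ≡ a ℤ.* 1ℤ
  constant = solve-∀
evaluate-monomial a (suc d) t = trans (cong (λ x → 0ℤ ℤ.+ t ℤ.* x) (evaluate-monomial a d t)) (shift a t (t ℤ.^ d))
  where
  shift : ∀ a t x → 0ℤ ℤ.+ t ℤ.* (a ℤ.* x) ≡ a ℤ.* (t ℤ.* x)
  shift = solve-∀

evaluate-sumOverₚ : ∀ {A : Set} (xs : List A) f t → evaluate (sumOverₚ xs f) t ≡ sumOver xs λ x → evaluate (f x) t
evaluate-sumOverₚ []       f t = refl
evaluate-sumOverₚ (x ∷ xs) f t = trans (evaluate-+ₚ (f x) (sumOverₚ xs f) t) (cong (ℤ._+_ (evaluate (f x) t)) (evaluate-sumOverₚ xs f t))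

sumOver-filter : ∀ {A : Set} {P : A → Set} (P? : Decidable P) xs f →
                 sumOver (List.filter P? xs) f ≡ sumOver xs λ x → if does (P? x) then f x else 0ℤ
sumOver-filter P? []       f = refl
sumOver-filter P? (x ∷ xs) f with does (P? x)
... | true  = cong (ℤ._+_ (f x)) (sumOver-filter P? xs f)
... | false = trans (sumOver-filter P? xs f) (sym (ℤ.+-identityˡ _))

sumOverₚ-filter : ∀ {A : Set} {P : A → Set} (P? : Decidable P) xs f →
                  sumOverₚ (List.filter P? xs) f ≈ₚ sumOverₚ xs λ x → if does (P? x) then f x else []
sumOverₚ-filter P? []       f i = refl
sumOverₚ-filter P? (x ∷ xs) f i with does (P? x)
... | true  = trans (coefficient-+ₚ (f x) _ i) (trans (cong (ℤ._+_ (coefficient (f x) i)) (sumOverₚ-filter P? xs f i)) (sym (coefficient-+ₚ (f x) _ i)))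
... | false = sumOverₚ-filter P? xs f i

∈-subsets : ∀ {m} (S : Subset m) → S ∈ˡ subsets m
∈-subsets []            = Any.here refl
∈-subsets {suc m} (inside  ∷ S) = ∈-++⁺ˡ (∈-map⁺ (inside ∷_) (∈-subsets S))
∈-subsets {suc m} (outside ∷ S) = ∈-++⁺ʳ (List.map (inside ∷_) (subsets m)) (∈-map⁺ (outside ∷_) (∈-subsets S))

pos-^ : ∀ a k → + (a ℕ.^ k) ≡ (+ a) ℤ.^ k
pos-^ a zero    = refl
pos-^ a (suc k) = trans (ℤ.pos-* a (a ℕ.^ k)) (cong (+ a ℤ.*_) (pos-^ a k))

-- The subset expansion and the polynomial

module _ {n m} (G : Graph n m) (𝐰 : Vector ℤ m) where

  open RankProperties G 𝐰 using (potential⇒equalRank; equalRank⇒potential)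
  open FactorProperties G 𝐰 using (factor≡0⇒potential; potential-mod-factor; potential-mod⇒∣factor)

  -- Every `q` divides 0, so a zero factor would spoil the bound on `q`; it cannot occur, since it
  -- would produce a potential.
  factor≢0 : ∀ S → ¬ EqualRank G 𝐰 S → factor G 𝐰 S ≢ 0
  factor≢0 S unequal = unequal ∘ potential⇒equalRank S ∘ factor≡0⇒potential S

  private
    PotentialMod : ℕ → Subset m → Set
    PotentialMod q S = ∃ (ComponentsOf.IsPotentialMod G S (+ q) 𝐰)

    -- The two decisions are taken as arguments so that the cases follow the nested conditionals of
    -- `d̃`: an integer potential works modulo every `q`, and otherwise divisibility of the factor
    -- decides.
    potentialMod-dec : ∀ q .{{_ : NonZero q}} S → Dec (∃ (ComponentsOf.IsPotential G S 𝐰)) → Dec (q ℕ.∣ factor G 𝐰 S) → Dec (PotentialMod q S)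
    potentialMod-dec q S (yes (φ , potential)) _ = yes (φ , λ e e∈S → divides 0ℤ (ℤ.i≡j⇒i-j≡0 (potential e e∈S)))
    potentialMod-dec q S (no none) (no q∤)       = no (q∤ ∘ potential-mod⇒∣factor S none q (ℕ.≢-nonZero⁻¹ q))
    potentialMod-dec q S (no none) (yes q∣)      = yes (reduced (potential-mod-factor S (none ∘ factor≡0⇒potential S)))
      where
      reduced : PotentialMod (factor G 𝐰 S) S → PotentialMod q S
      reduced (φ , potential) = φ , λ e e∈S → ∣-trans (∣ᵤ⇒∣ q∣) (potential e e∈S)

    d̃-dec : ∀ q .{{_ : NonZero q}} S p (r : Dec (q ℕ.∣ factor G 𝐰 S)) →
      (if does (equalRank? G 𝐰 S) then 1 else if does r then 1 else 0) ≡ (if does (potentialMod-dec q S p r) then 1 else 0)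
    d̃-dec q S (yes potential) r  = cong (λ b → if b then 1 else if does r then 1 else 0) (dec-true (equalRank? G 𝐰 S) (potential⇒equalRank S potential))
    d̃-dec q S (no none) r@(no _)  = cong (λ b → if b then 1 else if does r then 1 else 0) (dec-false (equalRank? G 𝐰 S) (none ∘ equalRank⇒potential S))
    d̃-dec q S (no none) r@(yes _) = cong (λ b → if b then 1 else if does r then 1 else 0) (dec-false (equalRank? G 𝐰 S) (none ∘ equalRank⇒potential S))

  count-allViolated-d̃ : ∀ q .{{_ : NonZero q}} S →
    + count {n} {q} (allViolated? q G 𝐰 S) ≡ + d̃ G 𝐰 q S ℤ.* (+ q) ℤ.^ numComponents G S
  count-allViolated-d̃ q S = trans (by-case (potentialMod-dec q S p r)) (cong (λ k → + k ℤ.* (+ q) ℤ.^ numComponents G S) (sym (d̃-dec q S p r)))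
    where
    p : Dec (∃ (ComponentsOf.IsPotential G S 𝐰))
    p = potential? G S 𝐰
    r : Dec (q ℕ.∣ factor G 𝐰 S)
    r = q ℕ.∣? factor G 𝐰 S
    by-case : (d : Dec (PotentialMod q S)) →
              + count {n} {q} (allViolated? q G 𝐰 S) ≡ + (if does d then 1 else 0) ℤ.* (+ q) ℤ.^ numComponents G S
    by-case (yes (φ , potential)) = trans (cong +_ (count-allViolated q G 𝐰 S φ potential)) (trans (pos-^ q (numComponents G S)) (sym (ℤ.*-identityˡ _)))
    by-case (no none)             = cong +_ (count-allViolated-none q G 𝐰 S none)

  numColorings-expansion : ∀ q .{{_ : NonZero q}} → + numColorings q G (reduce q 𝐰)
    ≡ sumOver (subsets m) λ S → sign S ℤ.* + d̃ G 𝐰 q S ℤ.* (+ q) ℤ.^ numComponents G S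
  numColorings-expansion q = trans (numColorings-inclusion-exclusion q G 𝐰) (sumOver-cong (subsets m) λ S →
    trans (cong (sign S ℤ.*_) (count-allViolated-d̃ q S)) (sym (ℤ.*-assoc (sign S) _ _)))

  factor≤qBound : ∀ S → ¬ EqualRank G 𝐰 S → factor G 𝐰 S ℕ.≤ qBound G 𝐰
  factor≤qBound S unequal = All.lookup (xs≤max 0 (List.map (factor G 𝐰) unequals))
    (∈-map⁺ (factor G 𝐰) (∈-filter⁺ (¬? ∘ equalRank? G 𝐰) (∈-subsets S) unequal))
    where
    unequals : List (Subset m)
    unequals = List.filter (¬? ∘ equalRank? G 𝐰) (subsets m)

  -- A `q` beyond the bound exceeds every positive factor that occurs and so divides none of them.
  d̃-large : ∀ q → qBound G 𝐰 ℕ.< q → ∀ S → d̃ G 𝐰 q S ≡ (if does (equalRank? G 𝐰 S) then 1 else 0)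
  d̃-large q large S = by-case (equalRank? G 𝐰 S) (q ℕ.∣? factor G 𝐰 S)
    where
    by-case : (e : Dec (EqualRank G 𝐰 S)) (r : Dec (q ℕ.∣ factor G 𝐰 S)) →
              (if does e then 1 else if does r then 1 else 0) ≡ (if does e then 1 else 0)
    by-case (yes _)      r        = refl
    by-case (no unequal) (no _)   = refl
    by-case (no unequal) (yes q∣) = contradiction (ℕ.∣⇒≤ {{ℕ.≢-nonZero (factor≢0 S unequal)}} q∣) (ℕ.<⇒≱ (ℕ.≤-<-trans (factor≤qBound S unequal) large))

  chromatic : Polynomial
  chromatic = sumOverₚ (List.filter (equalRank? G 𝐰) (subsets m)) λ S → monomial (sign S) (numComponents G S)

  numColorings-large : ∀ q .{{_ : NonZero q}} → qBound G 𝐰 ℕ.< q → + numColorings q G (reduce q 𝐰) ≡ evaluate chromatic (+ q)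
  numColorings-large q large = begin
    + numColorings q G (reduce q 𝐰)
      ≡⟨ numColorings-expansion q ⟩
    sumOver (subsets m) (λ S → sign S ℤ.* + d̃ G 𝐰 q S ℤ.* (+ q) ℤ.^ numComponents G S)
      ≡⟨ sumOver-cong (subsets m) (λ S → trans (cong (λ k → sign S ℤ.* + k ℤ.* (+ q) ℤ.^ numComponents G S) (d̃-large q large S))
           (by-case (does (equalRank? G 𝐰 S)) (sign S) ((+ q) ℤ.^ numComponents G S))) ⟩
    sumOver (subsets m) (λ S → if does (equalRank? G 𝐰 S) then sign S ℤ.* (+ q) ℤ.^ numComponents G S else 0ℤ)
      ≡⟨ sumOver-filter (equalRank? G 𝐰) (subsets m) _ ⟨
    sumOver (List.filter (equalRank? G 𝐰) (subsets m)) (λ S → sign S ℤ.* (+ q) ℤ.^ numComponents G S)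
      ≡⟨ sumOver-cong (List.filter (equalRank? G 𝐰) (subsets m)) (λ S → evaluate-monomial (sign S) (numComponents G S) (+ q)) ⟨
    sumOver (List.filter (equalRank? G 𝐰) (subsets m)) (λ S → evaluate (monomial (sign S) (numComponents G S)) (+ q))
      ≡⟨ evaluate-sumOverₚ (List.filter (equalRank? G 𝐰) (subsets m)) _ (+ q) ⟨
    evaluate chromatic (+ q) ∎
    where
    open ≡-Reasoning
    by-case : ∀ b s t → s ℤ.* + (if b then 1 else 0) ℤ.* t ≡ (if b then s ℤ.* t else 0ℤ)
    by-case true  s t = cong (ℤ._* t) (ℤ.*-identityʳ s)
    by-case false s t = trans (cong (ℤ._* t) (ℤ.*-zeroʳ s)) (ℤ.*-zeroˡ t)

  -- Equality of ranks decides, through integer potentials, whether a real intersection is nonempty;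
  -- the sets left out of the filtered sum contribute the zero polynomial.
  chromatic-characteristic : ∀ {c ℓ₁ ℓ₂} (ℝ : RealNumbers c ℓ₁ ℓ₂) → IsCharacteristicPolynomial ℝ (affinographic ℝ G 𝐰) chromatic
  chromatic-characteristic ℝ = term , isTerm , sumOverₚ-filter (equalRank? G 𝐰) (subsets m) _
    where
    open RealProperties ℝ
    term : Subset m → Polynomial
    term S = if does (equalRank? G 𝐰 S) then monomial (sign S) (numComponents G S) else []
    by-case : ∀ S (e : Dec (EqualRank G 𝐰 S)) → IsTerm ℝ (affinographic ℝ G 𝐰) S (if does e then monomial (sign S) (numComponents G S) else [])
    by-case S (yes equal)  = inj₁ (numComponents G S , intersection-dimension G 𝐰 S (equalRank⇒potential S equal) , λ _ → refl)
    by-case S (no unequal) = inj₂ (intersection-empty G 𝐰 S (unequal ∘ potential⇒equalRank S) , λ _ → refl)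
    isTerm : ∀ S → IsTerm ℝ (affinographic ℝ G 𝐰) S (term S)
    isTerm S = by-case S (equalRank? G 𝐰 S)

open import Data.Integer using (ℤ; +_) renaming (_*_ to _*ℤ_; _^_ to _^ℤ_)
open import Data.List using (filter)
open import Data.Nat using (ℕ; NonZero; _*_; _≤_; _<_)
open import Data.Nat.Properties using (m*n≢0)
open import Data.Product using (∃; _×_)
open import Data.Vec.Functional using (Vector)
open import Relation.Binary.PropositionalEquality using (_≡_)

corollary4p1 :
  ∀ {c ℓ₁ ℓ₂} (n m : ℕ) (G : Graph n m) (𝐰 : Vector ℤ m) →
    (∀ q .{{_ : NonZero q}} →
      + numColorings q G (reduce q 𝐰)
        ≡ sumOver (subsets m) λ S → sign S *ℤ + d̃ G 𝐰 q S *ℤ (+ q) ^ℤ numComponents G S)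
    × (∃ λ (χ : Polynomial) →
        (∀ q .{{_ : NonZero q}} → qBound G 𝐰 < q →
          + numColorings q G (reduce q 𝐰) ≡ evaluate χ (+ q))
        × χ ≈ₚ sumOverₚ (filter (equalRank? G 𝐰) (subsets m)) (λ S → monomial (sign S) (numComponents G S))
        × (∀ (ℝ : RealNumbers c ℓ₁ ℓ₂) →
            IsCharacteristicPolynomial ℝ (affinographic ℝ G 𝐰) χ))
    × (∀ p q .{{_ : NonZero p}} .{{_ : NonZero q}} →
        numColorings q G (reduce q 𝐰)
          ≤ numColorings (p * q) {{m*n≢0 p q}} G (reduce (p * q) {{m*n≢0 p q}} 𝐰))
corollary4p1 n m G 𝐰 =
  numColorings-expansion G 𝐰 ,
  (chromatic G 𝐰 , numColorings-large G 𝐰 , (λ _ → refl) , chromatic-characteristic G 𝐰) ,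
  λ p q → numColorings-mono G 𝐰 p q {{pq≢0 = m*n≢0 p q}}
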